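{- Each caterpillar can be reconstructed from its $U$-polynomial.
   Context: A leaf of a tree is a vertex of degree one. A caterpillar is a tree in which all edges not incident with a leaf form a path. The $U$-polynomial of a graph $G=(V,E)$ is defined as follows. For $A\subseteq E$ let $c(A)$ be the number of connected components of the spanning subgraph $(V,A)$, let $n_1\ge\dots\ge n_{c(A)}$ be the numbers of vertices of these components, and let $x(A)=\prod_{i=1}^{c(A)}x_{n_i}$, where $x_1,x_2,\dots$ are indeterminates. Then $$U_G(z,x_1,x_2,\dots)=\sum_{A\subseteq E}x(A)(z-1)^{|A|-|V|+c(A)}.$$ (For a tree the exponent of $z-1$ is always $0$.) "Reconstructed" is meant in the constructive sense: the tree itself can be effectively recovered from the knowledge of its $U$-polynomial. This is regarded as a different and harder task than showing, possibly non-constructively, that non-isomorphic trees have different $U$-polynomials. -}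

module Defs where

open import Data.Fin.Base using (Fin)
open import Data.Fin.Properties using (_<?_) renaming (_≟_ to _≟ᶠ_)
open import Data.Integer.Base using (ℤ; 0ℤ; 1ℤ; -1ℤ) renaming (_+_ to _+ℤ_; _*_ to _*ℤ_)
open import Data.List.Base
  using (List; []; _∷_; _++_; _∷ʳ_; map; foldr; filter; length; allFin; cartesianProduct;
         cartesianProductWith; deduplicate)
open import Data.List.Membership.Propositional using (_∈_)
open import Data.List.Membership.Propositional.Properties using (∈-∃++)
open import Data.List.Relation.Binary.Permutation.Propositional
  using (_↭_; ↭-refl; ↭-sym; ↭-trans; prep)
open import Data.List.Relation.Binary.Permutation.Propositional.Properties
  using (∈-resp-↭; ↭-empty-inv; drop-∷; shift)
open import Data.List.Relation.Unary.Any using (here; there)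
open import Data.List.Relation.Unary.Linked using (Linked)
open import Data.List.Relation.Unary.Unique.Propositional using (Unique)
open import Data.Nat.Base using (ℕ; zero; suc; _≤_; _+_; _∸_; NonZero)
open import Data.Nat.Properties using () renaming (_≟_ to _≟ℕ_)
open import Data.Product.Base using (Σ-syntax; ∃-syntax; _×_; _,_; proj₁; proj₂)
open import Data.Sum.Base using (_⊎_; inj₁; inj₂)
open import Function.Bundles using (_⇔_; _↔_; Inverse)
open import Level using (0ℓ)
open import Relation.Binary.Core using (Rel)
open import Relation.Binary.Construct.Closure.Equivalence as EqC using (EqClosure)
open import Relation.Binary.Construct.Closure.ReflexiveTransitive using (Star; ε; _◅_; _◅◅_)
open import Relation.Binary.Construct.Closure.Symmetric using (fwd; bwd)
open import Relation.Binary.Definitions using (Decidable; DecidableEquality; Symmetric; Irreflexive)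
open import Relation.Binary.PropositionalEquality.Core using (_≡_; refl; cong)
open import Relation.Nullary.Decidable.Core using (yes; no; map′; _×-dec_; _⊎-dec_)
open import Relation.Nullary.Negation.Core using (¬_)

------------------------------------------------------------------------
-- The polynomial ring ℤ[z, x₁, x₂, …]

-- The constructor x also provides an indeterminate x 0, which does not
-- occur in any U-polynomial.
data Var : Set where
  z : Var
  x : ℕ → Var

_≟ᵛ_ : DecidableEquality Var
z   ≟ᵛ z   = yes refl
z   ≟ᵛ x _ = no λ ()
x _ ≟ᵛ z   = no λ ()
x m ≟ᵛ x n = map′ (cong x) (λ { refl → refl }) (m ≟ℕ n)

open import Data.List.Membership.DecPropositional _≟ᵛ_ using (_∈?_)

-- A monomial is a word of indeterminates, considered up to _↭_.
Monomial : Set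
Monomial = List Var

_↭?_ : Decidable (_↭_ {A = Var})
[] ↭? []      = yes ↭-refl
[] ↭? (v ∷ m) = no λ p → case-[] (↭-empty-inv (↭-sym p))
  where
  case-[] : ¬ (v ∷ m ≡ [])
  case-[] ()
(v ∷ l) ↭? m with v ∈? m
... | no v∉m = no λ p → v∉m (∈-resp-↭ p (here refl))
... | yes v∈m with ∈-∃++ v∈m
...   | a , b , refl =
  map′ (λ p → ↭-trans (prep v p) (↭-sym (shift v a b)))
       (λ p → drop-∷ (↭-trans p (shift v a b)))
       (l ↭? (a ++ b))

-- A polynomial is a finite formal sum of terms, in which monomials may
-- be repeated; polynomials are considered up to _≈ₚ_.
Poly : Set
Poly = List (ℤ × Monomial)

coeff : Poly → Monomial → ℤ
coeff p m = foldr _+ℤ_ 0ℤ (map proj₁ (filter (λ t → proj₂ t ↭? m) p))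

infix 4 _≈ₚ_
_≈ₚ_ : Rel Poly 0ℓ
p ≈ₚ q = ∀ m → coeff p m ≡ coeff q m

const : ℤ → Poly
const c = (c , []) ∷ []

var : Var → Poly
var v = (1ℤ , v ∷ []) ∷ []

infixl 6 _+ₚ_
infixl 7 _*ₚ_
infixr 8 _^ₚ_

_+ₚ_ _*ₚ_ : Poly → Poly → Poly
p +ₚ q = p ++ q
p *ₚ q = cartesianProductWith (λ { (c , l) (d , m) → c *ℤ d , l ++ m }) p q

_^ₚ_ : Poly → ℕ → Poly
p ^ₚ zero  = const 1ℤ
p ^ₚ suc k = p *ₚ p ^ₚ k

sumₚ productₚ : List Poly → Poly
sumₚ     = foldr _+ₚ_ (const 0ℤ)
productₚ = foldr _*ₚ_ (const 1ℤ)

------------------------------------------------------------------------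
-- Finite simple graphs

record Graph : Set₁ where
  field
    order  : ℕ
    Adj    : Rel (Fin order) 0ℓ
    adj?   : Decidable Adj
    symm   : Symmetric Adj
    irrefl : Irreflexive _≡_ Adj

  Vertex : Set
  Vertex = Fin order

  degree : Vertex → ℕ
  degree v = length (filter (adj? v) (allFin order))

  Leaf : Vertex → Set
  Leaf v = degree v ≡ 1

  -- Each edge is listed once, with its smaller endpoint first.
  edges : List (Vertex × Vertex)
  edges = filter (λ { (u , v) → (u <? v) ×-dec adj? u v })
                 (cartesianProduct (allFin order) (allFin order))

open Graph using (order; Vertex; edges)

infix 4 _≅_
_≅_ : Graph → Graph → Set
G ≅ H = Σ[ f ∈ Vertex G ↔ Vertex H ]
          (∀ u v → Graph.Adj G u v ⇔ Graph.Adj H (Inverse.to f u) (Inverse.to f v))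

------------------------------------------------------------------------
-- Trees and caterpillars

module _ (G : Graph) where
  open Graph G hiding (order; Vertex; edges)

  Connected : Set
  Connected = ∀ u v → Star Adj u v

  -- v ∷ vs lists the vertices of a cycle in cyclic order.
  Cycle : Vertex G → List (Vertex G) → Set
  Cycle v vs = 2 ≤ length vs × Unique (v ∷ vs) × Linked Adj (v ∷ vs ∷ʳ v)

  Acyclic : Set
  Acyclic = ∀ v vs → ¬ Cycle v vs

  record Tree : Set where
    field
      nonEmpty  : NonZero (order G)
      connected : Connected
      acyclic   : Acyclic

  Consecutive : List (Vertex G) → Rel (Vertex G) 0ℓ
  Consecutive p u v = ∃[ a ] ∃[ b ] p ≡ a ++ u ∷ v ∷ b

  InnerEdge : Rel (Vertex G) 0ℓ
  InnerEdge u v = Adj u v × ¬ Leaf u × ¬ Leaf v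

  -- The path may have no edges, so that stars are caterpillars.
  InnerEdgesFormPath : Set
  InnerEdgesFormPath =
    ∃[ p ] Unique p × (∀ u v → InnerEdge u v ⇔ (Consecutive p u v ⊎ Consecutive p v u))

  Caterpillar : Set
  Caterpillar = Tree × InnerEdgesFormPath

------------------------------------------------------------------------
-- Connected components of the graph on Fin n with edge list A

module _ {n : ℕ} where

  Joined : List (Fin n × Fin n) → Rel (Fin n) 0ℓ
  Joined A = EqClosure (λ u v → (u , v) ∈ A)

  private
    Via : Fin n → Fin n → List (Fin n × Fin n) → Rel (Fin n) 0ℓ
    Via a b A u v = Joined A u v ⊎ (Joined A u a × Joined A b v) ⊎ (Joined A u b × Joined A a v)

    weaken : ∀ {e A u v} → Joined A u v → Joined (e ∷ A) u v
    weaken = EqC.map there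

    via⇒joined : ∀ {a b A u v} → Via a b A u v → Joined ((a , b) ∷ A) u v
    via⇒joined (inj₁ p)              = weaken p
    via⇒joined (inj₂ (inj₁ (p , q))) = weaken p ◅◅ fwd (here refl) ◅ weaken q
    via⇒joined (inj₂ (inj₂ (p , q))) = weaken p ◅◅ bwd (here refl) ◅ weaken q

    joined⇒via : ∀ {a b A u v} → Joined ((a , b) ∷ A) u v → Via a b A u v
    joined⇒via ε = inj₁ ε
    joined⇒via (fwd (here refl) ◅ p) with joined⇒via p
    ... | inj₁ q              = inj₂ (inj₁ (ε , q))
    ... | inj₂ (inj₁ (_ , q)) = inj₂ (inj₁ (ε , q))
    ... | inj₂ (inj₂ (_ , q)) = inj₁ q
    joined⇒via (bwd (here refl) ◅ p) with joined⇒via p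
    ... | inj₁ q              = inj₂ (inj₂ (ε , q))
    ... | inj₂ (inj₁ (_ , q)) = inj₁ q
    ... | inj₂ (inj₂ (_ , q)) = inj₂ (inj₂ (ε , q))
    joined⇒via (fwd (there e) ◅ p) with joined⇒via p
    ... | inj₁ q              = inj₁ (fwd e ◅ q)
    ... | inj₂ (inj₁ (r , q)) = inj₂ (inj₁ (fwd e ◅ r , q))
    ... | inj₂ (inj₂ (r , q)) = inj₂ (inj₂ (fwd e ◅ r , q))
    joined⇒via (bwd (there e) ◅ p) with joined⇒via p
    ... | inj₁ q              = inj₁ (bwd e ◅ q)
    ... | inj₂ (inj₁ (r , q)) = inj₂ (inj₁ (bwd e ◅ r , q))
    ... | inj₂ (inj₂ (r , q)) = inj₂ (inj₂ (bwd e ◅ r , q))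

    joined-[] : ∀ {u v} → Joined [] u v → u ≡ v
    joined-[] ε            = refl
    joined-[] (fwd () ◅ _)
    joined-[] (bwd () ◅ _)

  joined? : ∀ A → Decidable (Joined A)
  joined? [] u v = map′ (λ { refl → ε }) joined-[] (u ≟ᶠ v)
  joined? ((a , b) ∷ A) u v =
    map′ via⇒joined joined⇒via
      (joined? A u v
        ⊎-dec (joined? A u a ×-dec joined? A b v)
        ⊎-dec (joined? A u b ×-dec joined? A a v))

  -- One vertex is kept from each component, hence one size for each.
  componentSizes : List (Fin n × Fin n) → List ℕ
  componentSizes A =
    map (λ v → length (filter (joined? A v) (allFin n))) (deduplicate (joined? A) (allFin n))

------------------------------------------------------------------------
-- The U-polynomial

-- For a list without repetitions, such as `edges G`, each subset of its
-- elements is listed exactly once.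
subsets : ∀ {X : Set} → List X → List (List X)
subsets []       = [] ∷ []
subsets (e ∷ es) = map (e ∷_) (subsets es) ++ subsets es

U : Graph → Poly
U G = sumₚ (map term (subsets (edges G)))
  where
  term : List (Vertex G × Vertex G) → Poly
  term A = productₚ (map (λ s → var (x s)) sizes)
             -- |V| ≤ |A| + c(A), so the subtraction is exact.
             *ₚ (var z +ₚ const -1ℤ) ^ₚ ((length A + length sizes) ∸ order G)
    where
    sizes : List ℕ
    sizes = componentSizes A

{-# OPTIONS --safe #-}

-- Only the coefficients of x_n, x_p x_q and x_p x_q x_r matter.  List the vertices
-- of a caterpillar along the spine, each spine vertex followed by its leaves, and
-- let a_k be 1 or 0 according to whether the vertex in position k + 2 is a spine
-- vertex, that is, whether cutting a spine edge separates the first k + 2 vertices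
-- from the others.  Let b be the reversed sequence.  The coefficients of x_p x_q
-- determine a + b.  Suppose that a second caterpillar, with sequences a′ and b′,
-- has the same coefficients, and put e = a − a′ and f = a − b′.  These sequences
-- have values in {−1, 0, 1}, are antisymmetric, and never are both nonzero in one
-- place.  The coefficients of x_p x_q x_r with p, q, r ≥ 2 turn into the relation
--   e_i f_j + f_i e_j = e_s (f_i + f_j) + f_s (e_i + e_j),  s = i + j + 2,
-- and those of x_1 x_p x_q, where leaves can be cut off, into
--   (e_{k+1} − e_k) F_k + (f_{k+1} − f_k) E_k = 0
-- with the partial sums E and F of e and f.  Summing the first relation over
-- i + j = t and inserting the second one shows that the convolution G of e and f
-- satisfies G(k) − G(k−1) = e_k f_{k+1} + f_k e_{k+1}.  If both e and f were
-- nonzero, this would fail shortly after the leading term of G, so e = 0 or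
-- f = 0, and the caterpillars agree up to reversal.  Hence a caterpillar can be
-- reconstructed by comparing its polynomial with those of all caterpillars.

module Submission where

open import Data.Bool.Base using (Bool; true; false; if_then_else_)
open import Data.Empty using (⊥; ⊥-elim)
open import Data.Fin.Base as Fin using (Fin)
open import Data.Fin.Properties as Finₚ using () renaming (_≟_ to _≟ᶠ_; _<?_ to _<?ᶠ_)
open import Data.Integer.Base
  using (ℤ; 0ℤ; 1ℤ; -1ℤ; -_; _+_; _*_; _-_; ≢-nonZero) renaming (+_ to int_)
open import Data.Integer.Properties
  using (+-assoc; +-comm; +-identityˡ; +-identityʳ; *-comm; *-distribˡ-+; *-identityˡ; *-identityʳ;
         *-zeroˡ; *-zeroʳ; *-cancelˡ-≡; i*j≡0⇒i≡0∨j≡0; i-j≡0⇒i≡j; pos-+; _≟_)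
open import Data.Integer.Tactic.RingSolver using (solve-∀)
open import Data.List.Base
  using (List; []; _∷_; _∷ʳ_; _∷ʳ′_; _++_; length; map; filter; take; drop; head; reverse; replicate;
         concat; concatMap; tabulate; allFin; cartesianProduct; deduplicate; initLast)
open import Data.List.Membership.Propositional using (_∈_; _∉_)
import Data.List.Membership.DecPropositional as DecMembership
open import Data.List.Membership.Propositional.Properties
  using (∈-map⁺; ∈-map⁻; ∈-filter⁺; ∈-filter⁻; ∈-cartesianProduct⁺; ∈-allFin; ∈-++⁻; ∈-++⁺ˡ; ∈-++⁺ʳ;
         ∈-concat⁺′; ∈-concatMap⁺; ∈-concatMap⁻)
open import Data.List.Membership.Propositional.Properties.WithK using (unique∧set⇒bag)
import Data.List.Membership.Setoid.Properties as SetoidMembership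
open import Data.List.Properties
  using (length-drop; length-++; length-reverse; length-map; length-tabulate; take-all; map-++; map-∘;
         map-cong; map-cong-local; map-injective; filter-≐; filter-accept; filter-reject; ∷-injective;
         ∷ʳ-injective; ++-assoc; ++-identityʳ; unfold-reverse; reverse-++; reverse-involutive; reverse-map)
open import Data.List.Relation.Binary.BagAndSetEquality using (∼bag⇒↭)
open import Data.List.Relation.Binary.Permutation.Propositional as ↭
  using (_↭_; ↭-refl; ↭-sym; ↭-trans; ↭-reflexive; ↭⇒↭ₛ)
open import Data.List.Relation.Binary.Permutation.Propositional.Properties
  using (map⁺; ∈-resp-↭; filter-↭; drop-∷; ↭-length; ↭-map-inv; ↭-reverse; ↭-singleton-inv)
open import Data.List.Relation.Binary.Permutation.Setoid.Properties using (Unique-resp-↭)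
open import Data.List.Relation.Unary.All as All using (All; []; _∷_)
import Data.List.Relation.Unary.All.Properties as Allₚ
open import Data.List.Relation.Unary.AllPairs as AllPairs using (AllPairs; []; _∷_)
import Data.List.Relation.Unary.AllPairs.Properties as AllPairsₚ
open import Data.List.Relation.Unary.Any as Any using (Any; here; there)
import Data.List.Relation.Unary.Any.Properties as Anyₚ
import Data.List.Relation.Unary.Unique.DecSetoid.Properties as DecSetoidUnique
open import Data.List.Relation.Unary.Unique.Propositional using (Unique)
import Data.List.Relation.Unary.Unique.Propositional.Properties as Uniqueₚ
open import Data.Maybe.Base using (fromMaybe)
open import Data.Nat.Base as ℕ using (ℕ; zero; suc; _≤_; _<_; z≤n; s≤s)
import Data.Nat.Properties as ℕₚ
open import Data.Nat.Tactic.RingSolver using () renaming (solve-∀ to ℕ-solve-∀)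
open import Data.Product.Base using (Σ-syntax; ∃-syntax; _×_; _,_; proj₁; proj₂; map₁; swap)
open import Data.Product.Properties using (≡-dec)
open import Data.Sum.Base as Sum using (_⊎_; inj₁; inj₂)
open import Function.Base using (_∘_; case_of_; flip; id)
open import Function.Bundles using (Equivalence; _⇔_; mk⇔; mk↔ₛ′)
open import Relation.Binary.Bundles using (DecSetoid)
open import Relation.Binary.Construct.Closure.Equivalence as EqC using ()
open import Relation.Binary.Construct.Closure.ReflexiveTransitive using (Star; ε; _◅_; _◅◅_)
open import Relation.Binary.Construct.Closure.Symmetric using (fwd)
open import Relation.Binary.Definitions using (tri<; tri≈; tri>)
open import Relation.Binary.PropositionalEquality
open import Relation.Nullary using (Dec; ¬_; yes; no; contradiction; ¬?; does)
open import Relation.Nullary.Decidable using (_×-dec_; _⊎-dec_; decidable-stable; map′)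

open ≡-Reasoning

-- The pair coefficients determine the bits `a k` and `b k` only as an unordered pair, so at each
-- place `a` agrees with a′ or with b′; this is why e_k f_k = 0. A caterpillar and its mirror image
-- have the same polynomial, so the choice between a′ and b′ cannot be forced. The obstacle is that
-- it might change from place to place, and the relations from three components serve to exclude
-- such mixtures. The index s = i + j + 2 arises because components with i + 2 and j + 2 vertices
-- have s + 2 vertices together, so that the data of the third component can be expressed by the
-- values at s. The relations are available only inside the word; antisymmetry puts the leading
-- indices of e and f into its first half, which leaves just enough room behind them. Monomials do
-- not order the components, whereas cuts along the spine do; the comparison therefore runs through
-- sums over all orders of the sizes.

interchange : ∀ a b c d → a + b + (c + d) ≡ a + c + (b + d)
interchange = solve-∀

-- Partial sums and antidiagonal sums

∑ : ℕ → (ℕ → ℤ) → ℤ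
∑ zero    f = 0ℤ
∑ (suc n) f = ∑ n f + f n

antidiag : (ℕ → ℕ → ℤ) → ℕ → ℤ
antidiag g zero    = g 0 0
antidiag g (suc n) = g 0 (suc n) + antidiag (λ i j → g (suc i) j) n

antidiag-cong : ∀ {g h} n → (∀ i j → i ℕ.+ j ≡ n → g i j ≡ h i j) → antidiag g n ≡ antidiag h n
antidiag-cong zero    eq = eq 0 0 refl
antidiag-cong (suc n) eq =
  cong₂ _+_ (eq 0 (suc n) refl) (antidiag-cong n (λ i j p → eq (suc i) j (cong suc p)))

antidiag-last : ∀ g n → antidiag g (suc n) ≡ antidiag (λ i j → g i (suc j)) n + g (suc n) 0
antidiag-last g zero    = refl
antidiag-last g (suc n) = begin
  g 0 (2 ℕ.+ n) + antidiag g′ (suc n)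
    ≡⟨ cong (g 0 (2 ℕ.+ n) +_) (antidiag-last g′ n) ⟩
  g 0 (2 ℕ.+ n) + (antidiag (λ i j → g′ i (suc j)) n + g (2 ℕ.+ n) 0)
    ≡⟨ +-assoc (g 0 (2 ℕ.+ n)) _ (g (2 ℕ.+ n) 0) ⟨
  g 0 (2 ℕ.+ n) + antidiag (λ i j → g′ i (suc j)) n + g (2 ℕ.+ n) 0    ∎
  where
  g′ = λ i j → g (suc i) j

antidiag-flip : ∀ g n → antidiag g n ≡ antidiag (flip g) n
antidiag-flip g zero    = refl
antidiag-flip g (suc n) = begin
  g 0 (suc n) + antidiag (λ i j → g (suc i) j) n  ≡⟨ cong (g 0 (suc n) +_) (antidiag-flip _ n) ⟩
  g 0 (suc n) + antidiag (λ i j → g (suc j) i) n  ≡⟨ +-comm (g 0 (suc n)) _ ⟩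
  antidiag (λ i j → g (suc j) i) n + g 0 (suc n)  ≡⟨ antidiag-last (flip g) n ⟨
  antidiag (flip g) (suc n)                       ∎

antidiag-fst : ∀ f n → antidiag (λ i _ → f i) n ≡ ∑ (suc n) f
antidiag-fst f zero    = sym (+-identityˡ (f 0))
antidiag-fst f (suc n) = trans (antidiag-last (λ i _ → f i) n) (cong (_+ f (suc n)) (antidiag-fst f n))

antidiag-+ : ∀ g h n → antidiag (λ i j → g i j + h i j) n ≡ antidiag g n + antidiag h n
antidiag-+ g h zero    = refl
antidiag-+ g h (suc n) = trans (cong (g 0 (suc n) + h 0 (suc n) +_) (antidiag-+ _ _ n))
  (interchange (g 0 (suc n)) (h 0 (suc n)) (antidiag (λ i j → g (suc i) j) n) _)

antidiag-* : ∀ c g n → antidiag (λ i j → c * g i j) n ≡ c * antidiag g n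
antidiag-* c g zero    = refl
antidiag-* c g (suc n) = trans (cong (c * g 0 (suc n) +_) (antidiag-* c _ n))
  (sym (*-distribˡ-+ c (g 0 (suc n)) _))

antidiag-zero : ∀ {g} n → (∀ i j → i ℕ.+ j ≡ n → g i j ≡ 0ℤ) → antidiag g n ≡ 0ℤ
antidiag-zero zero    eq = eq 0 0 refl
antidiag-zero (suc n) eq
  rewrite eq 0 (suc n) refl | antidiag-zero n (λ i j p → eq (suc i) j (cong suc p)) = refl

antidiag-single : ∀ {g} a q → (∀ i j → i ℕ.+ j ≡ a ℕ.+ q → i ≢ a → g i j ≡ 0ℤ) →
                  antidiag g (a ℕ.+ q) ≡ g a q
antidiag-single zero zero eq = refl
antidiag-single {g} zero (suc q) eq = begin
  g 0 (suc q) + antidiag (λ i j → g (suc i) j) q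
    ≡⟨ cong (g 0 (suc q) +_) (antidiag-zero q (λ i j p → eq (suc i) j (cong suc p) λ ())) ⟩
  g 0 (suc q) + 0ℤ  ≡⟨ +-identityʳ _ ⟩
  g 0 (suc q)       ∎
antidiag-single {g} (suc a) q eq
  rewrite eq 0 (suc (a ℕ.+ q)) refl (λ ())
        | antidiag-single {λ i j → g (suc i) j} a q (λ i j p i≢a → eq (suc i) j (cong suc p) (i≢a ∘ ℕₚ.suc-injective))
        = +-identityˡ _

cancel-≢0 : ∀ {x y} → x ≢ 0ℤ → x * y ≡ 0ℤ → y ≡ 0ℤ
cancel-≢0 {x} x≢0 xy≡0 with i*j≡0⇒i≡0∨j≡0 x xy≡0
... | inj₁ x≡0 = contradiction x≡0 x≢0
... | inj₂ y≡0 = y≡0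

*-cancelˡ-≢0 : ∀ {x y z} → x ≢ 0ℤ → x * y ≡ x * z → y ≡ z
*-cancelˡ-≢0 {x} {y} {z} x≢0 eq = *-cancelˡ-≡ x y z {{≢-nonZero x≢0}} eq

-- The last argument is a pure ring identity, which the solver can prove.
using-eq : ∀ {x y} c {s t} → s ≡ t → x ≡ y + c * (s - t) → x ≡ y
using-eq {y = y} c {s} refl eq = trans eq (simplify y c s)
  where
  simplify : ∀ y c s → y + c * (s - s) ≡ y
  simplify = solve-∀

Sign : ℤ → Set
Sign x = x ≡ 0ℤ ⊎ x ≡ 1ℤ ⊎ x ≡ -1ℤ

-- Twice a nonzero sign leaves the range -1, 0, 1. This bound is what stops `f` from jumping in
-- `no-lead-zero`.
sign-double : ∀ {x y} → Sign x → Sign y → x ≡ y + y → y ≡ 0ℤ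
sign-double _                  (inj₁ y≡0)         _  = y≡0
sign-double (inj₁ refl)        (inj₂ (inj₁ refl)) ()
sign-double (inj₂ (inj₁ refl)) (inj₂ (inj₁ refl)) ()
sign-double (inj₂ (inj₂ refl)) (inj₂ (inj₁ refl)) ()
sign-double (inj₁ refl)        (inj₂ (inj₂ refl)) ()
sign-double (inj₂ (inj₁ refl)) (inj₂ (inj₂ refl)) ()
sign-double (inj₂ (inj₂ refl)) (inj₂ (inj₂ refl)) ()

-- Leading terms of two sequences with disjoint supports

module Core (N : ℕ) (e f : ℕ → ℤ)
  (sign-f : ∀ k → Sign (f k))
  (ef≡0 : ∀ k → e k * f k ≡ 0ℤ)
  (addition : ∀ i j → 3 ℕ.+ (i ℕ.+ j) ≤ N →
     e i * f j + f i * e j ≡ e (2 ℕ.+ (i ℕ.+ j)) * (f i + f j) + f (2 ℕ.+ (i ℕ.+ j)) * (e i + e j))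
  (boundary : ∀ k → 2 ℕ.+ k ≤ N →
     (e (suc k) - e k) * ∑ k f + (f (suc k) - f k) * ∑ k e ≡ 0ℤ)
  where

  G : ℕ → ℤ
  G = antidiag (λ i j → e i * f j)

  -- Sum `addition` over the antidiagonal of t. The left side counts `G t` twice; on the right the
  -- factors at 2 + t are constant and each partial sum also appears twice.
  G-formula : ∀ t → 3 ℕ.+ t ≤ N → G t ≡ e (2 ℕ.+ t) * ∑ (suc t) f + f (2 ℕ.+ t) * ∑ (suc t) e
  G-formula t le = *-cancelˡ-≡ ((1ℤ + 1ℤ)) _ _ (begin
    (1ℤ + 1ℤ) * G t
      ≡⟨ double (G t) ⟩
    G t + G t
      ≡⟨ cong (_+_ (G t)) (trans (antidiag-flip _ t) (antidiag-cong t (λ i j _ → *-comm (e j) (f i)))) ⟩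
    G t + antidiag (λ i j → f i * e j) t
      ≡⟨ antidiag-+ _ _ t ⟨
    antidiag (λ i j → e i * f j + f i * e j) t
      ≡⟨ antidiag-cong t (λ { i j refl → addition i j le }) ⟩
    antidiag (λ i j → x * (f i + f j) + y * (e i + e j)) t
      ≡⟨ antidiag-+ _ _ t ⟩
    antidiag (λ i j → x * (f i + f j)) t + antidiag (λ i j → y * (e i + e j)) t
      ≡⟨ cong₂ _+_ (both x f) (both y e) ⟩
    x * (∑ (suc t) f + ∑ (suc t) f) + y * (∑ (suc t) e + ∑ (suc t) e)
      ≡⟨ collect x y (∑ (suc t) f) (∑ (suc t) e) ⟩
    (1ℤ + 1ℤ) * (x * ∑ (suc t) f + y * ∑ (suc t) e) ∎)
    where
    x = e (2 ℕ.+ t)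
    y = f (2 ℕ.+ t)
    double : ∀ g → (1ℤ + 1ℤ) * g ≡ g + g
    double = solve-∀
    collect : ∀ x y u v → x * (u + u) + y * (v + v) ≡ (1ℤ + 1ℤ) * (x * u + y * v)
    collect = solve-∀
    both : ∀ c h → antidiag (λ i j → c * (h i + h j)) t ≡ c * (∑ (suc t) h + ∑ (suc t) h)
    both c h = begin
      antidiag (λ i j → c * (h i + h j)) t   ≡⟨ antidiag-* c _ t ⟩
      c * antidiag (λ i j → h i + h j) t     ≡⟨ cong (c *_) (antidiag-+ _ _ t) ⟩
      c * (antidiag (λ i _ → h i) t + antidiag (λ _ j → h j) t)
        ≡⟨ cong₂ (λ p q → c * (p + q)) (antidiag-fst h t)
                 (trans (antidiag-flip _ t) (antidiag-fst h t)) ⟩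
      c * (∑ (suc t) h + ∑ (suc t) h)        ∎

  cross : ℕ → ℤ
  cross k = e k * f (suc k) + f k * e (suc k)

  -- The case t = -1 of `G-suc`, with the empty convolution 0 in place of G(-1).
  G-zero : 3 ≤ N → cross 0 ≡ G 0
  G-zero le = sym (trans (G-formula 0 le)
    (using-eq 1ℤ (boundary 1 le) (rearrange (e 0) (e 1) (e 2) (f 0) (f 1) (f 2))))
    where
    rearrange : ∀ e₀ e₁ e₂ f₀ f₁ f₂ →
      e₂ * (0ℤ + f₀) + f₂ * (0ℤ + e₀) ≡
      e₀ * f₁ + f₀ * e₁ + 1ℤ * ((e₂ - e₁) * (0ℤ + f₀) + (f₂ - f₁) * (0ℤ + e₀) - 0ℤ)
    rearrange = solve-∀

  -- In the formula for `G (suc t)`, `boundary` at 2 + t trades the values at 3 + t for those at 2 +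
  -- t. The partial sums there have one summand more than in the formula for `G t`, and these
  -- summands produce `cross`.
  G-suc : ∀ t → 4 ℕ.+ t ≤ N → G (suc t) ≡ G t + cross (suc t)
  G-suc t le = begin
    G (suc t)
      ≡⟨ G-formula (suc t) le ⟩
    e (3 ℕ.+ t) * (F + f (suc t)) + f (3 ℕ.+ t) * (E + e (suc t))
      ≡⟨ using-eq 1ℤ (boundary (2 ℕ.+ t) le)
           (rearrange (e (suc t)) (e (2 ℕ.+ t)) (e (3 ℕ.+ t)) (f (suc t)) (f (2 ℕ.+ t)) (f (3 ℕ.+ t)) E F) ⟩
    e (2 ℕ.+ t) * F + f (2 ℕ.+ t) * E + cross (suc t)
      ≡⟨ cong (_+ cross (suc t)) (G-formula t (ℕₚ.≤-trans (ℕₚ.n≤1+n _) le)) ⟨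
    G t + cross (suc t) ∎
    where
    E = ∑ (suc t) e
    F = ∑ (suc t) f
    rearrange : ∀ e₁ e₂ e₃ f₁ f₂ f₃ E F →
      e₃ * (F + f₁) + f₃ * (E + e₁) ≡
      e₂ * F + f₂ * E + (e₁ * f₂ + f₁ * e₂)
        + 1ℤ * ((e₃ - e₂) * (F + f₁) + (f₃ - f₂) * (E + e₁) - 0ℤ)
    rearrange = solve-∀

  -- Here a and b are the leading indices of e and f. The bound on 2a keeps a + q + 2 inside the
  -- word for every q < a, as `addition` at a and q requires.
  module Lead (a′ b : ℕ) (b<a : b < suc a′) (2a≤N : 2 ℕ.+ (suc a′ ℕ.+ suc a′) ≤ N)
    (e-low : ∀ i → i < suc a′ → e i ≡ 0ℤ) (ea≢0 : e (suc a′) ≢ 0ℤ)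
    (f-low : ∀ i → i < b → f i ≡ 0ℤ) (fb≢0 : f b ≢ 0ℤ)
    where

    private
      a : ℕ
      a = suc a′

    f-from-e : ∀ k → e k ≢ 0ℤ → f k ≡ 0ℤ
    f-from-e k ek≢0 = cancel-≢0 ek≢0 (ef≡0 k)

    e-from-f : ∀ k → f k ≢ 0ℤ → e k ≡ 0ℤ
    e-from-f k fk≢0 = cancel-≢0 fk≢0 (trans (*-comm (f k) (e k)) (ef≡0 k))

    fa≡0 : f a ≡ 0ℤ
    fa≡0 = f-from-e a ea≢0

    bound : ∀ {q} → q < a → 3 ℕ.+ (a ℕ.+ q) ≤ N
    bound {q} q<a = ℕₚ.≤-trans
      (s≤s (s≤s (ℕₚ.≤-trans (ℕₚ.≤-reflexive (sym (ℕₚ.+-suc a q))) (ℕₚ.+-monoʳ-≤ a q<a)))) 2a≤N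

    -- Since `e q` and `f a` vanish, `addition` at a and q carries the value of f at q over to the
    -- place a + q + 2.
    translate : ∀ q → q < a → e a * f q ≡ e (2 ℕ.+ (a ℕ.+ q)) * f q + f (2 ℕ.+ (a ℕ.+ q)) * e a
    translate q q<a = begin
      e a * f q                  ≡⟨ pad (e a * f q) (f a) ⟩
      e a * f q + f a * 0ℤ       ≡⟨ cong (λ z → e a * f q + f a * z) (e-low q q<a) ⟨
      e a * f q + f a * e q      ≡⟨ addition a q (bound q<a) ⟩
      x * (f a + f q) + y * (e a + e q)
        ≡⟨ cong₂ (λ u v → x * (u + f q) + y * (e a + v)) fa≡0 (e-low q q<a) ⟩
      x * (0ℤ + f q) + y * (e a + 0ℤ)
        ≡⟨ cong₂ (λ u v → x * u + y * v) (+-identityˡ (f q)) (+-identityʳ (e a)) ⟩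
      x * f q + y * e a ∎
      where
      x = e (2 ℕ.+ (a ℕ.+ q))
      y = f (2 ℕ.+ (a ℕ.+ q))
      pad : ∀ u v → u ≡ u + v * 0ℤ
      pad = solve-∀

    f-translate-zero : ∀ q → q < a → f q ≡ 0ℤ → f (2 ℕ.+ (a ℕ.+ q)) ≡ 0ℤ
    f-translate-zero q q<a fq≡0 = cancel-≢0 ea≢0 (begin
      e a * y              ≡⟨ drop-x x (e a) y ⟩
      x * 0ℤ + y * e a     ≡⟨ cong (λ z → x * z + y * e a) fq≡0 ⟨
      x * f q + y * e a    ≡⟨ translate q q<a ⟨
      e a * f q            ≡⟨ cong (e a *_) fq≡0 ⟩
      e a * 0ℤ             ≡⟨ *-zeroʳ (e a) ⟩
      0ℤ                   ∎)
      where
      x = e (2 ℕ.+ (a ℕ.+ q))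
      y = f (2 ℕ.+ (a ℕ.+ q))
      drop-x : ∀ x u y → u * y ≡ x * 0ℤ + y * u
      drop-x = solve-∀

    -- A summand with i > a has i = a + k + 1 and j = q - (k + 1). The disjunction serves two
    -- situations: f vanishing below b, and e vanishing on a stretch behind a.
    summand-zero : ∀ {q} → (∀ i → i < q → e (suc (a ℕ.+ i)) ≡ 0ℤ ⊎ f (q ℕ.∸ suc i) ≡ 0ℤ) →
                   ∀ i j → i ℕ.+ j ≡ a ℕ.+ q → i ≢ a → e i * f j ≡ 0ℤ
    summand-zero {q} hyp i j eq i≢a with ℕₚ.<-cmp i a
    ... | tri< i<a _ _ = trans (cong (_* f j) (e-low i i<a)) (*-zeroˡ (f j))
    ... | tri≈ _ i≡a _ = contradiction i≡a i≢a
    ... | tri> _ _ a<i = go (hyp k k<q)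
      where
      k = i ℕ.∸ suc a
      i≡ : suc (a ℕ.+ k) ≡ i
      i≡ = ℕₚ.m+[n∸m]≡n a<i
      k+j : suc k ℕ.+ j ≡ q
      k+j = ℕₚ.+-cancelˡ-≡ a _ _ (begin
        a ℕ.+ (suc k ℕ.+ j)    ≡⟨ ℕₚ.+-assoc a (suc k) j ⟨
        a ℕ.+ suc k ℕ.+ j      ≡⟨ cong (ℕ._+ j) (trans (ℕₚ.+-suc a k) i≡) ⟩
        i ℕ.+ j                ≡⟨ eq ⟩
        a ℕ.+ q                ∎)
      k<q : k < q
      k<q = subst (suc k ≤_) k+j (ℕₚ.m≤m+n (suc k) j)
      j≡ : q ℕ.∸ suc k ≡ j
      j≡ = trans (cong (ℕ._∸ suc k) (sym k+j)) (ℕₚ.m+n∸m≡n (suc k) j)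
      go : e (suc (a ℕ.+ k)) ≡ 0ℤ ⊎ f (q ℕ.∸ suc k) ≡ 0ℤ → e i * f j ≡ 0ℤ
      go (inj₁ z) = trans (cong (_* f j) (trans (cong e (sym i≡)) z)) (*-zeroˡ (f j))
      go (inj₂ z) = trans (cong (e i *_) (trans (cong f (sym j≡)) z)) (*-zeroʳ (e i))

    G-low : ∀ t → t < a ℕ.+ b → G t ≡ 0ℤ
    G-low t t<a+b = antidiag-zero t λ i j i+j≡t → go i j i+j≡t (ℕₚ.<-≤-connex i a)
      where
      go : ∀ i j → i ℕ.+ j ≡ t → i < a ⊎ a ≤ i → e i * f j ≡ 0ℤ
      go i j _ (inj₁ i<a) = trans (cong (_* f j) (e-low i i<a)) (*-zeroˡ (f j))
      go i j refl (inj₂ a≤i) =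
        trans (cong (e i *_) (f-low j (ℕₚ.+-cancelˡ-< a j b
          (ℕₚ.≤-<-trans (ℕₚ.+-monoˡ-≤ j a≤i) t<a+b)))) (*-zeroʳ (e i))

    G-lead : G (a ℕ.+ b) ≡ e a * f b
    G-lead = antidiag-single a b (summand-zero λ i i<b →
      inj₂ (f-low (b ℕ.∸ suc i) (ℕₚ.∸-monoʳ-< (s≤s z≤n) i<b)))

    -- `cross` is the difference of consecutive values of `G`, which are all zero below a + b.
    cross-low : ∀ k → k < a ℕ.+ b → cross k ≡ 0ℤ
    cross-low zero    k<a+b = trans (G-zero (ℕₚ.≤-trans (s≤s (s≤s (s≤s z≤n))) 2a≤N)) (G-low 0 k<a+b)
    cross-low (suc t) k<a+b = begin
      cross (suc t)         ≡⟨ +-identityˡ _ ⟨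
      0ℤ + cross (suc t)    ≡⟨ cong (_+ cross (suc t)) (G-low t (ℕₚ.<-trans (ℕₚ.n<1+n t) k<a+b)) ⟨
      G t + cross (suc t)   ≡⟨ G-suc t le ⟨
      G (suc t)             ≡⟨ G-low (suc t) k<a+b ⟩
      0ℤ                    ∎
      where
      le : 4 ℕ.+ t ≤ N
      le = ℕₚ.≤-trans (s≤s (s≤s k<a+b)) (ℕₚ.≤-trans (ℕₚ.n≤1+n _) (bound b<a))

    cross-lead : cross (a ℕ.+ b) ≡ e a * f b
    cross-lead = begin
      cross (suc (a′ ℕ.+ b))                ≡⟨ +-identityˡ _ ⟨
      0ℤ + cross (suc (a′ ℕ.+ b))
        ≡⟨ cong (_+ cross (suc (a′ ℕ.+ b))) (G-low (a′ ℕ.+ b) (ℕₚ.n<1+n _)) ⟨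
      G (a′ ℕ.+ b) + cross (suc (a′ ℕ.+ b)) ≡⟨ G-suc (a′ ℕ.+ b) (bound b<a) ⟨
      G (a ℕ.+ b)                           ≡⟨ G-lead ⟩
      e a * f b                             ∎

    cross-at-a : cross a ≡ e a * f (suc a)
    cross-at-a =
      trans (cong (λ z → e a * f (suc a) + z * e (suc a)) fa≡0) (pad (e a * f (suc a)) (e (suc a)))
      where
      pad : ∀ u v → u + 0ℤ * v ≡ u
      pad = solve-∀

    product-≢0 : e a * f b ≢ 0ℤ
    product-≢0 eq = fb≢0 (cancel-≢0 ea≢0 eq)

  -- The leading coefficient e a * f b of G is also a value of cross, but
  -- f vanishes next to a + b.
  no-lead-suc : ∀ a′ b′ → suc b′ < suc a′ → 2 ℕ.+ (suc a′ ℕ.+ suc a′) ≤ N →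
          (∀ i → i < suc a′ → e i ≡ 0ℤ) → e (suc a′) ≢ 0ℤ →
          (∀ i → i < suc b′ → f i ≡ 0ℤ) → f (suc b′) ≢ 0ℤ → ⊥
  no-lead-suc a′ b′ b<a 2a≤N e-low ea≢0 f-low fb≢0 = product-≢0 (begin
    e a * f b          ≡⟨ cross-lead ⟨
    cross (a ℕ.+ b)    ≡⟨ cong₂ (λ u v → e (a ℕ.+ b) * u + v * e (suc (a ℕ.+ b))) next (at b′ refl) ⟩
    e (a ℕ.+ b) * 0ℤ + 0ℤ * e (suc (a ℕ.+ b))
                       ≡⟨ vanish (e (a ℕ.+ b)) (e (suc (a ℕ.+ b))) ⟩
    0ℤ                 ∎)
    where
    a = suc a′
    b = suc b′
    open Lead a′ b b<a 2a≤N e-low ea≢0 f-low fb≢0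
    vanish : ∀ u v → u * 0ℤ + 0ℤ * v ≡ 0ℤ
    vanish = solve-∀
    zero-after : ∀ q → q < b → f (2 ℕ.+ (a ℕ.+ q)) ≡ 0ℤ
    zero-after q q<b = f-translate-zero q (ℕₚ.<-trans q<b b<a) (f-low q q<b)
    next : f (suc (a ℕ.+ b)) ≡ 0ℤ
    next = trans (cong (f ∘ suc) (ℕₚ.+-suc a b′)) (zero-after b′ (ℕₚ.n<1+n b′))
    at : ∀ c → c ≡ b′ → f (a ℕ.+ b) ≡ 0ℤ
    -- For b = 1 the place a + b lies before a + 2, where `zero-after` starts. Instead `cross a`
    -- vanishes because a < a + b, and it is a nonzero multiple of this value of f.
    at zero    refl = trans (cong f (ℕₚ.+-comm a 1)) (cancel-≢0 ea≢0
      (trans (sym (cross-at-a)) (cross-low a (ℕₚ.m<m+n a (s≤s z≤n)))))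
    at (suc c) refl = trans (cong f (trans (ℕₚ.+-suc a (suc c)) (cong suc (ℕₚ.+-suc a c))))
                            (zero-after c (s≤s (ℕₚ.n≤1+n c)))

  -- Comparing cross with the values of G past a forces f to keep the value
  -- f 0 up to a - 1, where it has to vanish.
  no-lead-zero : ∀ a′ → 2 ℕ.+ (suc a′ ℕ.+ suc a′) ≤ N →
        (∀ i → i < suc a′ → e i ≡ 0ℤ) → e (suc a′) ≢ 0ℤ → f 0 ≢ 0ℤ → ⊥
  no-lead-zero a′ 2a≤N e-low ea≢0 f0≢0 =
    f0≢0 (trans (sym (proj₁ (constant a′ ℕₚ.≤-refl) a′ ℕₚ.≤-refl)) fa′≡0)
    where
    a = suc a′
    open Lead a′ 0 (s≤s z≤n) 2a≤N e-low ea≢0 (λ _ ()) f0≢0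

    fa′≡0 : f a′ ≡ 0ℤ
    fa′≡0 = cancel-≢0 ea≢0 (begin
      e a * f a′                    ≡⟨ pad (e a) (f a′) (f a) ⟩
      0ℤ * f a + f a′ * e a         ≡⟨ cong (λ z → z * f a + f a′ * e a) (e-low a′ (ℕₚ.n<1+n a′)) ⟨
      cross a′                      ≡⟨ cross-low a′ (s≤s (ℕₚ.m≤m+n a′ 0)) ⟩
      0ℤ                            ∎)
      where
      pad : ∀ u v w → u * v ≡ 0ℤ * w + v * u
      pad = solve-∀

    -- The induction has to carry the values behind a as well: the zeros of e there reduce G(a + p)
    -- to e a * f p, and the last component supplies the next value of `cross`.
    Constant : ℕ → Set
    Constant q =
      (∀ i → i ≤ q → f i ≡ f 0) × (∀ i → i ≤ q → e (suc (a ℕ.+ i)) ≡ 0ℤ) × f (suc (a ℕ.+ q)) ≡ f 0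

    extend : ∀ {A : ℕ → Set} {q} → (∀ i → i ≤ q → A i) → A (suc q) → ∀ i → i ≤ suc q → A i
    extend {A} low top i i≤ with ℕₚ.m≤n⇒m<n∨m≡n i≤
    ... | inj₁ (s≤s i≤q) = low i i≤q
    ... | inj₂ refl      = top

    constant : ∀ q → q ≤ a′ → Constant q
    constant zero _ =
      (λ { zero z≤n → refl }) , (λ { zero z≤n → e-from-f _ (f0≢0 ∘ trans (sym f₁)) }) , f₁
      where
      f₁ : f (suc (a ℕ.+ 0)) ≡ f 0
      f₁ = *-cancelˡ-≢0 ea≢0 (begin
        e a * f (suc (a ℕ.+ 0))     ≡⟨ cong (λ k → e a * f (suc k)) (ℕₚ.+-identityʳ a) ⟩
        e a * f (suc a)             ≡⟨ cross-at-a ⟨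
        cross a                     ≡⟨ cong cross (ℕₚ.+-identityʳ a) ⟨
        cross (a ℕ.+ 0)             ≡⟨ cross-lead ⟩
        e a * f 0                   ∎)
    constant (suc q) q<a′ with constant q (ℕₚ.<⇒≤ q<a′)
    ... | f-const , e-zero , f₁≡ =
      extend f-const f-next ,
      extend e-zero (trans (cong (e ∘ suc) (ℕₚ.+-suc a q)) x≡0) ,
      trans (cong (f ∘ suc) (ℕₚ.+-suc a q)) y≡
      where
      x = e (2 ℕ.+ (a ℕ.+ q))
      y = f (2 ℕ.+ (a ℕ.+ q))
      q<a : q < a
      q<a = ℕₚ.<-trans q<a′ (ℕₚ.n<1+n a′)
      moved : e a * f 0 ≡ x * f 0 + y * e a
      moved = trans (cong (e a *_) (sym (f-const q ℕₚ.≤-refl)))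
        (trans (translate q q<a) (cong (λ z → x * z + y * e a) (f-const q ℕₚ.≤-refl)))
      G-at : ∀ p → p ≤ suc q → G (a ℕ.+ p) ≡ e a * f p
      G-at p p≤ = antidiag-single a p (summand-zero λ i i<p →
        inj₁ (e-zero i (ℕₚ.≤-pred (ℕₚ.≤-trans i<p p≤))))
      -- Compare G at a + q + 1 and a + q; by the invariant only f 0 * x survives in `cross`.
      jump : e a * f (suc q) ≡ e a * f 0 + f 0 * x
      jump = begin
        e a * f (suc q)                  ≡⟨ G-at (suc q) ℕₚ.≤-refl ⟨
        G (a ℕ.+ suc q)                  ≡⟨ cong G (ℕₚ.+-suc a q) ⟩
        G (suc (a ℕ.+ q))
          ≡⟨ G-suc (a ℕ.+ q) (ℕₚ.≤-trans (ℕₚ.≤-reflexive (cong (3 ℕ.+_) (sym (ℕₚ.+-suc a q)))) (bound (s≤s q<a′))) ⟩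
        G (a ℕ.+ q) + cross (suc (a ℕ.+ q))
          ≡⟨ cong₂ _+_ (trans (G-at q (ℕₚ.n≤1+n q)) (cong (e a *_) (f-const q ℕₚ.≤-refl)))
               (cong₂ (λ u v → u * y + v * x) (e-zero q ℕₚ.≤-refl) f₁≡) ⟩
        e a * f 0 + (0ℤ * y + f 0 * x)   ≡⟨ pad (e a * f 0) y (f 0 * x) ⟩
        e a * f 0 + f 0 * x              ∎
        where
        pad : ∀ u v w → u + (0ℤ * v + w) ≡ u + w
        pad = solve-∀
      -- If x were nonzero, then y = 0 by disjointness of supports, `moved` would give x = e a, and
      -- `jump` would make f (suc q) twice the nonzero sign f 0.
      x≡0 : x ≡ 0ℤ
      x≡0 with x ≟ 0ℤ
      ... | yes x≡0 = x≡0
      ... | no  x≢0 = contradiction (sign-double (sign-f (suc q)) (sign-f 0) doubled) f0≢0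
        where
        x≡ea : x ≡ e a
        x≡ea = sym (*-cancelˡ-≢0 f0≢0 (begin
          f 0 * e a              ≡⟨ *-comm (f 0) (e a) ⟩
          e a * f 0              ≡⟨ moved ⟩
          x * f 0 + y * e a      ≡⟨ cong (λ z → x * f 0 + z * e a) (f-from-e _ x≢0) ⟩
          x * f 0 + 0ℤ * e a     ≡⟨ pad x (f 0) (e a) ⟩
          f 0 * x                ∎))
          where
          pad : ∀ u v w → u * v + 0ℤ * w ≡ v * u
          pad = solve-∀
        doubled : f (suc q) ≡ f 0 + f 0
        doubled = *-cancelˡ-≢0 ea≢0 (begin
          e a * f (suc q)          ≡⟨ jump ⟩
          e a * f 0 + f 0 * x      ≡⟨ cong (λ z → e a * f 0 + f 0 * z) x≡ea ⟩
          e a * f 0 + f 0 * e a    ≡⟨ collect (e a) (f 0) ⟩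
          e a * (f 0 + f 0)        ∎)
          where
          collect : ∀ u v → u * v + v * u ≡ u * (v + v)
          collect = solve-∀
      f-next : f (suc q) ≡ f 0
      f-next =
        *-cancelˡ-≢0 ea≢0 (trans jump (trans (cong (λ z → e a * f 0 + f 0 * z) x≡0) (pad (e a * f 0) (f 0))))
        where
        pad : ∀ u v → u + v * 0ℤ ≡ u
        pad = solve-∀
      y≡ : y ≡ f 0
      y≡ =
        sym (*-cancelˡ-≢0 ea≢0 (trans moved (trans (cong (λ z → z * f 0 + y * e a) x≡0) (pad (f 0) y (e a)))))
        where
        pad : ∀ u v w → 0ℤ * u + v * w ≡ w * v
        pad = solve-∀

  no-leads : ∀ a b → b < a → 2 ℕ.+ (a ℕ.+ a) ≤ N →
             (∀ i → i < a → e i ≡ 0ℤ) → e a ≢ 0ℤ →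
             (∀ i → i < b → f i ≡ 0ℤ) → f b ≢ 0ℤ → ⊥
  no-leads (suc a′) zero    _   2a≤N e-low ea≢0 f-low fb≢0 = no-lead-zero a′ 2a≤N e-low ea≢0 fb≢0
  no-leads (suc a′) (suc b) b<a 2a≤N e-low ea≢0 f-low fb≢0 =
    no-lead-suc a′ b b<a 2a≤N e-low ea≢0 f-low fb≢0

-- Words with the same counts

⟦_⟧ : Bool → ℤ
⟦ true  ⟧ = 1ℤ
⟦ false ⟧ = 0ℤ

-- Indicator functions are extended by 0 past the end of the word.
at : List Bool → ℕ → ℤ
at []      _       = 0ℤ
at (s ∷ u) zero    = ⟦ s ⟧
at (s ∷ u) (suc k) = at u k

at-end : ∀ u {k} → length u ≤ k → at u k ≡ 0ℤ
at-end []      _         = refl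
at-end (s ∷ u) (s≤s u≤k) = at-end u u≤k

at-∷ʳ : ∀ u s {k} → k < length u → at (u ∷ʳ s) k ≡ at u k
at-∷ʳ (t ∷ u) s {zero}  _         = refl
at-∷ʳ (t ∷ u) s {suc k} (s≤s k<u) = at-∷ʳ u s k<u

at-last : ∀ u s → at (u ∷ʳ s) (length u) ≡ ⟦ s ⟧
at-last []      s = refl
at-last (t ∷ u) s = at-last u s

at-∷ʳ-false : ∀ u k → at (u ∷ʳ false) k ≡ at u k
at-∷ʳ-false []      zero    = refl
at-∷ʳ-false []      (suc k) = refl
at-∷ʳ-false (t ∷ u) zero    = refl
at-∷ʳ-false (t ∷ u) (suc k) = at-∷ʳ-false u k

at-reverse : ∀ u k j → suc (k ℕ.+ j) ≡ length u → at (reverse u) k ≡ at u j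
at-reverse (s ∷ u) k j eq rewrite unfold-reverse s u = go j eq
  where
  go : ∀ j → suc (k ℕ.+ j) ≡ suc (length u) → at (reverse u ∷ʳ s) k ≡ at (s ∷ u) j
  go zero    eq = trans (cong (at (reverse u ∷ʳ s))
    (trans (sym (ℕₚ.+-identityʳ k)) (trans (ℕₚ.suc-injective eq) (sym (length-reverse u))))) (at-last (reverse u) s)
  go (suc j) eq = trans (at-∷ʳ (reverse u) s k<) (at-reverse u k j eq′)
    where
    eq′ : suc (k ℕ.+ j) ≡ length u
    eq′ = trans (sym (ℕₚ.+-suc k j)) (ℕₚ.suc-injective eq)
    k< : k < length (reverse u)
    k< = subst (k <_) (trans eq′ (sym (length-reverse u))) (s≤s (ℕₚ.m≤m+n k j))

at-injective : ∀ u v → length u ≡ length v → (∀ k → at u k ≡ at v k) → u ≡ v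
at-injective []      []      _ _ = refl
at-injective (s ∷ u) (t ∷ v) l eq =
  cong₂ _∷_ (bit s t (eq 0)) (at-injective u v (ℕₚ.suc-injective l) (eq ∘ suc))
  where
  bit : ∀ s t → ⟦ s ⟧ ≡ ⟦ t ⟧ → s ≡ t
  bit true  true  _ = refl
  bit false false _ = refl

Bit : ℤ → Set
Bit x = x ≡ 0ℤ ⊎ x ≡ 1ℤ

at-bit : ∀ u k → Bit (at u k)
at-bit []          k       = inj₁ refl
at-bit (true  ∷ u) zero    = inj₂ refl
at-bit (false ∷ u) zero    = inj₁ refl
at-bit (s ∷ u)     (suc k) = at-bit u k

bit-square : ∀ {x} → Bit x → x * x ≡ x
bit-square (inj₁ refl) = refl
bit-square (inj₂ refl) = refl

bit-difference : ∀ {x y} → Bit x → Bit y → Sign (x - y)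
bit-difference (inj₁ refl) (inj₁ refl) = inj₁ refl
bit-difference (inj₁ refl) (inj₂ refl) = inj₂ (inj₂ refl)
bit-difference (inj₂ refl) (inj₁ refl) = inj₂ (inj₁ refl)
bit-difference (inj₂ refl) (inj₂ refl) = inj₁ refl

-- Two bits are determined up to order by their sum, so x is x′ or y′.
bit-differences-product : ∀ {x y x′ y′} → Bit x → Bit y → Bit x′ → Bit y′ → x + y ≡ x′ + y′ →
                          (x - x′) * (x - y′) ≡ 0ℤ
bit-differences-product (inj₁ refl) _           (inj₁ refl) _           _  = refl
bit-differences-product {y′ = y′} (inj₂ refl) _ (inj₂ refl) _ _ = *-zeroˡ (1ℤ - y′)
bit-differences-product (inj₁ refl) _           (inj₂ refl) (inj₁ refl) _  = refl
bit-differences-product (inj₂ refl) _           (inj₁ refl) (inj₂ refl) _  = refl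
bit-differences-product (inj₁ refl) (inj₁ refl) (inj₂ refl) (inj₂ refl) ()
bit-differences-product (inj₁ refl) (inj₂ refl) (inj₂ refl) (inj₂ refl) ()
bit-differences-product (inj₂ refl) (inj₁ refl) (inj₁ refl) (inj₁ refl) ()
bit-differences-product (inj₂ refl) (inj₂ refl) (inj₁ refl) (inj₁ refl) ()

∑-cong : ∀ n {f g} → (∀ i → f i ≡ g i) → ∑ n f ≡ ∑ n g
∑-cong zero    eq = refl
∑-cong (suc n) eq = cong₂ _+_ (∑-cong n eq) (eq n)

∑-+ : ∀ n f g → ∑ n (λ i → f i + g i) ≡ ∑ n f + ∑ n g
∑-+ zero    f g = refl
∑-+ (suc n) f g = trans (cong (_+ (f n + g n)) (∑-+ n f g)) (interchange (∑ n f) (∑ n g) (f n) (g n))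

∑-minus : ∀ n f g → ∑ n (λ i → f i - g i) ≡ ∑ n f - ∑ n g
∑-minus zero    f g = refl
∑-minus (suc n) f g =
  trans (cong (_+ (f n - g n)) (∑-minus n f g)) (regroup (∑ n f) (∑ n g) (f n) (g n))
  where
  regroup : ∀ a b c d → a - b + (c - d) ≡ a + c - (b + d)
  regroup = solve-∀

-- For the caterpillar coded by u these are, up to a factor that only depends on
-- the monomial, the coefficients of x_p x_q, of x_p x_q x_r and of x_1 x_p x_q
-- with p = k + 2, q = j + 2 and r = l + 2.
pairCount : List Bool → ℕ → ℕ → ℤ
pairCount u k j = at u k + at u j

tripleCount : List Bool → ℕ → ℕ → ℕ → ℤ
tripleCount u k j l =
  a k * b l + a k * b j + a j * b l + a j * b k + a l * b j + a l * b k
  where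
  a = at u
  b = at (reverse u)

leafCount : List Bool → ℕ → ℕ → ℤ
leafCount u k j = half k + half j
  where
  a = at u
  -- The first summand counts the size lists k + 2, 1, j + 2, the second one the lists 1, k + 2, j +
  -- 2.
  half : ℕ → ℤ
  half k = a k * (int (length u) - ∑ (length u) a - int k + ∑ (suc k) a + a (suc k))
         + (int k + int 2 - ∑ (suc k) a) * a (suc k)

module Word (u : List Bool) where
  N = length u
  a = at u
  b = at (reverse u)

  b≡a : ∀ k j → suc (k ℕ.+ j) ≡ N → b k ≡ a j
  b≡a = at-reverse u

  a≡b : ∀ k j → suc (k ℕ.+ j) ≡ N → a k ≡ b j
  a≡b k j eq = sym (b≡a j k (trans (cong suc (ℕₚ.+-comm j k)) eq))

  b-end : ∀ {k} → N ≤ k → b k ≡ 0ℤ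
  b-end {k} N≤k = at-end (reverse u) (subst (_≤ k) (sym (length-reverse u)) N≤k)

  -- The first y entries of `b` are the last y entries of `a`.
  total : ∀ x y → x ℕ.+ y ≡ N → ∑ x a + ∑ y b ≡ ∑ N a
  total x zero    eq =
    trans (+-identityʳ (∑ x a)) (cong (λ n → ∑ n a) (trans (sym (ℕₚ.+-identityʳ x)) eq))
  total x (suc y) eq = begin
    ∑ x a + (∑ y b + b y)
      ≡⟨ cong (λ z → ∑ x a + (∑ y b + z)) (b≡a y x (trans (cong suc (ℕₚ.+-comm y x)) eq′)) ⟩
    ∑ x a + (∑ y b + a x)   ≡⟨ regroup (∑ x a) (∑ y b) (a x) ⟩
    ∑ (suc x) a + ∑ y b     ≡⟨ total (suc x) y eq′ ⟩
    ∑ N a                   ∎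
    where
    eq′ : suc (x ℕ.+ y) ≡ N
    eq′ = trans (sym (ℕₚ.+-suc x y)) eq
    regroup : ∀ p q r → p + (q + r) ≡ p + r + q
    regroup = solve-∀

  -- The part of leafCount that is not a function of a + b.
  skew : ℕ → ℤ
  skew k = (a k - a (suc k)) * ∑ k a + (b k - b (suc k)) * ∑ k b

  -- As j is the reflection of k + 1, the half for j can be rewritten in terms of `b` at k and k +
  -- 1. Apart from the skew part, what remains is linear in a + b, once the squares of bits are
  -- replaced by the bits.
  leafCount-skew : ∀ k j → 2 ℕ.+ (k ℕ.+ j) ≡ N →
    leafCount u k j ≡
      (a k + b k) * (int N - ∑ N a - int k + 1ℤ) + (a (suc k) + b (suc k)) * (int k + int 2) + skew k
  leafCount-skew k j eq = begin
    leafCount u k j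
      ≡⟨ cong₂ (λ p q → half k (a k) (a (suc k)) (∑ (suc k) a) + half j p q (∑ (suc j) a)) aj aj′ ⟩
    half k (a k) (a (suc k)) (∑ (suc k) a) + half j (b (suc k)) (b k) (∑ (suc j) a)
      ≡⟨ cong (λ z → half k (a k) (a (suc k)) (∑ (suc k) a) + half j (b (suc k)) (b k) z) A-j ⟩
    half k (a k) (a (suc k)) (∑ (suc k) a) + half j (b (suc k)) (b k) (∑ N a - ∑ (suc k) b)
      ≡⟨ cong (λ z → half k (a k) (a (suc k)) (∑ (suc k) a)
                     + (b (suc k) * (int N - ∑ N a - z + (∑ N a - ∑ (suc k) b) + b k)
                       + (z + int 2 - (∑ N a - ∑ (suc k) b)) * b k)) posj ⟩
    _ ≡⟨ using-eq 1ℤ (bit-square (at-bit u k))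
          (using-eq 1ℤ (bit-square (at-bit (reverse u) k))
            (expand (a k) (a (suc k)) (b k) (b (suc k)) (∑ k a) (∑ k b) (∑ N a) (int N) (int k) (int 2))) ⟩
    (a k + b k) * (int N - ∑ N a - int k + 1ℤ) + (a (suc k) + b (suc k)) * (int k + int 2) + skew k ∎
    where
    half : ℕ → ℤ → ℤ → ℤ → ℤ
    half k x y A = x * (int N - ∑ N a - int k + A + y) + (int k + int 2 - A) * y
    aj : a j ≡ b (suc k)
    aj = sym (b≡a (suc k) j eq)
    aj′ : a (suc j) ≡ b k
    aj′ = sym (b≡a k (suc j) (trans (cong suc (ℕₚ.+-suc k j)) eq))
    A-j : ∑ (suc j) a ≡ ∑ N a - ∑ (suc k) b
    A-j =
      using-eq 1ℤ (total (suc j) (suc k) (trans (cong suc (trans (ℕₚ.+-suc j k) (cong suc (ℕₚ.+-comm j k)))) eq))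
            (rearrange (∑ (suc j) a) (∑ (suc k) b) (∑ N a))
      where
      rearrange : ∀ x y z → x ≡ z - y + 1ℤ * (x + y - z)
      rearrange = solve-∀
    posj : int j ≡ int N - int k - int 2
    posj = trans (rearrange (int j) (int k) (int 2)) (cong (λ z → z - int k - int 2)
      (trans (cong (_+_ (int 2)) (sym (pos-+ k j))) (trans (sym (pos-+ 2 (k ℕ.+ j))) (cong int_ eq))))
      where
      rearrange : ∀ x y z → x ≡ z + (y + x) - y - z
      rearrange = solve-∀
    expand : ∀ a₀ a₁ b₀ b₁ A B T n k two →
      a₀ * (n - T - k + (A + a₀) + a₁) + (k + two - (A + a₀)) * a₁
        + (b₁ * (n - T - (n - k - two) + (T - (B + b₀)) + b₀) + (n - k - two + two - (T - (B + b₀))) * b₀)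
      ≡ (a₀ + b₀) * (n - T - k + 1ℤ) + (a₁ + b₁) * (k + two)
        + ((a₀ - a₁) * A + (b₀ - b₁) * B)
        + 1ℤ * (a₀ * a₀ - a₀) + 1ℤ * (b₀ * b₀ - b₀)
    expand = solve-∀

least-nonzero : ∀ (h : ℕ → ℤ) n →
  (∀ i → i < n → h i ≡ 0ℤ) ⊎ ∃[ m ] m < n × (∀ i → i < m → h i ≡ 0ℤ) × h m ≢ 0ℤ
least-nonzero h zero = inj₁ λ _ ()
least-nonzero h (suc n) with least-nonzero h n
... | inj₂ (m , m<n , low , hm≢0) = inj₂ (m , ℕₚ.m<n⇒m<1+n m<n , low , hm≢0)
... | inj₁ low with h n ≟ 0ℤ
...   | no  hn≢0 = inj₂ (n , ℕₚ.n<1+n n , low , hn≢0)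
...   | yes hn≡0 = inj₁ λ i i<1+n → extend i (ℕₚ.m≤n⇒m<n∨m≡n (ℕₚ.≤-pred i<1+n))
  where
  extend : ∀ i → i < n ⊎ i ≡ n → h i ≡ 0ℤ
  extend i (inj₁ i<n)  = low i i<n
  extend i (inj₂ refl) = hn≡0

self-negative : ∀ {x} → x ≡ - x → x ≡ 0ℤ
self-negative {x} x≡-x = *-cancelˡ-≡ (1ℤ + 1ℤ) x 0ℤ (using-eq 1ℤ x≡-x (double x))
  where
  double : ∀ x → (1ℤ + 1ℤ) * x ≡ (1ℤ + 1ℤ) * 0ℤ + 1ℤ * (x - - x)
  double = solve-∀

-- The value at the reflection n - 1 - m of the leading index m is - h m, which is nonzero, so the
-- reflection cannot lie before m. It cannot be m either, as then h m = - h m.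
antisymmetric-lead : ∀ {h : ℕ → ℤ} {n m} → (∀ k j → suc (k ℕ.+ j) ≡ n → h j ≡ - h k) → m < n →
                     (∀ i → i < m → h i ≡ 0ℤ) → h m ≢ 0ℤ → 2 ℕ.+ (m ℕ.+ m) ≤ n
antisymmetric-lead {h} {n} {m} anti m<n low hm≢0 with ℕₚ.<-cmp (n ℕ.∸ suc m) m
... | tri< j<m _ _ = contradiction (trans (anti j m j+m) (cong -_ (low j j<m))) hm≢0
  where
  j = n ℕ.∸ suc m
  j+m : suc (j ℕ.+ m) ≡ n
  j+m = trans (cong suc (ℕₚ.+-comm j m)) (ℕₚ.m+[n∸m]≡n m<n)
... | tri≈ _ j≡m _ = contradiction
  (self-negative (anti m m (trans (cong (λ z → suc (m ℕ.+ z)) (sym j≡m)) (ℕₚ.m+[n∸m]≡n m<n)))) hm≢0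
... | tri> _ _ m<j = subst₂ _≤_ (ℕₚ.+-suc (suc m) m) (ℕₚ.m+[n∸m]≡n m<n) (ℕₚ.+-monoʳ-≤ (suc m) m<j)

module Compare (u u′ : List Bool) (len : length u ≡ length u′)
  (pairs   : ∀ k j → suc (k ℕ.+ j) ≡ length u → pairCount u k j ≡ pairCount u′ k j)
  (triples : ∀ k j l → 3 ℕ.+ (k ℕ.+ j ℕ.+ l) ≡ length u → tripleCount u k j l ≡ tripleCount u′ k j l)
  (leaves  : ∀ k j → 2 ℕ.+ (k ℕ.+ j) ≡ length u → leafCount u k j ≡ leafCount u′ k j)
  where

  module W = Word u
  module W′ = Word u′
  open W using (N; a; b)
  open W′ using () renaming (a to a′; b to b′)

  e f : ℕ → ℤ
  e k = a k - a′ k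
  f k = a k - b′ k

  complement : ∀ {k} → k < N → suc (k ℕ.+ (N ℕ.∸ suc k)) ≡ N
  complement k<N = ℕₚ.m+[n∸m]≡n k<N

  sums : ∀ k → a k + b k ≡ a′ k + b′ k
  sums k with ℕₚ.<-≤-connex k N
  ... | inj₁ k<N = begin
    a k + b k     ≡⟨ cong (_+_ (a k)) (W.b≡a k j eq) ⟩
    a k + a j     ≡⟨ pairs k j eq ⟩
    a′ k + a′ j   ≡⟨ cong (_+_ (a′ k)) (W′.b≡a k j (trans eq len)) ⟨
    a′ k + b′ k   ∎
    where
    j = N ℕ.∸ suc k
    eq = complement k<N
  ... | inj₂ N≤k = trans (cong₂ _+_ (at-end u N≤k) (W.b-end N≤k))
                         (sym (cong₂ _+_ (at-end u′ (subst (_≤ k) len N≤k)) (W′.b-end (subst (_≤ k) len N≤k))))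

  b≡ : ∀ k → b k ≡ a′ k + b′ k - a k
  b≡ k = using-eq 1ℤ (sums k) (rearrange (a k) (b k) (a′ k) (b′ k))
    where
    rearrange : ∀ a b a′ b′ → b ≡ a′ + b′ - a + 1ℤ * (a + b - (a′ + b′))
    rearrange = solve-∀

  partial-sums : ∀ n → ∑ n a + ∑ n b ≡ ∑ n a′ + ∑ n b′
  partial-sums n = trans (sym (∑-+ n a b)) (trans (∑-cong n sums) (∑-+ n a′ b′))

  -- A word and its reverse have equal sums, so the sum of a + b is twice that of a.
  totals : ∑ N a ≡ ∑ N a′
  totals = *-cancelˡ-≡ (1ℤ + 1ℤ) _ _ (begin
    (1ℤ + 1ℤ) * ∑ N a                ≡⟨ double (∑ N a) ⟩
    (0ℤ + ∑ N a) + ∑ N a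
      ≡⟨ cong₂ _+_ (+-identityˡ (∑ N a)) (trans (sym (W.total 0 N refl)) (+-identityˡ (∑ N b))) ⟩
    ∑ N a + ∑ N b                    ≡⟨ partial-sums N ⟩
    ∑ N a′ + ∑ N b′                  ≡⟨ cong (_+_ (∑ N a′)) total′ ⟩
    ∑ N a′ + ∑ N a′                  ≡⟨ cong (_+ ∑ N a′) (+-identityˡ (∑ N a′)) ⟨
    (0ℤ + ∑ N a′) + ∑ N a′           ≡⟨ double (∑ N a′) ⟨
    (1ℤ + 1ℤ) * ∑ N a′               ∎)
    where
    double : ∀ x → (1ℤ + 1ℤ) * x ≡ (0ℤ + x) + x
    double = solve-∀
    total′ : ∑ N b′ ≡ ∑ N a′
    total′ =
      subst (λ n → ∑ n b′ ≡ ∑ n a′) (sym len) (trans (sym (+-identityˡ _)) (W′.total 0 W′.N refl))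

  e-antisymmetric : ∀ k j → suc (k ℕ.+ j) ≡ N → e j ≡ - e k
  e-antisymmetric k j eq = begin
    a j - a′ j    ≡⟨ cong₂ _-_ (W.b≡a k j eq) (W′.b≡a k j (trans eq len)) ⟨
    b k - b′ k    ≡⟨ cong (_- b′ k) (b≡ k) ⟩
    a′ k + b′ k - a k - b′ k ≡⟨ rearrange (a k) (a′ k) (b′ k) ⟩
    - e k         ∎
    where
    rearrange : ∀ a a′ b′ → a′ + b′ - a - b′ ≡ - (a - a′)
    rearrange = solve-∀

  f-antisymmetric : ∀ k j → suc (k ℕ.+ j) ≡ N → f j ≡ - f k
  f-antisymmetric k j eq = begin
    a j - b′ j    ≡⟨ cong₂ _-_ (W.b≡a k j eq) (W′.a≡b k j (trans eq len)) ⟨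
    b k - a′ k    ≡⟨ cong (_- a′ k) (b≡ k) ⟩
    a′ k + b′ k - a k - a′ k ≡⟨ rearrange (a k) (a′ k) (b′ k) ⟩
    - f k         ∎
    where
    rearrange : ∀ a a′ b′ → a′ + b′ - a - a′ ≡ - (a - b′)
    rearrange = solve-∀

  -- The third index l is the reflection of s, so `a l` and `b l` are `b s` and `a s`. After
  -- replacing b by a′ + b′ - a, equality of the triple counts is this bilinear relation.
  addition : ∀ i j → 3 ℕ.+ (i ℕ.+ j) ≤ N →
     e i * f j + f i * e j ≡ e (2 ℕ.+ (i ℕ.+ j)) * (f i + f j) + f (2 ℕ.+ (i ℕ.+ j)) * (e i + e j)
  addition i j le =
    using-eq -1ℤ triple (expand (a i) (a′ i) (b′ i) (a j) (a′ j) (b′ j) (a s) (a′ s) (b′ s))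
    where
    s = 2 ℕ.+ (i ℕ.+ j)
    l = N ℕ.∸ suc s
    eq : suc (s ℕ.+ l) ≡ N
    eq = complement le
    T : (a b : ℕ → ℤ) → ℤ
    T a b = a i * a s + a i * b j + a j * a s + a j * b i + b s * b j + b s * b i
    T-b : ℤ → ℤ → ℤ → ℤ
    T-b bi bj bs = a i * a s + a i * bj + a j * a s + a j * bi + bs * bj + bs * bi
    triple : T-b (a′ i + b′ i - a i) (a′ j + b′ j - a j) (a′ s + b′ s - a s) ≡ T a′ b′
    triple = begin
      T-b (a′ i + b′ i - a i) (a′ j + b′ j - a j) (a′ s + b′ s - a s)
        ≡⟨ cong₂ (λ x y → T-b x y (a′ s + b′ s - a s)) (b≡ i) (b≡ j) ⟨
      T-b (b i) (b j) (a′ s + b′ s - a s)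
        ≡⟨ cong (T-b (b i) (b j)) (b≡ s) ⟨
      T a b
        ≡⟨ cong₂ (λ x y → a i * x + a i * b j + a j * x + a j * b i + y * b j + y * b i)
             (W.a≡b s l eq) (W.b≡a s l eq) ⟩
      tripleCount u i j l
        ≡⟨ triples i j l eq ⟩
      tripleCount u′ i j l
        ≡⟨ cong₂ (λ x y → a′ i * x + a′ i * b′ j + a′ j * x + a′ j * b′ i + y * b′ j + y * b′ i)
             (W′.a≡b s l (trans eq len)) (W′.b≡a s l (trans eq len)) ⟨
      T a′ b′ ∎
    expand : ∀ aᵢ cᵢ dᵢ aⱼ cⱼ dⱼ aₛ cₛ dₛ →
      (aᵢ - cᵢ) * (aⱼ - dⱼ) + (aᵢ - dᵢ) * (aⱼ - cⱼ) ≡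
      (aₛ - cₛ) * (aᵢ - dᵢ + (aⱼ - dⱼ)) + (aₛ - dₛ) * (aᵢ - cᵢ + (aⱼ - cⱼ))
      + -1ℤ * (aᵢ * aₛ + aᵢ * (cⱼ + dⱼ - aⱼ) + aⱼ * aₛ + aⱼ * (cᵢ + dᵢ - aᵢ)
               + (cₛ + dₛ - aₛ) * (cⱼ + dⱼ - aⱼ) + (cₛ + dₛ - aₛ) * (cᵢ + dᵢ - aᵢ)
               - (cᵢ * cₛ + cᵢ * dⱼ + cⱼ * cₛ + cⱼ * dᵢ + dₛ * dⱼ + dₛ * dᵢ))
    expand = solve-∀

  -- The remaining part of `leafCount-skew` depends only on a + b, the length and the number of
  -- spine bits, in which the two words agree.
  skews : ∀ k → 2 ℕ.+ k ≤ N → W.skew k ≡ W′.skew k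
  skews k le = using-eq 1ℤ main (rearrange (W.skew k) (W′.skew k) rest)
    where
    j = N ℕ.∸ (2 ℕ.+ k)
    eq : 2 ℕ.+ (k ℕ.+ j) ≡ N
    eq = ℕₚ.m+[n∸m]≡n le
    rest : ℤ
    rest = (a′ k + b′ k) * (int N - ∑ N a′ - int k + 1ℤ) + (a′ (suc k) + b′ (suc k)) * (int k + int 2)
    main : rest + W.skew k ≡ rest + W′.skew k
    main = begin
      rest + W.skew k
        ≡⟨ cong₂ (λ x y → x * (int N - ∑ N a′ - int k + 1ℤ) + y * (int k + int 2) + W.skew k)
             (sums k) (sums (suc k)) ⟨
      _ ≡⟨ cong (λ z → (a k + b k) * (int N - z - int k + 1ℤ)
                       + (a (suc k) + b (suc k)) * (int k + int 2) + W.skew k) totals ⟨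
      _ ≡⟨ W.leafCount-skew k j eq ⟨
      leafCount u k j
        ≡⟨ leaves k j eq ⟩
      leafCount u′ k j
        ≡⟨ W′.leafCount-skew k j (trans eq len) ⟩
      _ ≡⟨ cong (λ n → (a′ k + b′ k) * (int n - ∑ n a′ - int k + 1ℤ)
                       + (a′ (suc k) + b′ (suc k)) * (int k + int 2) + W′.skew k) len ⟨
      rest + W′.skew k ∎
    rearrange : ∀ x y r → x ≡ y + 1ℤ * (r + x - (r + y))
    rearrange = solve-∀

  -- With b and its partial sums eliminated, the difference of the two skews turns into the left
  -- side up to sign.
  boundary : ∀ k → 2 ℕ.+ k ≤ N → (e (suc k) - e k) * ∑ k f + (f (suc k) - f k) * ∑ k e ≡ 0ℤ
  boundary k le = begin
    (e (suc k) - e k) * ∑ k f + (f (suc k) - f k) * ∑ k e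
      ≡⟨ cong₂ (λ x y → (e (suc k) - e k) * x + (f (suc k) - f k) * y) (∑-minus k a b′) (∑-minus k a a′) ⟩
    (e (suc k) - e k) * (∑ k a - ∑ k b′) + (f (suc k) - f k) * (∑ k a - ∑ k a′)
      ≡⟨ using-eq -1ℤ skew
           (expand (a k) (a′ k) (b′ k) (a (suc k)) (a′ (suc k)) (b′ (suc k)) (∑ k a) (∑ k a′) (∑ k b′)) ⟩
    0ℤ ∎
    where
    ∑b≡ : ∑ k b ≡ ∑ k a′ + ∑ k b′ - ∑ k a
    ∑b≡ = using-eq 1ℤ (partial-sums k) (rearrange (∑ k a) (∑ k b) (∑ k a′) (∑ k b′))
      where
      rearrange : ∀ a b a′ b′ → b ≡ a′ + b′ - a + 1ℤ * (a + b - (a′ + b′))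
      rearrange = solve-∀
    skew : (a k - a (suc k)) * ∑ k a
           + (a′ k + b′ k - a k - (a′ (suc k) + b′ (suc k) - a (suc k))) * (∑ k a′ + ∑ k b′ - ∑ k a)
           ≡ W′.skew k
    skew = trans (sym (trans
      (cong₂ (λ x y → (a k - a (suc k)) * ∑ k a + (x - y) * ∑ k b) (b≡ k) (b≡ (suc k)))
      (cong (λ z → (a k - a (suc k)) * ∑ k a
           + (a′ k + b′ k - a k - (a′ (suc k) + b′ (suc k) - a (suc k))) * z) ∑b≡))) (skews k le)
    expand : ∀ a₀ c₀ d₀ a₁ c₁ d₁ A C D →
      (a₁ - c₁ - (a₀ - c₀)) * (A - D) + (a₁ - d₁ - (a₀ - d₀)) * (A - C) ≡
      0ℤ + -1ℤ * ((a₀ - a₁) * A + (c₀ + d₀ - a₀ - (c₁ + d₁ - a₁)) * (C + D - A)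
                 - ((c₀ - c₁) * C + (d₀ - d₁) * D))
    expand = solve-∀

  ef≡0 : ∀ k → e k * f k ≡ 0ℤ
  ef≡0 k =
    bit-differences-product (at-bit u k) (at-bit (reverse u) k) (at-bit u′ k) (at-bit (reverse u′) k) (sums k)

  agree-beyond : ∀ {v} → length v ≡ length u′ → (∀ i → i < N → a i - at v i ≡ 0ℤ) → u ≡ v
  agree-beyond {v} len-v zero-below =
    at-injective u v (trans len (sym len-v)) λ k → go k (ℕₚ.<-≤-connex k N)
    where
    go : ∀ k → k < N ⊎ N ≤ k → a k ≡ at v k
    go k (inj₁ k<N) = i-j≡0⇒i≡j (a k) (at v k) (zero-below k k<N)
    go k (inj₂ N≤k) = trans (at-end u N≤k) (sym (at-end v (subst (_≤ k) (trans len (sym len-v)) N≤k)))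

  equal-or-reverse : u ≡ u′ ⊎ u ≡ reverse u′
  equal-or-reverse with least-nonzero e N | least-nonzero f N
  ... | inj₁ e≡0 | _        = inj₁ (agree-beyond refl e≡0)
  ... | inj₂ _   | inj₁ f≡0 = inj₂ (agree-beyond (length-reverse u′) f≡0)
  ... | inj₂ (p , p<N , e-low , ep≢0) | inj₂ (q , q<N , f-low , fq≢0) with ℕₚ.<-cmp q p
  ...   | tri< q<p _ _ = ⊥-elim (Core.no-leads N e f
            (λ k → bit-difference (at-bit u k) (at-bit (reverse u′) k)) ef≡0 addition boundary
            p q q<p (antisymmetric-lead e-antisymmetric p<N e-low ep≢0) e-low ep≢0 f-low fq≢0)
  ...   | tri≈ _ refl _ = contradiction (cancel-≢0 ep≢0 (ef≡0 p)) fq≢0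
  -- `no-leads` expects the sequence that starts earlier in the place of f; the relations are
  -- symmetric in e and f, so the two are exchanged.
  ...   | tri> _ _ p<q = ⊥-elim (Core.no-leads N f e
            (λ k → bit-difference (at-bit u k) (at-bit u′ k))
            (λ k → trans (*-comm (f k) (e k)) (ef≡0 k))
            (λ i j le → trans (+-comm (f i * e j) (e i * f j)) (trans (addition i j le)
              (+-comm (e (2 ℕ.+ (i ℕ.+ j)) * (f i + f j)) (f (2 ℕ.+ (i ℕ.+ j)) * (e i + e j)))))
            (λ k le → trans (+-comm ((f (suc k) - f k) * ∑ k e) ((e (suc k) - e k) * ∑ k f)) (boundary k le))
            q p p<q (antisymmetric-lead f-antisymmetric q<N f-low fq≢0) f-low fq≢0 e-low ep≢0)

open import Defs

-- Component sizes after cutting edges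

-- The word lists the vertices other than the root, true standing for a spine
-- vertex; every vertex is joined to the last spine vertex before it.  With i = 1,
-- h is summed over the component sizes for all choices of edges to be cut.  In
-- general i is the size so far of the component of the last spine vertex.
cutSum : (List ℕ → ℤ) → ℕ → List Bool → ℤ
cutSum h i []          = h (i ∷ [])
cutSum h i (true  ∷ w) = cutSum h (suc i) w + cutSum (h ∘ (i ∷_)) 1 w
cutSum h i (false ∷ w) = cutSum h (suc i) w + cutSum (h ∘ (1 ∷_)) i w

cutSum-cong : ∀ {g h} → (∀ s → g s ≡ h s) → ∀ i w → cutSum g i w ≡ cutSum h i w
cutSum-cong eq i []          = eq _
cutSum-cong eq i (true  ∷ w) = cong₂ _+_ (cutSum-cong eq (suc i) w) (cutSum-cong (eq ∘ (i ∷_)) 1 w)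
cutSum-cong eq i (false ∷ w) = cong₂ _+_ (cutSum-cong eq (suc i) w) (cutSum-cong (eq ∘ (1 ∷_)) i w)

cutSum-+ : ∀ g h i w → cutSum (λ s → g s + h s) i w ≡ cutSum g i w + cutSum h i w
cutSum-+ g h i []          = refl
cutSum-+ g h i (true  ∷ w) =
  trans (cong₂ _+_ (cutSum-+ g h (suc i) w) (cutSum-+ (g ∘ (i ∷_)) (h ∘ (i ∷_)) 1 w))
    (interchange (cutSum g (suc i) w) (cutSum h (suc i) w) (cutSum (g ∘ (i ∷_)) 1 w) (cutSum (h ∘ (i ∷_)) 1 w))
cutSum-+ g h i (false ∷ w) =
  trans (cong₂ _+_ (cutSum-+ g h (suc i) w) (cutSum-+ (g ∘ (1 ∷_)) (h ∘ (1 ∷_)) i w))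
    (interchange (cutSum g (suc i) w) (cutSum h (suc i) w) (cutSum (g ∘ (1 ∷_)) i w) (cutSum (h ∘ (1 ∷_)) i w))

cutSum-* : ∀ c g i w → cutSum (λ s → c * g s) i w ≡ c * cutSum g i w
cutSum-* c g i []          = refl
cutSum-* c g i (true  ∷ w) =
  trans (cong₂ _+_ (cutSum-* c g (suc i) w) (cutSum-* c (g ∘ (i ∷_)) 1 w)) (sym (*-distribˡ-+ c (cutSum g (suc i) w) _))
cutSum-* c g i (false ∷ w) =
  trans (cong₂ _+_ (cutSum-* c g (suc i) w) (cutSum-* c (g ∘ (1 ∷_)) i w)) (sym (*-distribˡ-+ c (cutSum g (suc i) w) _))

δ : ℕ → ℕ → ℤ
δ zero    zero    = 1ℤ
δ zero    (suc _) = 0ℤ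
δ (suc _) zero    = 0ℤ
δ (suc p) (suc q) = δ p q

δ-refl : ∀ p → δ p p ≡ 1ℤ
δ-refl zero    = refl
δ-refl (suc p) = δ-refl p

δ-≡ : ∀ {p q} → p ≡ q → δ p q ≡ 1ℤ
δ-≡ {p} refl = δ-refl p

δ-≢ : ∀ {p q} → p ≢ q → δ p q ≡ 0ℤ
δ-≢ {zero}  {zero}  p≢q = contradiction refl p≢q
δ-≢ {zero}  {suc _} _   = refl
δ-≢ {suc _} {zero}  _   = refl
δ-≢ {suc p} {suc q} p≢q = δ-≢ (p≢q ∘ cong suc)

indicator : List ℕ → List ℕ → ℤ
indicator []      []      = 1ℤ
indicator []      (_ ∷ _) = 0ℤ
indicator (_ ∷ _) []      = 0ℤ
indicator (p ∷ t) (q ∷ s) = δ p q * indicator t s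

indicator-≢ : ∀ t s → s ≢ t → indicator t s ≡ 0ℤ
indicator-≢ []      []      s≢t = contradiction refl s≢t
indicator-≢ []      (_ ∷ _) _   = refl
indicator-≢ (_ ∷ _) []      _   = refl
indicator-≢ (p ∷ t) (q ∷ s) s≢t with p ℕₚ.≟ q
... | yes refl = trans (cong (δ p p *_) (indicator-≢ t s (s≢t ∘ cong (p ∷_)))) (*-zeroʳ (δ p p))
... | no  p≢q    = trans (cong (_* indicator t s) (δ-≢ p≢q)) (*-zeroˡ (indicator t s))

-- The number of ways to cut such that the components, in the order of their completion, have the
-- sizes in the list. A leaf that is cut off is complete at once and so precedes the component of
-- its spine vertex.
occurrences : List ℕ → ℕ → List Bool → ℤ
occurrences []      i w           = 0ℤ
occurrences (p ∷ t) i []          = δ p i * indicator t []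
occurrences (p ∷ t) i (true  ∷ w) = occurrences (p ∷ t) (suc i) w + δ p i * occurrences t 1 w
occurrences (p ∷ t) i (false ∷ w) = occurrences (p ∷ t) (suc i) w + δ p 1 * occurrences t i w

cutSum-zero : ∀ {h} → (∀ q s → h (q ∷ s) ≡ 0ℤ) → ∀ i w → cutSum h i w ≡ 0ℤ
cutSum-zero eq i []          = eq i []
cutSum-zero eq i (true  ∷ w) =
  cong₂ _+_ (cutSum-zero eq (suc i) w) (cutSum-zero (λ q s → eq i (q ∷ s)) 1 w)
cutSum-zero eq i (false ∷ w) =
  cong₂ _+_ (cutSum-zero eq (suc i) w) (cutSum-zero (λ q s → eq 1 (q ∷ s)) i w)

cutSum-indicator : ∀ t i w → cutSum (indicator t) i w ≡ occurrences t i w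
cutSum-indicator []      i w           = cutSum-zero (λ _ _ → refl) i w
cutSum-indicator (p ∷ t) i []          = refl
cutSum-indicator (p ∷ t) i (true  ∷ w) = cong₂ _+_ (cutSum-indicator (p ∷ t) (suc i) w)
  (trans (cutSum-* (δ p i) (indicator t) 1 w) (cong (δ p i *_) (cutSum-indicator t 1 w)))
cutSum-indicator (p ∷ t) i (false ∷ w) = cong₂ _+_ (cutSum-indicator (p ∷ t) (suc i) w)
  (trans (cutSum-* (δ p 1) (indicator t) i w) (cong (δ p 1 *_) (cutSum-indicator t i w)))

0*+ : ∀ m n → m + 0ℤ * n ≡ m
0*+ = solve-∀

-- A single component means that nothing is cut.
occurrences-[_] : ∀ r i w → occurrences (r ∷ []) i w ≡ δ r (i ℕ.+ length w)
occurrences-[ r ] i []          = trans (*-identityʳ (δ r i)) (cong (δ r) (sym (ℕₚ.+-identityʳ i)))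
occurrences-[ r ] i (true  ∷ w) = begin
  occurrences (r ∷ []) (suc i) w + δ r i * 0ℤ
    ≡⟨ cong₂ _+_ (occurrences-[ r ] (suc i) w) (*-zeroʳ (δ r i)) ⟩
  δ r (suc i ℕ.+ length w) + 0ℤ                 ≡⟨ +-identityʳ _ ⟩
  δ r (suc i ℕ.+ length w)                      ≡⟨ cong (δ r) (ℕₚ.+-suc i (length w)) ⟨
  δ r (i ℕ.+ suc (length w))                    ∎
occurrences-[ r ] i (false ∷ w) = begin
  occurrences (r ∷ []) (suc i) w + δ r 1 * 0ℤ
    ≡⟨ cong₂ _+_ (occurrences-[ r ] (suc i) w) (*-zeroʳ (δ r 1)) ⟩
  δ r (suc i ℕ.+ length w) + 0ℤ                 ≡⟨ +-identityʳ _ ⟩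
  δ r (suc i ℕ.+ length w)                      ≡⟨ cong (δ r) (ℕₚ.+-suc i (length w)) ⟨
  δ r (i ℕ.+ suc (length w))                    ∎

-- A first entry of at least 2 is not a leaf cut off, so it is the current component, which has
-- already outgrown q.
occurrences-low : ∀ {q} t r i w → 2 ≤ q → q < i → occurrences (q ∷ r ∷ t) i w ≡ 0ℤ
occurrences-low {q} t r i [] _ _ = *-zeroʳ (δ q i)
occurrences-low {q} t r i (true ∷ w) 2≤q q<i
  rewrite occurrences-low t r (suc i) w 2≤q (ℕₚ.m<n⇒m<1+n q<i) | δ-≢ (ℕₚ.<⇒≢ q<i) =
    0*+ 0ℤ (occurrences (r ∷ t) 1 w)
occurrences-low {q} t r i (false ∷ w) 2≤q q<i
  rewrite occurrences-low t r (suc i) w 2≤q (ℕₚ.m<n⇒m<1+n q<i) | δ-≢ (≢-sym (ℕₚ.<⇒≢ 2≤q)) =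
    0*+ 0ℤ (occurrences (r ∷ t) i w)

-- A first entry of at least 2 means that no leaf is cut off before the current component is
-- complete. So this takes the next m vertices without exception, and the cut behind them needs a
-- spine vertex in position m, where a fresh component starts.
occurrences-cut : ∀ r t i m w → 2 ≤ i ℕ.+ m →
  occurrences (i ℕ.+ m ∷ r ∷ t) i w ≡ at w m * occurrences (r ∷ t) 1 (drop (suc m) w)
occurrences-cut r t i m [] _ =
  trans (*-zeroʳ (δ (i ℕ.+ m) i)) (sym (*-zeroˡ (occurrences (r ∷ t) 1 [])))
occurrences-cut r t i zero (true ∷ w) le
  rewrite occurrences-low t r (suc i) w le (s≤s (ℕₚ.≤-reflexive (ℕₚ.+-identityʳ i)))
        | δ-≡ (ℕₚ.+-identityʳ i) = +-identityˡ _
occurrences-cut r t i zero (false ∷ w) le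
  rewrite occurrences-low t r (suc i) w le (s≤s (ℕₚ.≤-reflexive (ℕₚ.+-identityʳ i)))
        | δ-≢ (≢-sym (ℕₚ.<⇒≢ le)) = zeros (occurrences (r ∷ t) i w) (occurrences (r ∷ t) 1 w)
  where
  zeros : ∀ m n → 0ℤ + 0ℤ * m ≡ 0ℤ * n
  zeros = solve-∀
occurrences-cut r t i (suc m) (true ∷ w) le
  rewrite δ-≢ {i ℕ.+ suc m} {i} (λ eq → ℕₚ.m≢1+m+n i (trans (sym eq) (ℕₚ.+-suc i m)))
        | ℕₚ.+-suc i m
        | occurrences-cut r t (suc i) m w le = 0*+ _ (occurrences (r ∷ t) 1 w)
occurrences-cut r t i (suc m) (false ∷ w) le
  rewrite δ-≢ (≢-sym (ℕₚ.<⇒≢ le))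
        | ℕₚ.+-suc i m
        | occurrences-cut r t (suc i) m w le = 0*+ _ (occurrences (r ∷ t) i w)

occurrences-pair : ∀ i m r w → 2 ≤ i ℕ.+ m → m ℕ.+ r ≡ length w →
                   occurrences (i ℕ.+ m ∷ r ∷ []) i w ≡ at w m
occurrences-pair i m r w le eq = begin
  occurrences (i ℕ.+ m ∷ r ∷ []) i w                 ≡⟨ occurrences-cut r [] i m w le ⟩
  at w m * occurrences (r ∷ []) 1 (drop (suc m) w)
    ≡⟨ cong (at w m *_) (occurrences-[ r ] 1 (drop (suc m) w)) ⟩
  at w m * δ r (suc (length (drop (suc m) w)))       ≡⟨ cut (ℕₚ.<-≤-connex m (length w)) ⟩
  at w m                                             ∎
  where
  cut : m < length w ⊎ length w ≤ m → at w m * δ r (suc (length (drop (suc m) w))) ≡ at w m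
  cut (inj₁ m<) = trans (cong (at w m *_) (δ-≡ (ℕₚ.+-cancelˡ-≡ m _ _ (begin
    m ℕ.+ r                                   ≡⟨ eq ⟩
    length w                                  ≡⟨ ℕₚ.m+[n∸m]≡n m< ⟨
    suc (m ℕ.+ (length w ℕ.∸ suc m))          ≡⟨ ℕₚ.+-suc m _ ⟨
    m ℕ.+ suc (length w ℕ.∸ suc m)            ≡⟨ cong (λ n → m ℕ.+ suc n) (length-drop (suc m) w) ⟨
    m ℕ.+ suc (length (drop (suc m) w))       ∎)))) (*-identityʳ (at w m))
  cut (inj₂ ≤m) rewrite at-end w ≤m = refl

falses : List Bool → ℤ
falses []          = 0ℤ
falses (true  ∷ w) = falses w
falses (false ∷ w) = falses w + 1ℤ

-- The current component is too large to be the entry 1, which therefore is any one of the leaves.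
occurrences-1-last : ∀ r i w → 2 ≤ i → suc r ≡ i ℕ.+ length w → occurrences (1 ∷ r ∷ []) i w ≡ falses w
occurrences-1-last r i [] _ _ = *-zeroʳ (δ 1 i)
occurrences-1-last r i (true ∷ w) le eq
  rewrite occurrences-1-last r (suc i) w (ℕₚ.m≤n⇒m≤1+n le) (trans eq (ℕₚ.+-suc i (length w)))
        | δ-≢ (ℕₚ.<⇒≢ le) = 0*+ (falses w) (occurrences (r ∷ []) 1 w)
occurrences-1-last r i (false ∷ w) le eq
  rewrite occurrences-1-last r (suc i) w (ℕₚ.m≤n⇒m≤1+n le) (trans eq (ℕₚ.+-suc i (length w)))
        | occurrences-[ r ] i w
        | δ-≡ (ℕₚ.suc-injective (trans eq (ℕₚ.+-suc i (length w)))) = refl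

-- While the current component has size 1, the entry 1 can also be its spine vertex alone, provided
-- that the next vertex lies on the spine.
occurrences-1-fresh : ∀ r w → suc r ≡ suc (length w) → occurrences (1 ∷ r ∷ []) 1 w ≡ falses w + at w 0
occurrences-1-fresh r [] _ = refl
occurrences-1-fresh r (true ∷ w) eq
  rewrite occurrences-1-last r 2 w ℕₚ.≤-refl eq | occurrences-[ r ] 1 w | δ-≡ (ℕₚ.suc-injective eq) =
    refl
occurrences-1-fresh r (false ∷ w) eq
  rewrite occurrences-1-last r 2 w ℕₚ.≤-refl eq | occurrences-[ r ] 1 w | δ-≡ (ℕₚ.suc-injective eq) =
    sym (+-identityʳ _)

occurrences-1-low : ∀ {q} r i w → 2 ≤ q → q < i → occurrences (1 ∷ q ∷ r ∷ []) i w ≡ 0ℤ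
occurrences-1-low r i [] _ _ = *-zeroʳ (δ 1 i)
occurrences-1-low {q} r i (true ∷ w) le q<i
  rewrite occurrences-1-low r (suc i) w le (ℕₚ.m<n⇒m<1+n q<i)
        | δ-≢ (ℕₚ.<⇒≢ (ℕₚ.<-trans le q<i)) = 0*+ 0ℤ (occurrences (q ∷ r ∷ []) 1 w)
occurrences-1-low r i (false ∷ w) le q<i
  rewrite occurrences-1-low r (suc i) w le (ℕₚ.m<n⇒m<1+n q<i)
        | occurrences-low [] r i w le q<i = refl

-- The component of i + m vertices is complete after m + 1 further vertices, because one of these is
-- the leaf cut off; it may be any leaf among them. The condition 2 ≤ i keeps the current component
-- from being the entry 1.
occurrences-1-first : ∀ i m r w → 2 ≤ i → suc (m ℕ.+ r) ≡ length w →
  occurrences (1 ∷ i ℕ.+ m ∷ r ∷ []) i w ≡ falses (take (suc m) w) * at w (suc m)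
occurrences-1-first i zero r (true ∷ w) le eq
  rewrite occurrences-1-low r (suc i) w (ℕₚ.≤-trans le (ℕₚ.m≤m+n i 0)) (s≤s (ℕₚ.≤-reflexive (ℕₚ.+-identityʳ i)))
        | δ-≢ (ℕₚ.<⇒≢ le) = 0*+ 0ℤ (occurrences (i ℕ.+ 0 ∷ r ∷ []) 1 w)
occurrences-1-first i zero r (false ∷ w) le eq
  rewrite occurrences-1-low r (suc i) w (ℕₚ.≤-trans le (ℕₚ.m≤m+n i 0)) (s≤s (ℕₚ.≤-reflexive (ℕₚ.+-identityʳ i)))
        | occurrences-pair i 0 r w (ℕₚ.≤-trans le (ℕₚ.m≤m+n i 0)) (ℕₚ.suc-injective eq) = units (at w 0)
  where
  units : ∀ n → 0ℤ + 1ℤ * n ≡ 1ℤ * n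
  units = solve-∀
occurrences-1-first i (suc m) r (true ∷ w) le eq
  rewrite δ-≢ (ℕₚ.<⇒≢ le) | ℕₚ.+-suc i m
        | occurrences-1-first (suc i) m r w (ℕₚ.m≤n⇒m≤1+n le) (ℕₚ.suc-injective eq)
        = 0*+ _ (occurrences (suc (i ℕ.+ m) ∷ r ∷ []) 1 w)
occurrences-1-first i (suc m) r (false ∷ w) le eq
  rewrite occurrences-pair i (suc m) r w (ℕₚ.≤-trans le (ℕₚ.m≤m+n i (suc m))) (ℕₚ.suc-injective eq)
        | ℕₚ.+-suc i m
        | occurrences-1-first (suc i) m r w (ℕₚ.m≤n⇒m≤1+n le) (ℕₚ.suc-injective eq)
        = collect (falses (take (suc m) w)) (at w (suc m))
  where
  collect : ∀ m n → m * n + 1ℤ * n ≡ (m + 1ℤ) * n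
  collect = solve-∀

∑-shift : ∀ n f → ∑ (suc n) f ≡ f 0 + ∑ n (f ∘ suc)
∑-shift zero    f = +-comm 0ℤ (f 0)
∑-shift (suc n) f =
  trans (cong (_+ f (suc n)) (∑-shift n f)) (+-assoc (f 0) (∑ n (f ∘ suc)) (f (suc n)))

int-suc : ∀ n → int (suc n) ≡ 1ℤ + int n
int-suc n = pos-+ 1 n

falses-take : ∀ m w → m ≤ length w → falses (take m w) ≡ int m - ∑ m (at w)
falses-take zero    w           _         = refl
falses-take (suc m) (true ∷ w)  (s≤s m≤w) = begin
  falses (take m w)                  ≡⟨ falses-take m w m≤w ⟩
  int m - ∑ m (at w)                 ≡⟨ pad (int m) (∑ m (at w)) ⟩
  1ℤ + int m - (1ℤ + ∑ m (at w))     ≡⟨ cong₂ _-_ (int-suc m) (∑-shift m (at (true ∷ w))) ⟨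
  int (suc m) - ∑ (suc m) (at (true ∷ w)) ∎
  where
  pad : ∀ m n → m - n ≡ 1ℤ + m - (1ℤ + n)
  pad = solve-∀
falses-take (suc m) (false ∷ w) (s≤s m≤w) = begin
  falses (take m w) + 1ℤ             ≡⟨ cong (_+ 1ℤ) (falses-take m w m≤w) ⟩
  int m - ∑ m (at w) + 1ℤ            ≡⟨ pad (int m) (∑ m (at w)) ⟩
  1ℤ + int m - (0ℤ + ∑ m (at w))     ≡⟨ cong₂ _-_ (int-suc m) (∑-shift m (at (false ∷ w))) ⟨
  int (suc m) - ∑ (suc m) (at (false ∷ w)) ∎
  where
  pad : ∀ m n → m - n + 1ℤ ≡ 1ℤ + m - (0ℤ + n)
  pad = solve-∀

falses-take-drop : ∀ m w → falses (take m w) + falses (drop m w) ≡ falses w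
falses-take-drop zero    w           = +-identityˡ (falses w)
falses-take-drop (suc m) []          = refl
falses-take-drop (suc m) (true ∷ w)  = falses-take-drop m w
falses-take-drop (suc m) (false ∷ w) =
  trans (move (falses (take m w)) (falses (drop m w))) (cong (_+ 1ℤ) (falses-take-drop m w))
  where
  move : ∀ m n → m + 1ℤ + n ≡ m + n + 1ℤ
  move = solve-∀

falses-all : ∀ w → falses w ≡ int (length w) - ∑ (length w) (at w)
falses-all w =
  trans (cong falses (sym (take-all (length w) w ℕₚ.≤-refl))) (falses-take (length w) w ℕₚ.≤-refl)

at-drop : ∀ m w k → at (drop m w) k ≡ at w (m ℕ.+ k)
at-drop zero    w       k = refl
at-drop (suc m) []      k = refl
at-drop (suc m) (s ∷ w) k = at-drop m w k

-- The word of the caterpillar coded by u: on at least three vertices, both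
-- the first and the last vertex other than the root are leaves.
wrap : List Bool → List Bool
wrap u = false ∷ u ∷ʳ false

length-wrap : ∀ u → length (wrap u) ≡ 2 ℕ.+ length u
length-wrap u = cong suc (trans (length-++ u) (ℕₚ.+-comm (length u) 1))

at-wrap : ∀ u k → at (wrap u) (suc k) ≡ at u k
at-wrap u k = at-∷ʳ-false u k

length-drop-wrap : ∀ u m n → m ℕ.+ n ≡ length u → length (drop (2 ℕ.+ m) (wrap u)) ≡ n
length-drop-wrap u m n eq = begin
  length (drop (2 ℕ.+ m) (wrap u))       ≡⟨ length-drop (2 ℕ.+ m) (wrap u) ⟩
  length (wrap u) ℕ.∸ (2 ℕ.+ m)          ≡⟨ cong (ℕ._∸ (2 ℕ.+ m)) (length-wrap u) ⟩
  length u ℕ.∸ m                         ≡⟨ cong (ℕ._∸ m) eq ⟨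
  m ℕ.+ n ℕ.∸ m                          ≡⟨ ℕₚ.m+n∸m≡n m n ⟩
  n                                      ∎

module Occurrences (u : List Bool) where
  open Word u using (N; a; b; a≡b)

  w = wrap u

  -- The first component consists of the root, the leaf put in front by `wrap` and k vertices coded
  -- by `u`, so the cut is at bit k.
  pair : ∀ k j → suc (k ℕ.+ j) ≡ N → occurrences (2 ℕ.+ k ∷ 2 ℕ.+ j ∷ []) 1 w ≡ a k
  pair k j eq = trans (occurrences-pair 1 (suc k) (2 ℕ.+ j) w (s≤s (s≤s z≤n)) sizes) (at-wrap u k)
    where
    sizes : suc k ℕ.+ (2 ℕ.+ j) ≡ length w
    sizes = begin
      suc (k ℕ.+ (2 ℕ.+ j))       ≡⟨ cong suc (ℕₚ.+-suc k (suc j)) ⟩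
      2 ℕ.+ (k ℕ.+ suc j)         ≡⟨ cong (2 ℕ.+_) (ℕₚ.+-suc k j) ⟩
      2 ℕ.+ (suc (k ℕ.+ j))       ≡⟨ cong (2 ℕ.+_) eq ⟩
      2 ℕ.+ N                     ≡⟨ length-wrap u ⟨
      length w                    ∎

  after-cut : ∀ r t k →
      occurrences (2 ℕ.+ k ∷ r ∷ t) 1 w ≡ a k * occurrences (r ∷ t) 1 (drop (2 ℕ.+ k) w)
  after-cut r t k = trans (occurrences-cut r t 1 (suc k) w (s≤s (s≤s z≤n)))
                            (cong (_* occurrences (r ∷ t) 1 (drop (2 ℕ.+ k) w)) (at-wrap u k))

  -- The second cut has 2 + l vertices behind it, hence is at bit l when read from the other end.
  triple : ∀ k j l → 3 ℕ.+ (k ℕ.+ j ℕ.+ l) ≡ N →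
           occurrences (2 ℕ.+ k ∷ 2 ℕ.+ j ∷ 2 ℕ.+ l ∷ []) 1 w ≡ a k * b l
  triple k j l eq = trans (after-cut (2 ℕ.+ j) (2 ℕ.+ l ∷ []) k) (cong (a k *_) (begin
    occurrences (2 ℕ.+ j ∷ 2 ℕ.+ l ∷ []) 1 v
      ≡⟨ occurrences-pair 1 (suc j) (2 ℕ.+ l) v (s≤s (s≤s z≤n)) (sym sizes) ⟩
    at v (suc j)                               ≡⟨ at-drop (2 ℕ.+ k) w (suc j) ⟩
    at w (2 ℕ.+ k ℕ.+ suc j)                   ≡⟨ at-wrap u _ ⟩
    a (suc k ℕ.+ suc j)                        ≡⟨ cong (a ∘ suc) (ℕₚ.+-suc k j) ⟩
    a (2 ℕ.+ (k ℕ.+ j))                        ≡⟨ a≡b _ l eq ⟩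
    b l                                        ∎))
    where
    v = drop (2 ℕ.+ k) w
    sizes : length v ≡ suc j ℕ.+ (2 ℕ.+ l)
    sizes = length-drop-wrap u k _ (begin
      k ℕ.+ suc (j ℕ.+ (2 ℕ.+ l))    ≡⟨ ℕₚ.+-suc k _ ⟩
      suc (k ℕ.+ (j ℕ.+ (2 ℕ.+ l)))  ≡⟨ cong suc (ℕₚ.+-assoc k j (2 ℕ.+ l)) ⟨
      suc (k ℕ.+ j ℕ.+ (2 ℕ.+ l))
        ≡⟨ cong suc (trans (ℕₚ.+-suc (k ℕ.+ j) (suc l)) (cong suc (ℕₚ.+-suc (k ℕ.+ j) l))) ⟩
      3 ℕ.+ (k ℕ.+ j ℕ.+ l)          ≡⟨ eq ⟩
      N                              ∎)

  module _ (k j : ℕ) (eq : 2 ℕ.+ (k ℕ.+ j) ≡ N) where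

    v = drop (2 ℕ.+ k) w

    length-v : length v ≡ 2 ℕ.+ j
    length-v = length-drop-wrap u k _ (trans (trans (ℕₚ.+-suc k (suc j)) (cong suc (ℕₚ.+-suc k j))) eq)

    k<N : k < N
    k<N = ℕₚ.≤-trans (ℕₚ.m≤n⇒m≤1+n (s≤s (ℕₚ.m≤m+n k j))) (ℕₚ.≤-reflexive eq)

    -- The last entry is the component of the last spine vertex. For it to be 1 with no leaf cut
    -- off, the word would have to end with a spine vertex, but `wrap` ends it with a leaf.
    leaf-last : occurrences (2 ℕ.+ k ∷ 2 ℕ.+ j ∷ 1 ∷ []) 1 w ≡ 0ℤ
    leaf-last = trans (after-cut (2 ℕ.+ j) (1 ∷ []) k) (trans (cong (a k *_) (begin
      occurrences (2 ℕ.+ j ∷ 1 ∷ []) 1 v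
        ≡⟨ occurrences-pair 1 (suc j) 1 v (s≤s (s≤s z≤n)) (sym (trans length-v (ℕₚ.+-comm 1 (suc j)))) ⟩
      at v (suc j)                        ≡⟨ at-drop (2 ℕ.+ k) w (suc j) ⟩
      at w (2 ℕ.+ k ℕ.+ suc j)            ≡⟨ at-wrap u _ ⟩
      a (suc k ℕ.+ suc j)                 ≡⟨ cong (a ∘ suc) (ℕₚ.+-suc k j) ⟩
      a (2 ℕ.+ (k ℕ.+ j))                 ≡⟨ at-end u (ℕₚ.≤-reflexive (sym eq)) ⟩
      0ℤ                                  ∎)) (*-zeroʳ (a k)))

    -- Behind the first cut, the entry 1 is one of the remaining leaves or the spine vertex just
    -- reached, left alone.
    leaf-middle : occurrences (2 ℕ.+ k ∷ 1 ∷ 2 ℕ.+ j ∷ []) 1 w ≡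
                  a k * (int N - ∑ N a - int k + ∑ (suc k) a + a (suc k))
    leaf-middle = trans (after-cut 1 (2 ℕ.+ j ∷ []) k) (cong (a k *_) (begin
      occurrences (1 ∷ 2 ℕ.+ j ∷ []) 1 v
        ≡⟨ occurrences-1-fresh (2 ℕ.+ j) v (cong suc (sym length-v)) ⟩
      falses v + at v 0                     ≡⟨ cong₂ _+_ falses-v at-v ⟩
      int N - ∑ N a - int k + ∑ (suc k) a + a (suc k) ∎))
      where
      at-v : at v 0 ≡ a (suc k)
      at-v =
        trans (at-drop (2 ℕ.+ k) w 0) (trans (at-wrap u (suc (k ℕ.+ 0))) (cong (a ∘ suc) (ℕₚ.+-identityʳ k)))
      sum-w : ∀ n → ∑ (suc n) (at w) ≡ ∑ n a
      sum-w n = trans (∑-shift n (at w)) (trans (+-identityˡ _) (∑-cong n (at-wrap u)))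
      falses-w : falses w ≡ int 2 + int N - ∑ N a
      falses-w = begin
        falses w                                    ≡⟨ falses-all w ⟩
        int (length w) - ∑ (length w) (at w)        ≡⟨ cong (λ n → int n - ∑ n (at w)) (length-wrap u) ⟩
        int (2 ℕ.+ N) - ∑ (2 ℕ.+ N) (at w)          ≡⟨ cong₂ _-_ (pos-+ 2 N) (sum-w (suc N)) ⟩
        int 2 + int N - (∑ N a + a N)
          ≡⟨ cong (λ n → int 2 + int N - (∑ N a + n)) (at-end u ℕₚ.≤-refl) ⟩
        int 2 + int N - (∑ N a + 0ℤ)
          ≡⟨ cong (λ n → int 2 + int N - n) (+-identityʳ (∑ N a)) ⟩
        int 2 + int N - ∑ N a                       ∎
      falses-v : falses v ≡ int N - ∑ N a - int k + ∑ (suc k) a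
      falses-v = begin
        falses v
          ≡⟨ using-eq 1ℤ (falses-take-drop (2 ℕ.+ k) w) (isolate (falses (take (2 ℕ.+ k) w)) (falses v) (falses w)) ⟩
        falses w - falses (take (2 ℕ.+ k) w)
          ≡⟨ cong₂ _-_ falses-w (trans (falses-take (2 ℕ.+ k) w bound) (cong₂ _-_ (pos-+ 2 k) (sum-w (suc k)))) ⟩
        int 2 + int N - ∑ N a - (int 2 + int k - ∑ (suc k) a)
          ≡⟨ rearrange (int 2) (int N) (∑ N a) (int k) (∑ (suc k) a) ⟩
        int N - ∑ N a - int k + ∑ (suc k) a ∎
        where
        bound : 2 ℕ.+ k ≤ length w
        bound = ℕₚ.≤-trans (s≤s (s≤s (ℕₚ.<⇒≤ k<N))) (ℕₚ.≤-reflexive (sym (length-wrap u)))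
        isolate : ∀ m n p → n ≡ p - m + 1ℤ * (m + n - p)
        isolate = solve-∀
        rearrange : ∀ t n A k B → t + n - A - (t + k - B) ≡ n - A - k + B
        rearrange = solve-∀

    -- Split on the leaf put in front by `wrap`: either it is kept, and the current component has
    -- the size 2 that `occurrences-1-first` asks for, or it is itself the entry 1.
    leaf-first : occurrences (1 ∷ 2 ℕ.+ k ∷ 2 ℕ.+ j ∷ []) 1 w ≡
                 (int k + int 2 - ∑ (suc k) a) * a (suc k)
    leaf-first = begin
      occurrences (1 ∷ 2 ℕ.+ k ∷ 2 ℕ.+ j ∷ []) 2 v′ + 1ℤ * occurrences (2 ℕ.+ k ∷ 2 ℕ.+ j ∷ []) 1 v′
        ≡⟨ cong₂ (λ m n → m + 1ℤ * n)
             (occurrences-1-first 2 k (2 ℕ.+ j) v′ ℕₚ.≤-refl sizes)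
             (occurrences-pair 1 (suc k) (2 ℕ.+ j) v′ (s≤s (s≤s z≤n)) sizes) ⟩
      falses (take (suc k) v′) * at v′ (suc k) + 1ℤ * at v′ (suc k)
        ≡⟨ cong₂ (λ m n → m * n + 1ℤ * n)
             (trans (falses-take (suc k) v′ bound) (cong₂ _-_ (int-suc k) (∑-cong (suc k) (at-∷ʳ-false u))))
             (at-∷ʳ-false u (suc k)) ⟩
      (1ℤ + int k - ∑ (suc k) a) * a (suc k) + 1ℤ * a (suc k)
        ≡⟨ collect (int k) (∑ (suc k) a) (a (suc k)) ⟩
      (int k + (1ℤ + 1ℤ) - ∑ (suc k) a) * a (suc k) ∎
      where
      v′ = u ∷ʳ false
      sizes : suc (k ℕ.+ (2 ℕ.+ j)) ≡ length v′
      sizes = begin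
        suc (k ℕ.+ (2 ℕ.+ j))       ≡⟨ cong suc (ℕₚ.+-suc k (suc j)) ⟩
        2 ℕ.+ (k ℕ.+ suc j)         ≡⟨ cong (2 ℕ.+_) (ℕₚ.+-suc k j) ⟩
        suc (2 ℕ.+ (k ℕ.+ j))       ≡⟨ cong suc eq ⟩
        suc N                       ≡⟨ ℕₚ.suc-injective (length-wrap u) ⟨
        length v′                   ∎
      bound : suc k ≤ length v′
      bound = ℕₚ.≤-trans (s≤s (ℕₚ.m≤m+n k (2 ℕ.+ j))) (ℕₚ.≤-reflexive sizes)
      collect : ∀ k A y → (1ℤ + k - A) * y + 1ℤ * y ≡ (k + (1ℤ + 1ℤ) - A) * y
      collect = solve-∀

-- From ordered size lists to coefficients of monomials

pair-inv : ∀ {s : List ℕ} {p q} → s ↭ p ∷ q ∷ [] → s ≡ p ∷ q ∷ [] ⊎ s ≡ q ∷ p ∷ []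
pair-inv {[]}    ρ with () ← ↭-length ρ
pair-inv {y ∷ s} {p} {q} ρ with ∈-resp-↭ ρ (here refl)
... | here refl         = inj₁ (cong (y ∷_) (↭-singleton-inv (drop-∷ ρ)))
... | there (here refl) = inj₂ (cong (y ∷_) (↭-singleton-inv (drop-∷ (↭-trans ρ (↭.swap p q ↭-refl)))))

triple-inv : ∀ {s : List ℕ} {p q r} → s ↭ p ∷ q ∷ r ∷ [] →
  (s ≡ p ∷ q ∷ r ∷ [] ⊎ s ≡ p ∷ r ∷ q ∷ []) ⊎
  (s ≡ q ∷ p ∷ r ∷ [] ⊎ s ≡ q ∷ r ∷ p ∷ []) ⊎
  (s ≡ r ∷ p ∷ q ∷ [] ⊎ s ≡ r ∷ q ∷ p ∷ [])
triple-inv {[]}    ρ with () ← ↭-length ρ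
triple-inv {y ∷ s} {p} {q} {r} ρ with ∈-resp-↭ ρ (here refl)
... | here refl         = inj₁ (Sum.map (cong (y ∷_)) (cong (y ∷_)) (pair-inv (drop-∷ ρ)))
... | there (here refl) = inj₂ (inj₁ (Sum.map (cong (y ∷_)) (cong (y ∷_))
                              (pair-inv (drop-∷ (↭-trans ρ (↭.swap p q ↭-refl))))))
... | there (there (here refl)) = inj₂ (inj₂ (Sum.map (cong (y ∷_)) (cong (y ∷_))
                              (pair-inv (drop-∷ (↭-trans ρ (↭-trans (↭.prep p (↭.swap q r ↭-refl)) (↭.swap p r ↭-refl)))))))

map-x-inv : ∀ {s t} → map x s ↭ map x t → s ↭ t
map-x-inv {s} ρ with ↭-map-inv x ρ
... | t′ , eq , ρ′ = subst (s ↭_) (sym (map-injective (λ { refl → refl }) eq)) ρ′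

termCoeff : Monomial → List ℕ → ℤ
termCoeff m s = coeff ((1ℤ , map x s) ∷ []) m

termCoeff-yes : ∀ {m s} → map x s ↭ m → termCoeff m s ≡ 1ℤ
termCoeff-yes {m} {s} ρ with map x s ↭? m
... | yes _ = refl
... | no ¬ρ = contradiction ρ ¬ρ

termCoeff-no : ∀ {m s} → ¬ (map x s ↭ m) → termCoeff m s ≡ 0ℤ
termCoeff-no {m} {s} ¬ρ with map x s ↭? m
... | yes ρ = contradiction ρ ¬ρ
... | no  _ = refl

-- A function that is constant on the arrangements of t and zero elsewhere is a multiple of the
-- coefficient of one monomial. The factor is the same for both words to be compared, so coinciding
-- sizes need no case distinction.
symmetric-term : ∀ {Φ : List ℕ → ℤ} t →
                 (∀ s → s ↭ t → Φ s ≡ Φ t) → (∀ s → ¬ (s ↭ t) → Φ s ≡ 0ℤ) →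
                 ∀ s → Φ s ≡ Φ t * termCoeff (map x t) s
symmetric-term {Φ} t on off s = case map x s ↭? map x t of λ
  { (yes ρ) → trans (on s (map-x-inv ρ))
      (sym (trans (cong (Φ t *_) (termCoeff-yes {map x t} {s} ρ)) (*-identityʳ (Φ t))))
  ; (no ¬ρ) → trans (off s (¬ρ ∘ map⁺ x))
      (sym (trans (cong (Φ t *_) (termCoeff-no {map x t} {s} ¬ρ)) (*-zeroʳ (Φ t))))
  }

-- Each list with the sizes p, q (and r) contributes equally often to
-- these sums, namely once unless some of the sizes are equal.
pairOrders : ℕ → ℕ → List ℕ → ℤ
pairOrders p q s = indicator (p ∷ q ∷ []) s + indicator (q ∷ p ∷ []) s

tripleOrders : ℕ → ℕ → ℕ → List ℕ → ℤ
tripleOrders p q r s =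
  ((indicator (p ∷ q ∷ r ∷ []) s + indicator (p ∷ r ∷ q ∷ []) s)
  + (indicator (q ∷ p ∷ r ∷ []) s + indicator (q ∷ r ∷ p ∷ []) s))
  + (indicator (r ∷ p ∷ q ∷ []) s + indicator (r ∷ q ∷ p ∷ []) s)

pairOrders-swap : ∀ p q i j → pairOrders p q (i ∷ j ∷ []) ≡ pairOrders p q (j ∷ i ∷ [])
pairOrders-swap p q i j = commute (δ p i) (δ q j) (δ q i) (δ p j)
  where
  commute : ∀ a b c d → a * (b * 1ℤ) + c * (d * 1ℤ) ≡ d * (c * 1ℤ) + b * (a * 1ℤ)
  commute = solve-∀

tripleOrders-swap₁ : ∀ p q r i j k →
    tripleOrders p q r (i ∷ j ∷ k ∷ []) ≡ tripleOrders p q r (j ∷ i ∷ k ∷ [])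
tripleOrders-swap₁ p q r i j k =
  commute (δ p i) (δ p j) (δ p k) (δ q i) (δ q j) (δ q k) (δ r i) (δ r j) (δ r k)
  where
  commute : ∀ pi pj pk qi qj qk ri rj rk →
    ((pi * (qj * (rk * 1ℤ)) + pi * (rj * (qk * 1ℤ))) + (qi * (pj * (rk * 1ℤ)) + qi * (rj * (pk * 1ℤ))))
      + (ri * (pj * (qk * 1ℤ)) + ri * (qj * (pk * 1ℤ))) ≡
    ((pj * (qi * (rk * 1ℤ)) + pj * (ri * (qk * 1ℤ))) + (qj * (pi * (rk * 1ℤ)) + qj * (ri * (pk * 1ℤ))))
      + (rj * (pi * (qk * 1ℤ)) + rj * (qi * (pk * 1ℤ)))
  commute = solve-∀

tripleOrders-swap₂ : ∀ p q r i j k →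
    tripleOrders p q r (i ∷ j ∷ k ∷ []) ≡ tripleOrders p q r (i ∷ k ∷ j ∷ [])
tripleOrders-swap₂ p q r i j k =
  commute (δ p i) (δ p j) (δ p k) (δ q i) (δ q j) (δ q k) (δ r i) (δ r j) (δ r k)
  where
  commute : ∀ pi pj pk qi qj qk ri rj rk →
    ((pi * (qj * (rk * 1ℤ)) + pi * (rj * (qk * 1ℤ))) + (qi * (pj * (rk * 1ℤ)) + qi * (rj * (pk * 1ℤ))))
      + (ri * (pj * (qk * 1ℤ)) + ri * (qj * (pk * 1ℤ))) ≡
    ((pi * (qk * (rj * 1ℤ)) + pi * (rk * (qj * 1ℤ))) + (qi * (pk * (rj * 1ℤ)) + qi * (rk * (pj * 1ℤ))))
      + (ri * (pk * (qj * 1ℤ)) + ri * (qk * (pj * 1ℤ)))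
  commute = solve-∀

pairOrders-term : ∀ p q s →
    pairOrders p q s ≡ pairOrders p q (p ∷ q ∷ []) * termCoeff (map x (p ∷ q ∷ [])) s
pairOrders-term p q = symmetric-term t on off
  where
  t = p ∷ q ∷ []
  on : ∀ s → s ↭ t → pairOrders p q s ≡ pairOrders p q t
  on s ρ with pair-inv ρ
  ... | inj₁ refl = refl
  ... | inj₂ refl = pairOrders-swap p q q p
  off : ∀ s → ¬ (s ↭ t) → pairOrders p q s ≡ 0ℤ
  off s ¬ρ = cong₂ _+_ (indicator-≢ t s λ { refl → ¬ρ ↭-refl })
                       (indicator-≢ (q ∷ p ∷ []) s λ { refl → ¬ρ (↭.swap q p ↭-refl) })

tripleOrders-term : ∀ p q r s →
  tripleOrders p q r s ≡ tripleOrders p q r (p ∷ q ∷ r ∷ []) * termCoeff (map x (p ∷ q ∷ r ∷ [])) s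
tripleOrders-term p q r = symmetric-term t on off
  where
  t = p ∷ q ∷ r ∷ []
  Φ = tripleOrders p q r
  swap₁ = tripleOrders-swap₁ p q r
  swap₂ = tripleOrders-swap₂ p q r
  on : ∀ s → s ↭ t → Φ s ≡ Φ t
  on s ρ with triple-inv ρ
  ... | inj₁ (inj₁ refl)        = refl
  ... | inj₁ (inj₂ refl)        = swap₂ p r q
  ... | inj₂ (inj₁ (inj₁ refl)) = swap₁ q p r
  ... | inj₂ (inj₁ (inj₂ refl)) = trans (swap₂ q r p) (swap₁ q p r)
  ... | inj₂ (inj₂ (inj₁ refl)) = trans (swap₁ r p q) (swap₂ p r q)
  ... | inj₂ (inj₂ (inj₂ refl)) = trans (swap₁ r q p) (trans (swap₂ q r p) (swap₁ q p r))
  off : ∀ s → ¬ (s ↭ t) → Φ s ≡ 0ℤ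
  off s ¬ρ = cong₂ _+_
    (cong₂ _+_
      (cong₂ _+_ (indicator-≢ t s λ { refl → ¬ρ ↭-refl })
                 (indicator-≢ (p ∷ r ∷ q ∷ []) s λ { refl → ¬ρ (↭.prep p (↭.swap r q ↭-refl)) }))
      (cong₂ _+_ (indicator-≢ (q ∷ p ∷ r ∷ []) s λ { refl → ¬ρ (↭.swap q p ↭-refl) })
                 (indicator-≢ (q ∷ r ∷ p ∷ []) s λ { refl →
                   ¬ρ (↭-trans (↭.prep q (↭.swap r p ↭-refl)) (↭.swap q p ↭-refl)) })))
    (cong₂ _+_ (indicator-≢ (r ∷ p ∷ q ∷ []) s λ { refl →
                 ¬ρ (↭-trans (↭.swap r p ↭-refl) (↭.prep p (↭.swap r q ↭-refl))) })
               (indicator-≢ (r ∷ q ∷ p ∷ []) s λ { refl →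
                 ¬ρ (↭-trans (↭.swap r q ↭-refl)
                     (↭-trans (↭.prep q (↭.swap r p ↭-refl)) (↭.swap q p ↭-refl))) }))

cutSum-pairOrders : ∀ p q w →
    cutSum (pairOrders p q) 1 w ≡ occurrences (p ∷ q ∷ []) 1 w + occurrences (q ∷ p ∷ []) 1 w
cutSum-pairOrders p q w = trans (cutSum-+ (indicator (p ∷ q ∷ [])) (indicator (q ∷ p ∷ [])) 1 w)
  (cong₂ _+_ (cutSum-indicator (p ∷ q ∷ []) 1 w) (cutSum-indicator (q ∷ p ∷ []) 1 w))

cutSum-tripleOrders : ∀ p q r w → cutSum (tripleOrders p q r) 1 w ≡
  ((occurrences (p ∷ q ∷ r ∷ []) 1 w + occurrences (p ∷ r ∷ q ∷ []) 1 w)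
  + (occurrences (q ∷ p ∷ r ∷ []) 1 w + occurrences (q ∷ r ∷ p ∷ []) 1 w))
  + (occurrences (r ∷ p ∷ q ∷ []) 1 w + occurrences (r ∷ q ∷ p ∷ []) 1 w)
cutSum-tripleOrders p q r w = trans
  (cutSum-+ (λ s → both p q r s + both q p r s)
    (λ s → indicator (r ∷ p ∷ q ∷ []) s + indicator (r ∷ q ∷ p ∷ []) s) 1 w)
  (cong₂ _+_ (trans (cutSum-+ (both p q r) (both q p r) 1 w) (cong₂ _+_ (two p q r) (two q p r))) (two r p q))
  where
  both : ℕ → ℕ → ℕ → List ℕ → ℤ
  both p q r s = indicator (p ∷ q ∷ r ∷ []) s + indicator (p ∷ r ∷ q ∷ []) s
  two : ∀ p q r →
      cutSum (both p q r) 1 w ≡ occurrences (p ∷ q ∷ r ∷ []) 1 w + occurrences (p ∷ r ∷ q ∷ []) 1 w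
  two p q r = trans (cutSum-+ (indicator (p ∷ q ∷ r ∷ [])) (indicator (p ∷ r ∷ q ∷ [])) 1 w)
    (cong₂ _+_ (cutSum-indicator (p ∷ q ∷ r ∷ []) 1 w) (cutSum-indicator (p ∷ r ∷ q ∷ []) 1 w))

module _ (u u′ : List Bool) (len : length u ≡ length u′)
  (eq : ∀ m → cutSum (termCoeff m) 1 (wrap u) ≡ cutSum (termCoeff m) 1 (wrap u′)) where

  private
    module O = Occurrences u
    module O′ = Occurrences u′

  same-orders : ∀ (Φ : List ℕ → ℤ) t → (∀ s → Φ s ≡ Φ t * termCoeff (map x t) s) →
                cutSum Φ 1 (wrap u) ≡ cutSum Φ 1 (wrap u′)
  same-orders Φ t Φ≡ = begin
    cutSum Φ 1 (wrap u)                             ≡⟨ cutSum-cong Φ≡ 1 (wrap u) ⟩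
    cutSum (λ s → c * termCoeff m s) 1 (wrap u)     ≡⟨ cutSum-* c (termCoeff m) 1 (wrap u) ⟩
    c * cutSum (termCoeff m) 1 (wrap u)             ≡⟨ cong (c *_) (eq m) ⟩
    c * cutSum (termCoeff m) 1 (wrap u′)            ≡⟨ cutSum-* c (termCoeff m) 1 (wrap u′) ⟨
    cutSum (λ s → c * termCoeff m s) 1 (wrap u′)    ≡⟨ cutSum-cong Φ≡ 1 (wrap u′) ⟨
    cutSum Φ 1 (wrap u′)                            ∎
    where
    c = Φ t
    m = map x t

  same-pairs : ∀ k j → suc (k ℕ.+ j) ≡ length u → pairCount u k j ≡ pairCount u′ k j
  same-pairs k j e = trans (sym (via u e))
    (trans (same-orders (pairOrders p q) (p ∷ q ∷ []) (pairOrders-term p q)) (via u′ (trans e len)))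
    where
    p = 2 ℕ.+ k
    q = 2 ℕ.+ j
    via : ∀ u → suc (k ℕ.+ j) ≡ length u → cutSum (pairOrders p q) 1 (wrap u) ≡ pairCount u k j
    via u e = trans (cutSum-pairOrders p q (wrap u)) (cong₂ _+_ (pair k j e)
      (pair j k (trans (cong suc (ℕₚ.+-comm j k)) e)))
      where open Occurrences u

  same-triples : ∀ k j l → 3 ℕ.+ (k ℕ.+ j ℕ.+ l) ≡ length u → tripleCount u k j l ≡ tripleCount u′ k j l
  same-triples k j l e = trans (sym (via u e))
    (trans (same-orders (tripleOrders p q r) (p ∷ q ∷ r ∷ []) (tripleOrders-term p q r)) (via u′ (trans e len)))
    where
    p = 2 ℕ.+ k
    q = 2 ℕ.+ j
    r = 2 ℕ.+ l
    ordered₁ : ∀ k j l → k ℕ.+ l ℕ.+ j ≡ k ℕ.+ j ℕ.+ l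
    ordered₁ = ℕ-solve-∀
    ordered₂ : ∀ k j l → j ℕ.+ k ℕ.+ l ≡ k ℕ.+ j ℕ.+ l
    ordered₂ = ℕ-solve-∀
    ordered₃ : ∀ k j l → j ℕ.+ l ℕ.+ k ≡ k ℕ.+ j ℕ.+ l
    ordered₃ = ℕ-solve-∀
    ordered₄ : ∀ k j l → l ℕ.+ k ℕ.+ j ≡ k ℕ.+ j ℕ.+ l
    ordered₄ = ℕ-solve-∀
    ordered₅ : ∀ k j l → l ℕ.+ j ℕ.+ k ≡ k ℕ.+ j ℕ.+ l
    ordered₅ = ℕ-solve-∀
    reorder : ∀ a b c d e f → ((a + b) + (c + d)) + (e + f) ≡ a + b + c + d + e + f
    reorder = solve-∀
    via : ∀ u → 3 ℕ.+ (k ℕ.+ j ℕ.+ l) ≡ length u →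
        cutSum (tripleOrders p q r) 1 (wrap u) ≡ tripleCount u k j l
    via u e = trans (cutSum-tripleOrders p q r (wrap u)) (trans
      (cong₂ _+_ (cong₂ _+_ (cong₂ _+_ (triple k j l e) (triple k l j (perm (ordered₁ k j l))))
                            (cong₂ _+_ (triple j k l (perm (ordered₂ k j l))) (triple j l k (perm (ordered₃ k j l)))))
                 (cong₂ _+_ (triple l k j (perm (ordered₄ k j l))) (triple l j k (perm (ordered₅ k j l)))))
      (reorder (at u k * b l) (at u k * b j) (at u j * b l) (at u j * b k) (at u l * b j) (at u l * b k)))
      where
      open Occurrences u
      b = at (reverse u)
      perm : ∀ {n} → n ≡ k ℕ.+ j ℕ.+ l → 3 ℕ.+ n ≡ length u
      perm n≡ = trans (cong (3 ℕ.+_) n≡) e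

  same-leaves : ∀ k j → 2 ℕ.+ (k ℕ.+ j) ≡ length u → leafCount u k j ≡ leafCount u′ k j
  same-leaves k j e = trans (sym (via u e))
    (trans (same-orders (tripleOrders p q 1) (p ∷ q ∷ 1 ∷ []) (tripleOrders-term p q 1)) (via u′ (trans e len)))
    where
    p = 2 ℕ.+ k
    q = 2 ℕ.+ j
    via : ∀ u → 2 ℕ.+ (k ℕ.+ j) ≡ length u → cutSum (tripleOrders p q 1) 1 (wrap u) ≡ leafCount u k j
    via u e = trans (cutSum-tripleOrders p q 1 (wrap u)) (trans
      (cong₂ _+_ (cong₂ _+_ (cong₂ _+_ (leaf-last k j e) (leaf-middle k j e))
                            (cong₂ _+_ (leaf-last j k e′) (leaf-middle j k e′)))
                 (cong₂ _+_ (leaf-first k j e) (leaf-first j k e′)))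
      (reorder (a k * (int N - ∑ N a - int k + ∑ (suc k) a + a (suc k)))
               (a j * (int N - ∑ N a - int j + ∑ (suc j) a + a (suc j)))
               ((int k + int 2 - ∑ (suc k) a) * a (suc k))
               ((int j + int 2 - ∑ (suc j) a) * a (suc j))))
      where
      open Occurrences u
      open Word u using (N; a)
      e′ : 2 ℕ.+ (j ℕ.+ k) ≡ length u
      e′ = trans (cong (2 ℕ.+_) (ℕₚ.+-comm j k)) e
      reorder : ∀ a b c d → ((0ℤ + a) + (0ℤ + b)) + (c + d) ≡ (a + c) + (b + d)
      reorder = solve-∀

  word-determined : u ≡ u′ ⊎ u ≡ reverse u′
  word-determined = Compare.equal-or-reverse u u′ len same-pairs same-triples same-leaves

-- The U-polynomial of a caterpillar

private
  variable
    A B : Set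

-- Spine and leaf vertices are marked by true and false.
Tokens : Set → Set
Tokens V = List (V × Bool)

advance : ∀ {V : Set} → V → Bool → V → V
advance c s v = if s then v else c

-- Every token is joined to the last spine vertex before it, c being the first one.
branches : ∀ {V : Set} → V → Tokens V → List (V × V)
branches c []             = []
branches c ((v , s) ∷ ts) = (c , v) ∷ branches (advance c s v) ts

-- The word determines both the polynomial, by `U-layout`, and the isomorphism type, by `layout-≅`.
-- In general a caterpillar has layouts for both directions of its spine.
record Layout (G : Graph) (w : List Bool) : Set where
  open Graph G
  field
    root   : Vertex
    tokens : Tokens Vertex
  vertices : List Vertex
  vertices = root ∷ map proj₁ tokens
  field
    word     : map proj₂ tokens ≡ w
    unique   : Unique vertices
    complete : ∀ v → v ∈ vertices
    adj⇒     : ∀ {u v} → Adj u v → (u , v) ∈ branches root tokens ⊎ (v , u) ∈ branches root tokens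
    ⇒adj     : ∀ {u v} → (u , v) ∈ branches root tokens → Adj u v

-- Tokens together with the decision to keep the edge to the vertex.
Cuts : Set → Set
Cuts V = List ((V × Bool) × Bool)

choices : Tokens A → List (Cuts A)
choices []       = [] ∷ []
choices (t ∷ ts) = map ((t , true) ∷_) (choices ts) ++ map ((t , false) ∷_) (choices ts)

kept : A → Cuts A → List (A × A)
kept c []                      = []
kept c (((v , s) , true)  ∷ ks) = (c , v) ∷ kept (advance c s v) ks
kept c (((v , s) , false) ∷ ks) = kept (advance c s v) ks

sizes : ℕ → Cuts A → List ℕ
sizes i []                          = i ∷ []
sizes i ((_           , true)  ∷ ks) = sizes (suc i) ks
sizes i (((_ , true)  , false) ∷ ks) = i ∷ sizes 1 ks
sizes i (((_ , false) , false) ∷ ks) = 1 ∷ sizes i ks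

subsets-map : ∀ (f : A → B) es → subsets (map f es) ≡ map (map f) (subsets es)
subsets-map f []       = refl
subsets-map f (e ∷ es) = begin
  map (f e ∷_) (subsets (map f es)) ++ subsets (map f es)
    ≡⟨ cong (λ S → map (f e ∷_) S ++ S) (subsets-map f es) ⟩
  map (f e ∷_) (map (map f) (subsets es)) ++ map (map f) (subsets es)
    ≡⟨ cong (_++ map (map f) (subsets es)) (trans (sym (map-∘ (subsets es))) (map-∘ (subsets es))) ⟩
  map (map f) (map (e ∷_) (subsets es)) ++ map (map f) (subsets es)
    ≡⟨ map-++ (map f) (map (e ∷_) (subsets es)) (subsets es) ⟨
  map (map f) (map (e ∷_) (subsets es) ++ subsets es) ∎

subsets-branches : ∀ (c : A) ts → subsets (branches c ts) ≡ map (kept c) (choices ts)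
subsets-branches c []             = refl
subsets-branches c ((v , s) ∷ ts) = begin
  map ((c , v) ∷_) (subsets es) ++ subsets es
    ≡⟨ cong (λ S → map ((c , v) ∷_) S ++ S) (subsets-branches (advance c s v) ts) ⟩
  map ((c , v) ∷_) (map (kept (advance c s v)) (choices ts)) ++ map (kept (advance c s v)) (choices ts)
    ≡⟨ cong₂ _++_ (trans (sym (map-∘ (choices ts))) (map-∘ (choices ts))) (map-∘ (choices ts)) ⟩
  map (kept c) (map (((v , s) , true) ∷_) (choices ts)) ++ map (kept c) (map (((v , s) , false) ∷_) (choices ts))
    ≡⟨ map-++ (kept c) (map (((v , s) , true) ∷_) (choices ts)) _ ⟨
  map (kept c) (choices ((v , s) ∷ ts)) ∎
  where es = branches (advance c s v) ts

-- Sums over the subsets of an edge list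

sumOver : (A → ℤ) → List A → ℤ
sumOver g []       = 0ℤ
sumOver g (a ∷ as) = g a + sumOver g as

sumOver-++ : ∀ (g : A → ℤ) as bs → sumOver g (as ++ bs) ≡ sumOver g as + sumOver g bs
sumOver-++ g []       bs = sym (+-identityˡ (sumOver g bs))
sumOver-++ g (a ∷ as) bs =
  trans (cong (g a +_) (sumOver-++ g as bs)) (sym (+-assoc (g a) (sumOver g as) (sumOver g bs)))

sumOver-map : ∀ (g : B → ℤ) (f : A → B) as → sumOver g (map f as) ≡ sumOver (g ∘ f) as
sumOver-map g f []       = refl
sumOver-map g f (a ∷ as) = cong (g (f a) +_) (sumOver-map g f as)

sumOver-cong : ∀ {g h : A → ℤ} as → (∀ {a} → a ∈ as → g a ≡ h a) → sumOver g as ≡ sumOver h as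
sumOver-cong []       eq = refl
sumOver-cong (a ∷ as) eq = cong₂ _+_ (eq (here refl)) (sumOver-cong as (eq ∘ there))

sumOver-subsets-∷ : ∀ (g : List A → ℤ) e es →
  sumOver g (subsets (e ∷ es)) ≡ sumOver (g ∘ (e ∷_)) (subsets es) + sumOver g (subsets es)
sumOver-subsets-∷ g e es =
  trans (sumOver-++ g (map (e ∷_) (subsets es)) (subsets es))
    (cong (_+ sumOver g (subsets es)) (sumOver-map g (e ∷_) (subsets es)))

-- Permuting the edge list also permutes the edges within each subset, so `g` must not depend on
-- their order. For a swap the sum splits into four according to which of the two edges are present,
-- and the middle two change places.
sumOver-subsets-↭ : ∀ {g : List A → ℤ} → (∀ {as bs} → as ↭ bs → g as ≡ g bs) →
                    ∀ {es fs} → es ↭ fs → sumOver g (subsets es) ≡ sumOver g (subsets fs)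
sumOver-subsets-↭ resp ↭.refl = refl
sumOver-subsets-↭ {g = g} resp {e ∷ es} {_ ∷ fs} (↭.prep e ρ) =
  trans (sumOver-subsets-∷ g e es) (trans
    (cong₂ _+_ (sumOver-subsets-↭ (resp ∘ ↭.prep e) ρ) (sumOver-subsets-↭ resp ρ))
    (sym (sumOver-subsets-∷ g e fs)))
sumOver-subsets-↭ {g = g} resp {e ∷ f ∷ es} {_ ∷ _ ∷ fs} (↭.swap e f ρ) = begin
  sumOver g (subsets (e ∷ f ∷ es))   ≡⟨ split e f es ⟩
  _ ≡⟨ cong₂ _+_ (cong₂ _+_
         (trans (sumOver-cong (subsets es) (λ {as} _ → resp (↭.swap e f (↭-refl {x = as}))))
           (sumOver-subsets-↭ (resp ∘ ↭.prep f ∘ ↭.prep e) ρ))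
         (sumOver-subsets-↭ (resp ∘ ↭.prep e) ρ))
       (cong₂ _+_ (sumOver-subsets-↭ (resp ∘ ↭.prep f) ρ) (sumOver-subsets-↭ resp ρ)) ⟩
  _ ≡⟨ interchange (sumOver (g ∘ (f ∷_) ∘ (e ∷_)) (subsets fs)) (sumOver (g ∘ (e ∷_)) (subsets fs))
         (sumOver (g ∘ (f ∷_)) (subsets fs)) (sumOver g (subsets fs)) ⟩
  _ ≡⟨ split f e fs ⟨
  sumOver g (subsets (f ∷ e ∷ fs)) ∎
  where
  split : ∀ e f es → sumOver g (subsets (e ∷ f ∷ es)) ≡
    (sumOver (g ∘ (e ∷_) ∘ (f ∷_)) (subsets es) + sumOver (g ∘ (e ∷_)) (subsets es))
      + (sumOver (g ∘ (f ∷_)) (subsets es) + sumOver g (subsets es))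
  split e f es = trans (sumOver-subsets-∷ g e (f ∷ es))
    (cong₂ _+_ (sumOver-subsets-∷ (g ∘ (e ∷_)) f es) (sumOver-subsets-∷ g f es))
sumOver-subsets-↭ resp (↭.trans ρ σ) = trans (sumOver-subsets-↭ resp ρ) (sumOver-subsets-↭ resp σ)

sumOver-choices : ∀ h i (ts : Tokens A) → sumOver (h ∘ sizes i) (choices ts) ≡ cutSum h i (map proj₂ ts)
sumOver-choices h i [] = +-identityʳ (h (i ∷ []))
sumOver-choices h i (t@(_ , s) ∷ ts) =
  trans (sumOver-++ (h ∘ sizes i) (map ((t , true) ∷_) (choices ts)) _)
  (trans (cong₂ _+_ (sumOver-map (h ∘ sizes i) ((t , true) ∷_) (choices ts))
                    (sumOver-map (h ∘ sizes i) ((t , false) ∷_) (choices ts)))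
    (rest s))
  where
  rest : ∀ s →
      sumOver (h ∘ sizes (suc i)) (choices ts) + sumOver (h ∘ sizes i ∘ (((proj₁ t , s) , false) ∷_)) (choices ts) ≡
           cutSum h i (s ∷ map proj₂ ts)
  rest true  = cong₂ _+_ (sumOver-choices h (suc i) ts) (sumOver-choices (h ∘ (i ∷_)) 1 ts)
  rest false = cong₂ _+_ (sumOver-choices h (suc i) ts) (sumOver-choices (h ∘ (1 ∷_)) i ts)

choices-tokens : ∀ (ts : Tokens A) {ks} → ks ∈ choices ts → map proj₁ ks ≡ ts
choices-tokens []       (here refl) = refl
choices-tokens (t ∷ ts) ks∈ with ∈-++⁻ (map ((t , true) ∷_) (choices ts)) ks∈
... | inj₁ p with ∈-map⁻ ((t , true) ∷_) p
...   | ks , ks∈′ , refl = cong (t ∷_) (choices-tokens ts ks∈′)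
choices-tokens (t ∷ ts) ks∈ | inj₂ p with ∈-map⁻ ((t , false) ∷_) p
...   | ks , ks∈′ , refl = cong (t ∷_) (choices-tokens ts ks∈′)

-- Each token either keeps an edge or completes a component. This is |A| + c(A) = |V| for a forest,
-- which makes the exponent of z - 1 zero.
length-kept+sizes : ∀ (c : A) i ks → length (kept c ks) ℕ.+ length (sizes i ks) ≡ suc (length ks)
length-kept+sizes c i [] = refl
length-kept+sizes c i (((v , s)     , true)  ∷ ks) =
  cong suc (length-kept+sizes (advance c s v) (suc i) ks)
length-kept+sizes c i (((v , true)  , false) ∷ ks) =
  trans (ℕₚ.+-suc (length (kept v ks)) _) (cong suc (length-kept+sizes v 1 ks))
length-kept+sizes c i (((v , false) , false) ∷ ks) =
  trans (ℕₚ.+-suc (length (kept c ks)) _) (cong suc (length-kept+sizes c i ks))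

coeff-++ : ∀ p q m → coeff (p ++ q) m ≡ coeff p m + coeff q m
coeff-++ []            q m = sym (+-identityˡ (coeff q m))
coeff-++ ((c , l) ∷ p) q m with l ↭? m
... | yes _ = trans (cong (c +_) (coeff-++ p q m)) (sym (+-assoc c (coeff p m) (coeff q m)))
... | no  _ = coeff-++ p q m

coeff-sumₚ : ∀ (t : A → Poly) as m → coeff (sumₚ (map t as)) m ≡ sumOver (λ a → coeff (t a) m) as
-- The empty sum is a term with coefficient 0 and empty monomial, hence the case distinction.
coeff-sumₚ t [] m with [] ↭? m
... | yes _ = refl
... | no  _ = refl
coeff-sumₚ t (a ∷ as) m =
  trans (coeff-++ (t a) (sumₚ (map t as)) m) (cong (coeff (t a) m +_) (coeff-sumₚ t as m))

-- The function `term` that is local to U, for j edges and component sizes s.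
summand : Graph → ℕ → List ℕ → Poly
summand G j s = productₚ (map (λ i → var (x i)) s)
                  *ₚ (var z +ₚ const -1ℤ) ^ₚ ((j ℕ.+ length s) ℕ.∸ Graph.order G)

U-coeff : ∀ G m → coeff (U G) m ≡
          sumOver (λ A → coeff (summand G (length A) (componentSizes A)) m) (subsets (Graph.edges G))
U-coeff G m = coeff-sumₚ (λ A → summand G (length A) (componentSizes A)) (subsets (Graph.edges G)) m

product-var : ∀ s → productₚ (map (λ i → var (x i)) s) ≡ (1ℤ , map x s) ∷ []
product-var []      = refl
product-var (i ∷ s) rewrite product-var s = refl

termCoeff-↭ : ∀ {s t} m → s ↭ t → termCoeff m s ≡ termCoeff m t
termCoeff-↭ {s} {t} m ρ = case map x t ↭? m of λ
  { (yes σ) → trans (termCoeff-yes {m} {s} (↭-trans (map⁺ x ρ) σ)) (sym (termCoeff-yes {m} {t} σ))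
  ; (no ¬σ) → trans (termCoeff-no {m} {s} (¬σ ∘ ↭-trans (↭-sym (map⁺ x ρ)))) (sym (termCoeff-no {m} {t} ¬σ))
  }

summand-forest : ∀ G j s m → j ℕ.+ length s ≡ Graph.order G → coeff (summand G j s) m ≡ termCoeff m s
summand-forest G j s m eq = cong (λ p → coeff p m) (begin
  summand G j s
    ≡⟨ cong₂ (λ p n → p *ₚ (var z +ₚ const -1ℤ) ^ₚ n) (product-var s) (ℕₚ.m≤n⇒m∸n≡0 (ℕₚ.≤-reflexive eq)) ⟩
  (1ℤ , map x s ++ []) ∷ []
    ≡⟨ cong (λ l → (1ℤ , l) ∷ []) (++-identityʳ (map x s)) ⟩
  (1ℤ , map x s) ∷ [] ∎)

-- Components of the graph formed by the kept edges

module _ {n : ℕ} where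

  private
    V = Fin n

  fold-joined : ∀ {A : List (V × V)} {_∼_ : V → V → Set} → (∀ {u} → u ∼ u) → (∀ {u v} → u ∼ v → v ∼ u) →
                (∀ {u v y} → u ∼ v → v ∼ y → u ∼ y) → (∀ {u v} → (u , v) ∈ A → u ∼ v) →
                ∀ {u v} → Joined A u v → u ∼ v
  fold-joined r s t = EqC.fold (record { refl = r ; sym = s ; trans = t })

  joined-sym : ∀ {A : List (V × V)} {u v} → Joined A u v → Joined A v u
  joined-sym = EqC.symmetric _

  joined-edge : ∀ {A : List (V × V)} {u v} → (u , v) ∈ A → Joined A u v
  joined-edge e = fwd e ◅ ε

  joined-mono : ∀ {A A′ : List (V × V)} → (∀ {u v} → (u , v) ∈ A → (u , v) ∈ A′ ⊎ (v , u) ∈ A′) →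
                ∀ {u v} → Joined A u v → Joined A′ u v
  joined-mono sub = fold-joined ε joined-sym _◅◅_ λ e → case sub e of λ
    { (inj₁ e′) → joined-edge e′ ; (inj₂ e′) → joined-sym (joined-edge e′) }

  deduplicate-cong : ∀ {R S : V → V → Set} (R? : ∀ u v → Dec (R u v)) (S? : ∀ u v → Dec (S u v)) →
    (∀ {u v} → R u v → S u v) → (∀ {u v} → S u v → R u v) → ∀ vs → deduplicate R? vs ≡ deduplicate S? vs
  deduplicate-cong R? S? to from []       = refl
  deduplicate-cong R? S? to from (v ∷ vs) = cong (v ∷_) (trans
    (cong (filter (λ u → ¬? (R? v u))) (deduplicate-cong R? S? to from vs))
    (filter-≐ _ _ ((λ ¬r s → ¬r (from s)) , (λ ¬s r → ¬s (to r))) (deduplicate S? vs)))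

  componentSizes-cong : ∀ {A A′ : List (V × V)} → (∀ {u v} → Joined A u v → Joined A′ u v) →
    (∀ {u v} → Joined A′ u v → Joined A u v) → componentSizes A ≡ componentSizes A′
  componentSizes-cong {A} {A′} to from = trans
    (cong (map (λ v → length (filter (joined? A v) (allFin n))))
      (deduplicate-cong (joined? A) (joined? A′) to from (allFin n)))
    (map-cong (λ v → cong length (filter-≐ (joined? A v) (joined? A′ v) (to , from) (allFin n)))
      (deduplicate (joined? A′) (allFin n)))

  count : V → List V → ℕ
  count r vs = length (filter (r ≟ᶠ_) vs)

  count-map : ∀ r (f : V → V) vs → length (filter (λ v → r ≟ᶠ f v) vs) ≡ count r (map f vs)
  count-map r f []       = refl
  count-map r f (v ∷ vs) with r ≟ᶠ f v
  ... | yes _ = cong suc (count-map r f vs)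
  ... | no  _ = count-map r f vs

  count-here : ∀ r vs → count r (r ∷ vs) ≡ suc (count r vs)
  count-here r vs = cong length (filter-accept (r ≟ᶠ_) {xs = vs} refl)

  count-skip : ∀ {r v} vs → r ≢ v → count r (v ∷ vs) ≡ count r vs
  count-skip vs r≢v = cong length (filter-reject (_ ≟ᶠ_) {xs = vs} r≢v)

  count-∉ : ∀ {r} vs → r ∉ vs → count r vs ≡ 0
  count-∉ []       r∉ = refl
  count-∉ {r} (v ∷ vs) r∉ = trans (count-skip {r} vs (r∉ ∘ here)) (count-∉ vs (r∉ ∘ there))

  -- Here `f` sends each vertex to a chosen representative of its component. `componentSizes` uses
  -- representatives of its own, but `f` maps them bijectively onto `rs`.
  componentSizes-fibres : ∀ {A : List (V × V)} (f : V → V) →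
    (∀ {u v} → Joined A u v → f u ≡ f v) → (∀ {u v} → f u ≡ f v → Joined A u v) →
    ∀ {vs} → Unique vs → (∀ v → v ∈ vs) →
    ∀ {rs} → Unique rs → (∀ v → f v ∈ rs) → (∀ {r} → r ∈ rs → f r ≡ r) →
    componentSizes A ↭ map (λ r → count r (map f vs)) rs
  componentSizes-fibres {A} f to from {vs} vs! vs-all {rs} rs! f∈rs f-fixes =
    ↭-trans (↭-reflexive sizes-eq) (map⁺ (λ r → count r (map f vs)) map-f-reps↭rs)
    where
    reps : List V
    reps = deduplicate (joined? A) (allFin n)

    joined-decSetoid : DecSetoid _ _
    joined-decSetoid = record
      { isDecEquivalence = record { isEquivalence = EqC.isEquivalence _ ; _≟_ = joined? A } }

    map-f-reps! : Unique (map f reps)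
    map-f-reps! =
      AllPairsₚ.map⁺ (AllPairs.map (_∘ from) (DecSetoidUnique.deduplicate-! joined-decSetoid (allFin n)))

    rep-of : ∀ v → Any (Joined A v) reps
    rep-of v = SetoidMembership.∈-deduplicate⁺ (DecSetoid.setoid joined-decSetoid) (joined? A)
      (λ u∼v y∼u → y∼u ◅◅ joined-sym u∼v) (Any.map (λ { refl → ε }) (∈-allFin v))

    map-f-reps↭rs : map f reps ↭ rs
    map-f-reps↭rs = ∼bag⇒↭ (unique∧set⇒bag map-f-reps! rs! (mk⇔ reps⇒rs rs⇒reps))
      where
      reps⇒rs : ∀ {r} → r ∈ map f reps → r ∈ rs
      reps⇒rs r∈ with ∈-map⁻ f r∈
      ... | v , _ , refl = f∈rs v
      image : ∀ v → f v ∈ map f reps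
      image v = Anyₚ.map⁺ (Any.map to (rep-of v))
      rs⇒reps : ∀ {r} → r ∈ rs → r ∈ map f reps
      rs⇒reps r∈ = subst (_∈ map f reps) (f-fixes r∈) (image _)

    vs↭allFin : vs ↭ allFin n
    vs↭allFin =
      ∼bag⇒↭ (unique∧set⇒bag vs! (Uniqueₚ.allFin⁺ n) (mk⇔ (λ _ → ∈-allFin _) (λ _ → vs-all _)))

    size-eq : ∀ v → length (filter (joined? A v) (allFin n)) ≡ count (f v) (map f vs)
    size-eq v = begin
      length (filter (joined? A v) (allFin n))
        ≡⟨ cong length (filter-≐ (joined? A v) (λ u → f v ≟ᶠ f u) (to , from) (allFin n)) ⟩
      length (filter (λ u → f v ≟ᶠ f u) (allFin n))
        ≡⟨ ↭-length (filter-↭ (λ u → f v ≟ᶠ f u) vs↭allFin) ⟨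
      length (filter (λ u → f v ≟ᶠ f u) vs)             ≡⟨ count-map (f v) f vs ⟩
      count (f v) (map f vs)                            ∎

    sizes-eq : componentSizes A ≡ map (λ r → count r (map f vs)) (map f reps)
    sizes-eq = trans (map-cong size-eq reps) (map-∘ reps)

  own : Bool → V → V → V
  own k l v = if k then l else v

  -- Each vertex is labelled by the first vertex of its component, l being the
  -- label of the last spine vertex.
  labels : V → Cuts V → List V
  labels l []                   = []
  labels l (((v , s) , k) ∷ ks) = own k l v ∷ labels (advance l s (own k l v)) ks

  -- The labels other than that of the root: a new component starts exactly where the edge to a
  -- vertex is cut.
  cutVertices : Cuts V → List V
  cutVertices []                       = []
  cutVertices (((v , s) , true)  ∷ ks) = cutVertices ks
  cutVertices (((v , s) , false) ∷ ks) = v ∷ cutVertices ks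

  names : Cuts V → List V
  names ks = map (proj₁ ∘ proj₁) ks

  cutVertices⊆names : ∀ ks {v} → v ∈ cutVertices ks → v ∈ names ks
  cutVertices⊆names ((_ , true)  ∷ ks) v∈         = there (cutVertices⊆names ks v∈)
  cutVertices⊆names ((_ , false) ∷ ks) (here eq)  = here eq
  cutVertices⊆names ((_ , false) ∷ ks) (there v∈) = there (cutVertices⊆names ks v∈)

  cutVertices! : ∀ ks → Unique (names ks) → Unique (cutVertices ks)
  cutVertices! []                 _          = []
  cutVertices! ((_ , true)  ∷ ks) (_ ∷ ks!)  = cutVertices! ks ks!
  cutVertices! ((_ , false) ∷ ks) (v∉ ∷ ks!) =
    All.tabulate (λ u∈ → All.lookup v∉ (cutVertices⊆names ks u∈)) ∷ cutVertices! ks ks!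

  labels⊆cutVertices : ∀ l ks {v} → v ∈ labels l ks → v ∈ l ∷ cutVertices ks
  labels⊆cutVertices l (((u , s)     , true)  ∷ ks) (here refl) = here refl
  labels⊆cutVertices l (((u , true)  , true)  ∷ ks) (there v∈)  = labels⊆cutVertices l ks v∈
  labels⊆cutVertices l (((u , false) , true)  ∷ ks) (there v∈)  = labels⊆cutVertices l ks v∈
  labels⊆cutVertices l (((u , s)     , false) ∷ ks) (here refl) = there (here refl)
  labels⊆cutVertices l (((u , true)  , false) ∷ ks) (there v∈)  = there (labels⊆cutVertices u ks v∈)
  labels⊆cutVertices l (((u , false) , false) ∷ ks) (there v∈)  with labels⊆cutVertices l ks v∈
  ... | here eq   = here eq
  ... | there v∈′ = there (there v∈′)

  labels⊆names : ∀ l ks {v} → v ∈ labels l ks → v ∈ l ∷ names ks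
  labels⊆names l ks v∈ with labels⊆cutVertices l ks v∈
  ... | here eq   = here eq
  ... | there v∈′ = there (cutVertices⊆names ks v∈′)

  -- The number i accounts for the vertices of the current component that have been passed.
  -- Components are listed by completion on the left and by first vertex on the right; the orders
  -- differ where a leaf is cut off.
  sizes↭counts : ∀ i l ks → Unique (l ∷ names ks) →
    sizes i ks ↭ (i ℕ.+ count l (labels l ks)) ∷ map (λ r → count r (labels l ks)) (cutVertices ks)
  sizes↭counts i l [] _ = ↭-reflexive (cong (_∷ []) (sym (ℕₚ.+-identityʳ i)))
  sizes↭counts i l (((v , s) , true) ∷ ks) ((l≢v ∷ l∉) ∷ (v∉ ∷ ks!)) = ↭-trans
    (sizes↭counts (suc i) l ks (l∉ ∷ ks!))
    (↭-reflexive (cong₂ _∷_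
      (begin
        suc i ℕ.+ count l (labels l ks)     ≡⟨ ℕₚ.+-suc i _ ⟨
        i ℕ.+ suc (count l (labels l ks))
          ≡⟨ cong (i ℕ.+_) (trans (cong (count l) lab≡) (count-here l (labels l ks))) ⟨
        i ℕ.+ count l (labels l (((v , s) , true) ∷ ks)) ∎)
      (map-cong-local (All.tabulate λ {r} r∈ → sym (trans (cong (count r) lab≡)
        (count-skip {r} (labels l ks) λ { refl → All.lookup l∉ (cutVertices⊆names ks r∈) refl }))))))
    where
    lab≡ : labels l (((v , s) , true) ∷ ks) ≡ l ∷ labels l ks
    lab≡ = cong (λ l′ → l ∷ labels l′ ks) (advance-same s)
      where
      advance-same : ∀ s → advance l s l ≡ l
      advance-same true  = refl
      advance-same false = refl
  sizes↭counts i l (((v , true) , false) ∷ ks) ((l≢v ∷ l∉) ∷ v!@(v∉ ∷ ks!)) = ↭-trans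
    (↭.prep i (sizes↭counts 1 v ks v!))
    (↭-reflexive (cong₂ _∷_
      -- Once the spine is cut, the label l does not return, so i is final.
      (sym (trans (cong (i ℕ.+_) (count-∉ {l} (v ∷ labels v ks) l∉labels)) (ℕₚ.+-identityʳ i)))
      (cong₂ _∷_ (sym (count-here v (labels v ks)))
        (map-cong-local (All.tabulate λ r∈ → sym
          (count-skip (labels v ks) λ { refl → All.lookup v∉ (cutVertices⊆names ks r∈) refl }))))))
    where
    l∉labels : l ∉ v ∷ labels v ks
    l∉labels (here l≡v) = l≢v l≡v
    l∉labels (there l∈) with labels⊆names v ks l∈
    ... | here l≡v  = l≢v l≡v
    ... | there l∈′ = All.lookup l∉ l∈′ refl
  sizes↭counts i l (((v , false) , false) ∷ ks) ((l≢v ∷ l∉) ∷ (v∉ ∷ ks!)) = ↭-trans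
    (↭-trans (↭.prep 1 (sizes↭counts i l ks (l∉ ∷ ks!))) (↭.swap 1 _ ↭-refl))
    (↭-reflexive (cong₂ _∷_
      (cong (i ℕ.+_) (sym (count-skip (labels l ks) l≢v)))
      (cong₂ _∷_ (sym (trans (count-here v (labels l ks)) (cong suc (count-∉ (labels l ks) v∉labels))))
        (map-cong-local (All.tabulate λ r∈ → sym
          (count-skip (labels l ks) λ { refl → All.lookup v∉ (cutVertices⊆names ks r∈) refl }))))))
    where
    v∉labels : v ∉ labels l ks
    v∉labels v∈ with labels⊆names l ks v∈
    ... | here v≡l  = l≢v (sym v≡l)
    ... | there v∈′ = All.lookup v∉ v∈′ refl

  -- `labels` runs along the tokens, whereas `componentSizes-fibres` asks for a function on the
  -- vertices; since the vertices are listed without repetition, one exists.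
  relabel : ∀ {vs ls : List V} → Unique vs → length vs ≡ length ls → ∃[ f ] map f vs ≡ ls
  relabel {[]}     {[]}     _          _  = id , refl
  relabel {v ∷ vs} {l ∷ ls} (v∉ ∷ vs!) eq with relabel {vs} {ls} vs! (ℕₚ.suc-injective eq)
  ... | f , f≡ = g , cong₂ _∷_ g-here (trans (map-cong-local (All.map g-there v∉)) f≡)
    where
    g : V → V
    g u = if does (u ≟ᶠ v) then l else f u
    g-here : g v ≡ l
    g-here with v ≟ᶠ v
    ... | yes _   = refl
    ... | no  v≢v = contradiction refl v≢v
    g-there : ∀ {u} → v ≢ u → g u ≡ f u
    g-there {u} v≢u with u ≟ᶠ v
    ... | yes u≡v = contradiction (sym u≡v) v≢u
    ... | no  _   = refl

  length-labels : ∀ l ks → length (labels l ks) ≡ length ks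
  length-labels l []                   = refl
  length-labels l (((v , s) , k) ∷ ks) = cong suc (length-labels (advance l s (own k l v)) ks)

  kept-same-label : ∀ (f : V → V) c ks → map f (names ks) ≡ labels (f c) ks →
                    ∀ {u v} → (u , v) ∈ kept c ks → f u ≡ f v
  kept-same-label f c (((v , s) , k) ∷ ks) eq uv∈ with ∷-injective eq
  ... | fv≡ , eq′ = go k fv≡ eq′ uv∈
    where
    f-advance : ∀ s {l} → f v ≡ l → f (advance c s v) ≡ advance (f c) s l
    f-advance true  e = e
    f-advance false e = refl
    go : ∀ k → f v ≡ own k (f c) v → map f (names ks) ≡ labels (advance (f c) s (own k (f c) v)) ks →
         ∀ {u y} → (u , y) ∈ kept c (((v , s) , k) ∷ ks) → f u ≡ f y
    go true  fv≡ eq′ (here refl) = sym fv≡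
    go true  fv≡ eq′ (there e∈)  = kept-same-label f (advance c s v) ks
      (trans eq′ (cong (λ l → labels l ks) (sym (f-advance s fv≡)))) e∈
    go false fv≡ eq′ e∈ = kept-same-label f (advance c s v) ks
      (trans eq′ (cong (λ l → labels l ks) (sym (f-advance s fv≡)))) e∈

  -- Kept edges lead back to the first vertex of the component. The hypothesis on c provides this
  -- for the last spine vertex, to which the next token is attached.
  joined-label : ∀ {A : List (V × V)} (f : V → V) c ks → map f (names ks) ≡ labels (f c) ks →
                 (∀ {u v} → (u , v) ∈ kept c ks → (u , v) ∈ A) → Joined A c (f c) →
                 ∀ {v} → v ∈ names ks → Joined A v (f v)
  joined-label {A} f c (((v , s) , k) ∷ ks) eq sub jc with ∷-injective eq
  ... | fv≡ , eq′ = λ { (here refl) → jv ; (there v∈) → joined-label f (advance c s v) ks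
          (trans eq′ (cong (λ l → labels l ks) (sym (f-advance s)))) (sub ∘ weaken-kept k) (j-advance s) v∈ }
    where
    f-advance : ∀ s → f (advance c s v) ≡ advance (f c) s (own k (f c) v)
    f-advance true  = fv≡
    f-advance false = refl
    weaken-kept : ∀ k {e} → e ∈ kept (advance c s v) ks → e ∈ kept c (((v , s) , k) ∷ ks)
    weaken-kept true  e∈ = there e∈
    weaken-kept false e∈ = e∈
    go : ∀ k → f v ≡ own k (f c) v → (∀ {u y} → (u , y) ∈ kept c (((v , s) , k) ∷ ks) → (u , y) ∈ A) →
        Joined A v (f v)
    go true  fv≡ sub = subst (Joined A v) (sym fv≡) (joined-sym (joined-edge (sub (here refl))) ◅◅ jc)
    go false fv≡ sub = subst (Joined A v) (sym fv≡) ε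
    jv : Joined A v (f v)
    jv = go k fv≡ sub
    j-advance : ∀ s → Joined A (advance c s v) (f (advance c s v))
    j-advance true  = jv
    j-advance false = jc

  cutVertices-fixed : ∀ (f : V → V) l ks → map f (names ks) ≡ labels l ks →
                      ∀ {r} → r ∈ cutVertices ks → f r ≡ r
  cutVertices-fixed f l (((v , s) , true)  ∷ ks) eq r∈          =
    cutVertices-fixed f _ ks (proj₂ (∷-injective eq)) r∈
  cutVertices-fixed f l (((v , s) , false) ∷ ks) eq (here refl) = proj₁ (∷-injective eq)
  cutVertices-fixed f l (((v , s) , false) ∷ ks) eq (there r∈)  =
    cutVertices-fixed f _ ks (proj₂ (∷-injective eq)) r∈

  componentSizes-kept : ∀ r ks → Unique (r ∷ names ks) → (∀ v → v ∈ r ∷ names ks) →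
                        componentSizes (kept r ks) ↭ sizes 1 ks
  componentSizes-kept r ks vs!@(r∉ ∷ ks!) all
    with relabel {r ∷ names ks} {r ∷ labels r ks} vs!
           (cong suc (trans (length-map (proj₁ ∘ proj₁) ks) (sym (length-labels r ks))))
  ... | f , f≡ = ↭-trans
    (componentSizes-fibres f same-label joined-by-label vs! all rs! image fixed)
    (↭-trans (↭-reflexive counts) (↭-sym (sizes↭counts 1 r ks vs!)))
    where
    K : List (V × V)
    K = kept r ks
    fr≡r : f r ≡ r
    fr≡r = proj₁ (∷-injective f≡)
    f-labels : map f (names ks) ≡ labels (f r) ks
    f-labels = trans (proj₂ (∷-injective f≡)) (cong (λ l → labels l ks) (sym fr≡r))
    same-label : ∀ {u v} → Joined K u v → f u ≡ f v
    same-label = fold-joined refl sym trans (kept-same-label f r ks f-labels)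
    to-label : ∀ v → Joined K v (f v)
    to-label v with all v
    ... | here refl = subst (Joined K v) (sym fr≡r) ε
    ... | there v∈  = joined-label f r ks f-labels id (subst (Joined K r) (sym fr≡r) ε) v∈
    joined-by-label : ∀ {u v} → f u ≡ f v → Joined K u v
    joined-by-label {u} {v} eq =
      to-label u ◅◅ subst (λ l → Joined K l v) (sym eq) (joined-sym (to-label v))
    rs! : Unique (r ∷ cutVertices ks)
    rs! = All.tabulate (λ v∈ → All.lookup r∉ (cutVertices⊆names ks v∈)) ∷ cutVertices! ks ks!
    image : ∀ v → f v ∈ r ∷ cutVertices ks
    image v with subst (f v ∈_) f≡ (∈-map⁺ f (all v))
    ... | here eq  = here eq
    ... | there l∈ = labels⊆cutVertices r ks l∈
    fixed : ∀ {v} → v ∈ r ∷ cutVertices ks → f v ≡ v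
    fixed (here refl) = fr≡r
    fixed (there v∈)  = cutVertices-fixed f (f r) ks f-labels v∈
    counts : map (λ v → count v (map f (r ∷ names ks))) (r ∷ cutVertices ks) ≡
             suc (count r (labels r ks)) ∷ map (λ v → count v (labels r ks)) (cutVertices ks)
    counts = trans (cong (λ ls → map (λ v → count v ls) (r ∷ cutVertices ks)) f≡)
      (cong₂ _∷_ (count-here r (labels r ks))
        (map-cong-local (All.tabulate λ v∈ → count-skip (labels r ks)
          λ { refl → All.lookup r∉ (cutVertices⊆names ks v∈) refl })))

-- The edge list and the polynomial of a graph with a layout

module _ (G : Graph) where
  open Graph G

  private
    E = Vertex × Vertex

  orient : E → E
  orient (u , v) with u <?ᶠ v
  ... | yes _ = u , v
  ... | no  _ = v , u

  orient-either : ∀ e → orient e ≡ e ⊎ orient e ≡ swap e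
  orient-either (u , v) with u <?ᶠ v
  ... | yes _ = inj₁ refl
  ... | no  _ = inj₂ refl

  orient-< : ∀ {u v} → u Fin.< v → orient (u , v) ≡ (u , v)
  orient-< {u} {v} u<v with u <?ᶠ v
  ... | yes _   = refl
  ... | no  u≮v = contradiction u<v u≮v

  orient-> : ∀ {u v} → u Fin.< v → orient (v , u) ≡ (u , v)
  orient-> {u} {v} u<v with v <?ᶠ u
  ... | yes v<u = contradiction v<u (Finₚ.<-asym u<v)
  ... | no  _   = refl

  branches-snd : ∀ c (ts : Tokens Vertex) {u v} → (u , v) ∈ branches c ts → v ∈ map proj₁ ts
  branches-snd c (t ∷ ts) (here refl) = here refl
  branches-snd c (t ∷ ts) (there e∈)  = there (branches-snd _ ts e∈)

  -- If a later branch had the same orientation as this one, its second endpoint would be v or c,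
  -- but both come before its token.
  orient-branches! : ∀ c (ts : Tokens Vertex) → Unique (c ∷ map proj₁ ts) →
      Unique (map orient (branches c ts))
  orient-branches! c []             _                        = []
  orient-branches! c ((v , s) ∷ ts) ((c≢v ∷ c∉) ∷ (v∉ ∷ ts!)) =
    Allₚ.map⁺ (All.tabulate distinct) ∷ orient-branches! (advance c s v) ts (advance! s)
    where
    advance! : ∀ s → Unique (advance c s v ∷ map proj₁ ts)
    advance! true  = v∉ ∷ ts!
    advance! false = c∉ ∷ ts!
    endpoints : ∀ {u y} → orient (c , v) ≡ orient (u , y) → y ≡ v ⊎ y ≡ c
    endpoints {u} {y} eq with orient-either (c , v) | orient-either (u , y)
    ... | inj₁ p | inj₁ q = inj₁ (sym (cong proj₂ (trans (sym p) (trans eq q))))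
    ... | inj₁ p | inj₂ q = inj₂ (sym (cong proj₁ (trans (sym p) (trans eq q))))
    ... | inj₂ p | inj₁ q = inj₂ (sym (cong proj₂ (trans (sym p) (trans eq q))))
    ... | inj₂ p | inj₂ q = inj₁ (sym (cong proj₁ (trans (sym p) (trans eq q))))
    distinct : ∀ {e} → e ∈ branches (advance c s v) ts → orient (c , v) ≢ orient e
    distinct e∈ eq with endpoints eq
    ... | inj₁ refl = All.lookup v∉ (branches-snd _ ts e∈) refl
    ... | inj₂ refl = All.lookup c∉ (branches-snd _ ts e∈) refl

  module _ {w : List Bool} (layout : Layout G w) where
    open Layout layout

    private
      es = branches root tokens

    edges↭branches : edges ↭ map orient es
    edges↭branches = ∼bag⇒↭ (unique∧set⇒bag
      (Uniqueₚ.filter⁺ _ (Uniqueₚ.cartesianProduct⁺ (Uniqueₚ.allFin⁺ order) (Uniqueₚ.allFin⁺ order)))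
      (orient-branches! root tokens unique) (mk⇔ to from))
      where
      to : ∀ {e} → e ∈ edges → e ∈ map orient es
      to {u , v} e∈ with ∈-filter⁻ _ {xs = cartesianProduct (allFin order) (allFin order)} e∈
      ... | _ , u<v , uv with adj⇒ uv
      ...   | inj₁ p = subst (_∈ map orient es) (orient-< u<v) (∈-map⁺ orient p)
      ...   | inj₂ p = subst (_∈ map orient es) (orient-> u<v) (∈-map⁺ orient p)
      edge : ∀ {u v} → u Fin.< v → Adj u v → (u , v) ∈ edges
      edge {u} {v} u<v uv = ∈-filter⁺ _ (∈-cartesianProduct⁺ (∈-allFin u) (∈-allFin v)) (u<v , uv)
      from : ∀ {e} → e ∈ map orient es → e ∈ edges
      from e∈ with ∈-map⁻ orient e∈
      ... | (u , v) , uv∈ , refl with Finₚ.<-cmp u v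
      ...   | tri< u<v _ _ = subst (_∈ edges) (sym (orient-< u<v)) (edge u<v (⇒adj uv∈))
      ...   | tri≈ _ u≡v _ = contradiction (⇒adj uv∈) (irrefl u≡v)
      ...   | tri> _ _ v<u = subst (_∈ edges) (sym (orient-> v<u)) (edge v<u (symm (⇒adj uv∈)))

    private
      g : Monomial → List E → ℤ
      g m A = coeff (summand G (length A) (componentSizes A)) m

      g-cong : ∀ m {A A′} → length A ≡ length A′ → (∀ {u v} → Joined A u v → Joined A′ u v) →
               (∀ {u v} → Joined A′ u v → Joined A u v) → g m A ≡ g m A′
      g-cong m len to from = cong₂ (λ j s → coeff (summand G j s) m) len (componentSizes-cong to from)

      g-↭ : ∀ m {A A′} → A ↭ A′ → g m A ≡ g m A′
      g-↭ m ρ = g-cong m (↭-length ρ)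
        (joined-mono (inj₁ ∘ ∈-resp-↭ ρ)) (joined-mono (inj₁ ∘ ∈-resp-↭ (↭-sym ρ)))

      g-orient : ∀ m A → g m (map orient A) ≡ g m A
      g-orient m A = g-cong m (length-map orient A) (joined-mono from) (joined-mono to)
        where
        from : ∀ {u v} → (u , v) ∈ map orient A → (u , v) ∈ A ⊎ (v , u) ∈ A
        from e∈ with ∈-map⁻ orient e∈
        ... | e , e∈A , eq with orient-either e
        ...   | inj₁ q = inj₁ (subst (_∈ A) (sym (trans eq q)) e∈A)
        ...   | inj₂ q = inj₂ (subst (_∈ A) (sym (cong swap (trans eq q))) e∈A)
        to : ∀ {u v} → (u , v) ∈ A → (u , v) ∈ map orient A ⊎ (v , u) ∈ map orient A
        to {u} {v} e∈ with orient-either (u , v)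
        ... | inj₁ q = inj₁ (subst (_∈ map orient A) q (∈-map⁺ orient e∈))
        ... | inj₂ q = inj₂ (subst (_∈ map orient A) q (∈-map⁺ orient e∈))

    order≡ : order ≡ suc (length tokens)
    order≡ = begin
      order                     ≡⟨ length-tabulate id ⟨
      length (allFin order)     ≡⟨ ↭-length (∼bag⇒↭ (unique∧set⇒bag (Uniqueₚ.allFin⁺ order) unique
                                     (mk⇔ (λ _ → complete _) (λ _ → ∈-allFin _)))) ⟩
      length vertices           ≡⟨ cong suc (length-map proj₁ tokens) ⟩
      suc (length tokens)       ∎

    private
      g-kept : ∀ m {ks} → ks ∈ choices tokens → g m (kept root ks) ≡ termCoeff m (sizes 1 ks)
      g-kept m {ks} ks∈ = begin
        g m (kept root ks)
          ≡⟨ summand-forest G (length (kept root ks)) (componentSizes (kept root ks)) m count-ok ⟩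
        termCoeff m (componentSizes (kept root ks))
          ≡⟨ termCoeff-↭ m components ⟩
        termCoeff m (sizes 1 ks) ∎
        where
        tokens≡ : map proj₁ ks ≡ tokens
        tokens≡ = choices-tokens tokens ks∈
        names≡ : names ks ≡ map proj₁ tokens
        names≡ = trans (map-∘ ks) (cong (map proj₁) tokens≡)
        components : componentSizes (kept root ks) ↭ sizes 1 ks
        components = componentSizes-kept root ks
          (subst (λ vs → Unique (root ∷ vs)) (sym names≡) unique)
          (λ v → subst (λ vs → v ∈ root ∷ vs) (sym names≡) (complete v))
        count-ok : length (kept root ks) ℕ.+ length (componentSizes (kept root ks)) ≡ order
        count-ok = begin
          length (kept root ks) ℕ.+ length (componentSizes (kept root ks))
            ≡⟨ cong (length (kept root ks) ℕ.+_) (↭-length components) ⟩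
          length (kept root ks) ℕ.+ length (sizes 1 ks)
            ≡⟨ length-kept+sizes root 1 ks ⟩
          suc (length ks)
            ≡⟨ cong suc (trans (sym (length-map proj₁ ks)) (cong length tokens≡)) ⟩
          suc (length tokens)                                              ≡⟨ order≡ ⟨
          order                                                            ∎

    U-layout : ∀ m → coeff (U G) m ≡ cutSum (termCoeff m) 1 w
    U-layout m = begin
      coeff (U G) m                                            ≡⟨ U-coeff G m ⟩
      sumOver (g m) (subsets edges)
        ≡⟨ sumOver-subsets-↭ (g-↭ m) edges↭branches ⟩
      sumOver (g m) (subsets (map orient es))
        ≡⟨ cong (sumOver (g m)) (subsets-map orient es) ⟩
      sumOver (g m) (map (map orient) (subsets es))
        ≡⟨ sumOver-map (g m) (map orient) (subsets es) ⟩
      sumOver (g m ∘ map orient) (subsets es)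
        ≡⟨ sumOver-cong (subsets es) (λ {A} _ → g-orient m A) ⟩
      sumOver (g m) (subsets es)
        ≡⟨ cong (sumOver (g m)) (subsets-branches root tokens) ⟩
      sumOver (g m) (map (kept root) (choices tokens))
        ≡⟨ sumOver-map (g m) (kept root) (choices tokens) ⟩
      sumOver (g m ∘ kept root) (choices tokens)
        ≡⟨ sumOver-cong (choices tokens) (g-kept m) ⟩
      sumOver (termCoeff m ∘ sizes 1) (choices tokens)
        ≡⟨ sumOver-choices (termCoeff m) 1 tokens ⟩
      cutSum (termCoeff m) 1 (map proj₂ tokens)                ≡⟨ cong (cutSum (termCoeff m) 1) word ⟩
      cutSum (termCoeff m) 1 w                                 ∎

-- Standard caterpillars and isomorphisms

advance-map : ∀ (f : A → B) c s v → advance (f c) s (f v) ≡ f (advance c s v)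
advance-map f c true  v = refl
advance-map f c false v = refl

both : (A → B) → A × A → B × B
both f (u , v) = f u , f v

branches-map : ∀ (f : A → B) c ts → branches (f c) (map (map₁ f) ts) ≡ map (both f) (branches c ts)
branches-map f c []             = refl
branches-map f c ((v , s) ∷ ts) = cong ((f c , f v) ∷_)
  (trans (cong (λ d → branches d (map (map₁ f) ts)) (advance-map f c s v)) (branches-map f (advance c s v) ts))

branches-≢ : ∀ (c : A) ts → Unique (c ∷ map proj₁ ts) → ∀ {u v} → (u , v) ∈ branches c ts → u ≢ v
branches-≢ c ((v , s) ∷ ts)     ((c≢v ∷ c∉) ∷ v!)         (here refl) = c≢v
branches-≢ c ((v , true) ∷ ts)  (c∉ ∷ v!)                 (there e∈)  = branches-≢ v ts v! e∈
branches-≢ c ((v , false) ∷ ts) ((c≢v ∷ c∉) ∷ (v∉ ∷ ts!)) (there e∈)  = branches-≢ c ts (c∉ ∷ ts!) e∈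

-- Generating tokens from positions exhibits any layout as the image of the standard one, through
-- `place-nth` and `place-map`.
place : (w : List Bool) → (Fin (length w) → A) → Tokens A
place []      f = []
place (s ∷ w) f = (f Fin.zero , s) ∷ place w (f ∘ Fin.suc)

place-names : ∀ w (f : Fin (length w) → A) → map proj₁ (place w f) ≡ tabulate f
place-names []      f = refl
place-names (s ∷ w) f = cong (f Fin.zero ∷_) (place-names w (f ∘ Fin.suc))

place-word : ∀ w (f : Fin (length w) → A) → map proj₂ (place w f) ≡ w
place-word []      f = refl
place-word (s ∷ w) f = cong (s ∷_) (place-word w (f ∘ Fin.suc))

place-map : ∀ w (g : A → B) (f : Fin (length w) → A) → place w (g ∘ f) ≡ map (map₁ g) (place w f)
place-map []      g f = refl
place-map (s ∷ w) g f = cong ((g (f Fin.zero) , s) ∷_) (place-map w g (f ∘ Fin.suc))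

nth : (ts : Tokens A) → Fin (length (map proj₂ ts)) → A
nth (t ∷ ts) Fin.zero    = proj₁ t
nth (t ∷ ts) (Fin.suc i) = nth ts i

place-nth : ∀ (ts : Tokens A) → place (map proj₂ ts) (nth ts) ≡ ts
place-nth []       = refl
place-nth (t ∷ ts) = cong (t ∷_) (place-nth ts)

nth-∈ : ∀ (ts : Tokens A) i → nth ts i ∈ map proj₁ ts
nth-∈ (t ∷ ts) Fin.zero    = here refl
nth-∈ (t ∷ ts) (Fin.suc i) = there (nth-∈ ts i)

nth-injective : ∀ (ts : Tokens A) → Unique (map proj₁ ts) → ∀ {i j} → nth ts i ≡ nth ts j → i ≡ j
nth-injective (t ∷ ts) (t∉ ∷ ts!) {Fin.zero}  {Fin.zero}  eq = refl
nth-injective (t ∷ ts) (t∉ ∷ ts!) {Fin.zero}  {Fin.suc j} eq =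
  contradiction eq (All.lookup t∉ (nth-∈ ts j))
nth-injective (t ∷ ts) (t∉ ∷ ts!) {Fin.suc i} {Fin.zero}  eq =
  contradiction (sym eq) (All.lookup t∉ (nth-∈ ts i))
nth-injective (t ∷ ts) (t∉ ∷ ts!) {Fin.suc i} {Fin.suc j} eq = cong Fin.suc (nth-injective ts ts! eq)

nth-surjective : ∀ (ts : Tokens A) {v} → v ∈ map proj₁ ts → ∃[ i ] nth ts i ≡ v
nth-surjective (t ∷ ts) (here refl) = Fin.zero , refl
nth-surjective (t ∷ ts) (there v∈) with nth-surjective ts v∈
... | i , eq = Fin.suc i , eq

standardTokens : (w : List Bool) → Tokens (Fin (suc (length w)))
standardTokens w = place w Fin.suc

standardEdges : (w : List Bool) → List (Fin (suc (length w)) × Fin (suc (length w)))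
standardEdges w = branches Fin.zero (standardTokens w)

standard-vertices : ∀ w → Fin.zero ∷ map proj₁ (standardTokens w) ≡ allFin (suc (length w))
standard-vertices w = cong (Fin.zero ∷_) (place-names w Fin.suc)

standard-unique : ∀ w → Unique (Fin.zero ∷ map proj₁ (standardTokens w))
standard-unique w = subst Unique (sym (standard-vertices w)) (Uniqueₚ.allFin⁺ _)

caterpillar : List Bool → Graph
caterpillar w = record
  { order  = suc (length w)
  ; Adj    = λ u v → (u , v) ∈ standardEdges w ⊎ (v , u) ∈ standardEdges w
  ; adj?   = λ u v → ((u , v) ∈? standardEdges w) ⊎-dec ((v , u) ∈? standardEdges w)
  ; symm   = Sum.swap
  ; irrefl = λ { refl (inj₁ e∈) → loop e∈ refl ; refl (inj₂ e∈) → loop e∈ refl }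
  }
  where
  open DecMembership (≡-dec _≟ᶠ_ _≟ᶠ_) using (_∈?_)
  loop : ∀ {u v} → (u , v) ∈ standardEdges w → u ≢ v
  loop = branches-≢ Fin.zero (standardTokens w) (standard-unique w)

caterpillar-layout : ∀ w → Layout (caterpillar w) w
caterpillar-layout w = record
  { root     = Fin.zero
  ; tokens   = standardTokens w
  ; word     = place-word w Fin.suc
  ; unique   = standard-unique w
  ; complete = λ v → subst (v ∈_) (sym (standard-vertices w)) (∈-allFin v)
  ; adj⇒     = id
  ; ⇒adj     = inj₁
  }

layout-≅ : ∀ {G w} → Layout G w → caterpillar w ≅ G
layout-≅ {G} record { root = root ; tokens = ts ; word = refl ; unique = r∉ ∷ ts! ; complete = all
                    ; adj⇒ = adj⇒ ; ⇒adj = ⇒adj } =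
  mk↔ₛ′ f (proj₁ ∘ f-surjective) (proj₂ ∘ f-surjective) (λ i → f-injective (proj₂ (f-surjective (f i)))) ,
  λ u v → mk⇔ (Sum.[ preserve , symm ∘ preserve ]) (Sum.map reflect reflect ∘ adj⇒)
  where
  open Graph G using (symm; Adj)
  w = map proj₂ ts
  f : Fin (suc (length w)) → Graph.Vertex G
  f Fin.zero    = root
  f (Fin.suc i) = nth ts i
  f-injective : ∀ {i j} → f i ≡ f j → i ≡ j
  f-injective {Fin.zero}  {Fin.zero}  eq = refl
  f-injective {Fin.zero}  {Fin.suc j} eq = contradiction eq (All.lookup r∉ (nth-∈ ts j))
  f-injective {Fin.suc i} {Fin.zero}  eq = contradiction (sym eq) (All.lookup r∉ (nth-∈ ts i))
  f-injective {Fin.suc i} {Fin.suc j} eq = cong Fin.suc (nth-injective ts ts! eq)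
  f-surjective : ∀ v → ∃[ i ] f i ≡ v
  f-surjective v with all v
  ... | here eq  = Fin.zero , sym eq
  ... | there v∈ with nth-surjective ts v∈
  ...   | i , eq = Fin.suc i , eq
  edges≡ : branches root ts ≡ map (both f) (standardEdges w)
  edges≡ = begin
    branches root ts                                 ≡⟨ cong (branches root) (place-nth ts) ⟨
    branches root (place w (f ∘ Fin.suc))            ≡⟨ cong (branches root) (place-map w f Fin.suc) ⟩
    branches root (map (map₁ f) (standardTokens w))  ≡⟨ branches-map f Fin.zero (standardTokens w) ⟩
    map (both f) (standardEdges w)                   ∎
  preserve : ∀ {u v} → (u , v) ∈ standardEdges w → Adj (f u) (f v)
  preserve {u} {v} e∈ = ⇒adj (subst ((f u , f v) ∈_) (sym edges≡) (∈-map⁺ (both f) e∈))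
  reflect : ∀ {u v} → (f u , f v) ∈ branches root ts → (u , v) ∈ standardEdges w
  reflect {u} {v} e∈ with ∈-map⁻ (both f) (subst ((f u , f v) ∈_) edges≡ e∈)
  ... | (u′ , v′) , e∈′ , eq = subst (_∈ standardEdges w)
    (cong₂ _,_ (f-injective (sym (cong proj₁ eq))) (f-injective (sym (cong proj₂ eq)))) e∈′

-- The spine of a caterpillar

-- The spine vertices have the given numbers of leaves.  Unlike the word of a
-- layout, this one includes the token of the root.
spineWord : List ℕ → List Bool
spineWord []      = []
spineWord (l ∷ S) = true ∷ replicate l false ++ spineWord S

spineWord-∷ʳ : ∀ S l → spineWord (S ∷ʳ l) ≡ spineWord S ++ true ∷ replicate l false
spineWord-∷ʳ []      l = cong (true ∷_) (++-identityʳ (replicate l false))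
spineWord-∷ʳ (k ∷ S) l = cong (true ∷_) (trans (cong (replicate k false ++_) (spineWord-∷ʳ S l))
  (sym (++-assoc (replicate k false) (spineWord S) _)))

replicate-∷ʳ : ∀ n (b : A) → replicate n b ∷ʳ b ≡ b ∷ replicate n b
replicate-∷ʳ zero    b = refl
replicate-∷ʳ (suc n) b = cong (b ∷_) (replicate-∷ʳ n b)

reverse-replicate : ∀ n (b : A) → reverse (replicate n b) ≡ replicate n b
reverse-replicate zero    b = refl
reverse-replicate (suc n) b =
  trans (unfold-reverse b (replicate n b)) (trans (cong (_∷ʳ b) (reverse-replicate n b)) (replicate-∷ʳ n b))

-- A block starts with its spine bit, while in the reversed word it ends with it. The extra `true`
-- on either side makes up for this shift.
spineWord-reverse : ∀ S → spineWord (reverse S) ∷ʳ true ≡ true ∷ reverse (spineWord S)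
spineWord-reverse []      = refl
spineWord-reverse (l ∷ S) = begin
  spineWord (reverse (l ∷ S)) ∷ʳ true
    ≡⟨ cong (λ T → spineWord T ∷ʳ true) (unfold-reverse l S) ⟩
  spineWord (reverse S ∷ʳ l) ∷ʳ true
    ≡⟨ cong (_∷ʳ true) (spineWord-∷ʳ (reverse S) l) ⟩
  (spineWord (reverse S) ++ true ∷ L) ∷ʳ true
    ≡⟨ cong (_∷ʳ true) (++-assoc (spineWord (reverse S)) (true ∷ []) L) ⟨
  ((spineWord (reverse S) ∷ʳ true) ++ L) ∷ʳ true
    ≡⟨ cong (λ v → (v ++ L) ∷ʳ true) (spineWord-reverse S) ⟩
  true ∷ (reverse (spineWord S) ++ L) ∷ʳ true
    ≡⟨ cong (λ L → true ∷ (reverse (spineWord S) ++ L) ∷ʳ true) (reverse-replicate l false) ⟨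
  true ∷ (reverse (spineWord S) ++ reverse L) ∷ʳ true
    ≡⟨ cong (λ v → true ∷ v ∷ʳ true) (reverse-++ L (spineWord S)) ⟨
  true ∷ reverse (L ++ spineWord S) ∷ʳ true
    ≡⟨ cong (true ∷_) (unfold-reverse true (L ++ spineWord S)) ⟨
  true ∷ reverse (spineWord (l ∷ S)) ∎
  where L = replicate l false

-- The one-vertex tree is the only caterpillar with a leafless spine end.
data Ends : List ℕ → Set where
  single : Ends (0 ∷ [])
  leafy  : ∀ {S i j T T′} → S ≡ suc i ∷ T → reverse S ≡ suc j ∷ T′ → Ends S

-- The first entry of `S` puts a leaf behind the root; the first entry of `reverse S` puts one at
-- the other end of the word. Reading the word backwards yields the code of the reversed spine at
-- the same time.
spineWord-ends : ∀ {S} → Ends S →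
  spineWord S ≡ true ∷ [] ⊎
  spineWord S ≡ true ∷ false ∷ [] ⊎
  ∃[ u ] spineWord S ≡ true ∷ wrap u × spineWord (reverse S) ≡ true ∷ wrap (reverse u)
spineWord-ends single = inj₁ refl
spineWord-ends {S} (leafy {i = i} {j} {T} {T′} S≡ rev≡) =
  go (replicate i false ++ spineWord T) (cong spineWord S≡)
  where
  go : ∀ v → spineWord S ≡ true ∷ false ∷ v →
       spineWord S ≡ true ∷ [] ⊎
       spineWord S ≡ true ∷ false ∷ [] ⊎
       ∃[ u ] spineWord S ≡ true ∷ wrap u × spineWord (reverse S) ≡ true ∷ wrap (reverse u)
  go v eq with initLast v
  ... | []     = inj₂ (inj₁ eq)
  ... | u ∷ʳ′ s with reversed
    where
    reversed : spineWord (reverse S) ≡ true ∷ s ∷ reverse u ∷ʳ false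
    reversed = proj₁ (∷ʳ-injective _ _ (begin
      spineWord (reverse S) ∷ʳ true           ≡⟨ spineWord-reverse S ⟩
      true ∷ reverse (spineWord S)            ≡⟨ cong (λ v → true ∷ reverse v) eq ⟩
      true ∷ reverse (true ∷ false ∷ u ∷ʳ s)  ≡⟨ cong (true ∷_) (unfold-reverse true (false ∷ u ∷ʳ s)) ⟩
      true ∷ reverse (false ∷ u ∷ʳ s) ∷ʳ true
        ≡⟨ cong (λ v → true ∷ v ∷ʳ true) (unfold-reverse false (u ∷ʳ s)) ⟩
      true ∷ (reverse (u ∷ʳ s) ∷ʳ false) ∷ʳ true
        ≡⟨ cong (λ v → true ∷ (v ∷ʳ false) ∷ʳ true) (reverse-++ u (s ∷ [])) ⟩
      (true ∷ s ∷ reverse u ∷ʳ false) ∷ʳ true ∎))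
  -- By `rev≡` the second letter of the reversed word is a leaf, so comparison with `reversed`
  -- forces s to be `false`.
  ...   | reversed with trans (sym (cong spineWord rev≡)) reversed
  ...     | start with ∷-injective (proj₂ (∷-injective start))
  ...       | refl , _ = inj₂ (inj₂ (u , eq , reversed))

-- Consecutive vertices of a path

Consecutiveₗ : List A → A → A → Set
Consecutiveₗ p u v = ∃[ a ] ∃[ b ] p ≡ a ++ u ∷ v ∷ b

consecutive-∷ : ∀ {p : List A} {c u v} → Consecutiveₗ p u v → Consecutiveₗ (c ∷ p) u v
consecutive-∷ {c = c} (a , b , eq) = c ∷ a , b , cong (c ∷_) eq

consecutive-here : ∀ {p : List A} {u v} → Consecutiveₗ (u ∷ v ∷ p) u v
consecutive-here {p = p} = [] , p , refl

consecutive-inv : ∀ {p : List A} {c d u v} → Consecutiveₗ (c ∷ d ∷ p) u v →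
                  (u ≡ c × v ≡ d) ⊎ Consecutiveₗ (d ∷ p) u v
consecutive-inv ([]    , b , refl) = inj₁ (refl , refl)
consecutive-inv (_ ∷ a , b , eq)   = inj₂ (a , b , proj₂ (∷-injective eq))

consecutive-single : ∀ {c u v : A} → ¬ Consecutiveₗ (c ∷ []) u v
consecutive-single ([]        , b , ())
consecutive-single (_ ∷ []    , b , ())
consecutive-single (_ ∷ _ ∷ a , b , ())

consecutive-∈ : ∀ {p : List A} {u v} → Consecutiveₗ p u v → u ∈ p × v ∈ p
consecutive-∈ (a , b , refl) = ∈-++⁺ʳ a (here refl) , ∈-++⁺ʳ a (there (here refl))

consecutive-reverse : ∀ {p : List A} {u v} → Consecutiveₗ p u v → Consecutiveₗ (reverse p) v u
consecutive-reverse {u = u} {v} (a , b , refl) = reverse b , reverse a , (begin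
  reverse (a ++ u ∷ v ∷ b)                    ≡⟨ reverse-++ a (u ∷ v ∷ b) ⟩
  reverse (u ∷ v ∷ b) ++ reverse a            ≡⟨ cong (_++ reverse a) (reverse-++ (u ∷ v ∷ []) b) ⟩
  (reverse b ++ v ∷ u ∷ []) ++ reverse a      ≡⟨ ++-assoc (reverse b) (v ∷ u ∷ []) (reverse a) ⟩
  reverse b ++ v ∷ u ∷ reverse a              ∎)

consecutive-reverse⁻ : ∀ {p : List A} {u v} → Consecutiveₗ (reverse p) u v → Consecutiveₗ p v u
consecutive-reverse⁻ {p = p} {u} {v} c =
  subst (λ q → Consecutiveₗ q v u) (reverse-involutive p) (consecutive-reverse c)

-- The path has an edge, so each of its vertices is on one; `path-inner` concludes that none of them
-- is a leaf.
consecutive-exists : ∀ {c d : A} p {u} → u ∈ c ∷ d ∷ p →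
                     ∃[ v ] (Consecutiveₗ (c ∷ d ∷ p) u v ⊎ Consecutiveₗ (c ∷ d ∷ p) v u)
consecutive-exists p       (here refl)         = _ , inj₁ consecutive-here
consecutive-exists p       (there (here refl)) = _ , inj₂ consecutive-here
consecutive-exists (e ∷ p) (there u∈@(there _)) with consecutive-exists p u∈
... | v , c = v , Sum.map consecutive-∷ consecutive-∷ c

reverse-unique : ∀ {p : List A} → Unique p → Unique (reverse p)
reverse-unique {p = p} = Unique-resp-↭ (setoid _) (↭⇒↭ₛ (↭-sym (↭-reverse p)))

∈-reverse : ∀ {p : List A} {v} → v ∈ p → v ∈ reverse p
∈-reverse = Anyₚ.reverse⁺

∈-reverse⁻ : ∀ {p : List A} {v} → v ∈ reverse p → v ∈ p
∈-reverse⁻ = Anyₚ.reverse⁻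

-- Layouts along a spine

module _ (G : Graph) where
  open Graph G

  open DecMembership (_≟ᶠ_ {order}) using (_∈?_)

  -- An induced path to which every other vertex is attached by its only edge. The notion is
  -- invariant under reversal, which yields the second layout.
  record Spine (P : List Vertex) : Set where
    field
      unique   : Unique P
      path     : ∀ {u v} → u ∈ P → v ∈ P → Adj u v → Consecutiveₗ P u v ⊎ Consecutiveₗ P v u
      adjacent : ∀ {u v} → Consecutiveₗ P u v → Adj u v
      leaf     : ∀ u → u ∉ P → ∃[ v ] v ∈ P × Adj v u × (∀ {y} → Adj u y → y ≡ v)

  spine-reverse : ∀ {P} → Spine P → Spine (reverse P)
  spine-reverse S = record
    { unique   = reverse-unique unique
    ; path     = λ u∈ v∈ uv → Sum.map consecutive-reverse consecutive-reverse
                   (Sum.swap (path (∈-reverse⁻ u∈) (∈-reverse⁻ v∈) uv))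
    ; adjacent = λ c → symm (adjacent (consecutive-reverse⁻ c))
    ; leaf     = λ u u∉ → case leaf u (u∉ ∘ ∈-reverse) of λ (v , v∈ , rest) → v , ∈-reverse v∈ , rest
    }
    where open Spine S

  leavesAt : List Vertex → Vertex → List Vertex
  leavesAt P v = filter (λ u → adj? v u ×-dec ¬? (u ∈? P)) (allFin order)

  ∈-leavesAt : ∀ {P v u} → Adj v u → u ∉ P → u ∈ leavesAt P v
  ∈-leavesAt {P} {v} vu u∉ = ∈-filter⁺ (λ u → adj? v u ×-dec ¬? (u ∈? P)) (∈-allFin _) (vu , u∉)

  leavesAt-reverse : ∀ P v → leavesAt (reverse P) v ≡ leavesAt P v
  leavesAt-reverse P v = filter-≐ _ _
    ((λ (vu , u∉) → vu , u∉ ∘ ∈-reverse) , (λ (vu , u∉) → vu , u∉ ∘ ∈-reverse⁻)) (allFin order)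

  shape : List Vertex → List ℕ
  shape P = map (length ∘ leavesAt P) P

  shape-reverse : ∀ P → shape (reverse P) ≡ reverse (shape P)
  shape-reverse P =
    trans (map-cong (cong length ∘ leavesAt-reverse P) (reverse P)) (reverse-map (length ∘ leavesAt P) P)

  module _ {P : List Vertex} (S : Spine P) where
    open Spine S

    private
      leaves = leavesAt P

      leaves-∈ : ∀ {v u} → u ∈ leaves v → Adj v u × u ∉ P
      leaves-∈ {v} u∈ = proj₂ (∈-filter⁻ (λ u → adj? v u ×-dec ¬? (u ∈? P)) {xs = allFin order} u∈)

      leafTokens : Vertex → Tokens Vertex
      leafTokens v = map (_, false) (leaves v)

      spineTokens : List Vertex → Tokens Vertex
      spineTokens []       = []
      spineTokens (v ∷ vs) = (v , true) ∷ leafTokens v ++ spineTokens vs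

      leafTokens-names : ∀ ls (ts : Tokens Vertex) →
          map proj₁ (map (_, false) ls ++ ts) ≡ ls ++ map proj₁ ts
      leafTokens-names []       ts = refl
      leafTokens-names (l ∷ ls) ts = cong (l ∷_) (leafTokens-names ls ts)

      leafTokens-word : ∀ ls (ts : Tokens Vertex) →
          map proj₂ (map (_, false) ls ++ ts) ≡ replicate (length ls) false ++ map proj₂ ts
      leafTokens-word []       ts = refl
      leafTokens-word (l ∷ ls) ts = cong (false ∷_) (leafTokens-word ls ts)

      leafTokens-branches : ∀ (c : Vertex) ls ts →
          branches c (map (_, false) ls ++ ts) ≡ map (c ,_) ls ++ branches c ts
      leafTokens-branches c []       ts = refl
      leafTokens-branches c (l ∷ ls) ts = cong ((c , l) ∷_) (leafTokens-branches c ls ts)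

      spineTokens-names : ∀ vs → map proj₁ (spineTokens vs) ≡ concat (map (λ v → v ∷ leaves v) vs)
      spineTokens-names []       = refl
      spineTokens-names (v ∷ vs) = cong (v ∷_)
        (trans (leafTokens-names (leaves v) (spineTokens vs)) (cong (leaves v ++_) (spineTokens-names vs)))

      spineTokens-word : ∀ vs → map proj₂ (spineTokens vs) ≡ spineWord (map (length ∘ leaves) vs)
      spineTokens-word []       = refl
      spineTokens-word (v ∷ vs) = cong (true ∷_)
        (trans (leafTokens-word (leaves v) (spineTokens vs))
          (cong (replicate (length (leaves v)) false ++_) (spineTokens-word vs)))

      spine-edges : Vertex → List Vertex → List (Vertex × Vertex)
      spine-edges c vs = branches c (leafTokens c ++ spineTokens vs)

      spine-edges⇒ : ∀ c vs {u v} → (u , v) ∈ spine-edges c vs →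
                     (u ∈ c ∷ vs × v ∈ leaves u) ⊎ Consecutiveₗ (c ∷ vs) u v
      spine-edges⇒ c vs e∈ with ∈-++⁻ (map (c ,_) (leaves c))
                                  (subst (_ ∈_) (leafTokens-branches c (leaves c) (spineTokens vs)) e∈)
      spine-edges⇒ c vs       e∈ | inj₁ p with ∈-map⁻ (c ,_) p
      ... | l , l∈ , refl = inj₁ (here refl , l∈)
      spine-edges⇒ c (d ∷ vs) e∈ | inj₂ (here refl) = inj₂ consecutive-here
      spine-edges⇒ c (d ∷ vs) e∈ | inj₂ (there p) with spine-edges⇒ d vs p
      ... | inj₁ (u∈ , v∈) = inj₁ (there u∈ , v∈)
      ... | inj₂ uv        = inj₂ (consecutive-∷ uv)

      into : ∀ c vs {e} → e ∈ map (c ,_) (leaves c) ++ branches c (spineTokens vs) →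
          e ∈ spine-edges c vs
      into c vs = subst (_ ∈_) (sym (leafTokens-branches c (leaves c) (spineTokens vs)))

      leaf-edge : ∀ c vs {u v} → u ∈ c ∷ vs → v ∈ leaves u → (u , v) ∈ spine-edges c vs
      leaf-edge c vs       (here refl) v∈ = into c vs (∈-++⁺ˡ (∈-map⁺ (c ,_) v∈))
      leaf-edge c (d ∷ vs) (there u∈)  v∈ =
        into c (d ∷ vs) (∈-++⁺ʳ (map (c ,_) (leaves c)) (there (leaf-edge d vs u∈ v∈)))

      path-edge : ∀ c vs {u v} → Consecutiveₗ (c ∷ vs) u v → (u , v) ∈ spine-edges c vs
      path-edge c []       uv = contradiction uv consecutive-single
      path-edge c (d ∷ vs) uv with consecutive-inv uv
      ... | inj₁ (refl , refl) = into c (d ∷ vs) (∈-++⁺ʳ (map (c ,_) (leaves c)) (here refl))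
      ... | inj₂ uv′           = into c (d ∷ vs) (∈-++⁺ʳ (map (c ,_) (leaves c)) (there (path-edge d vs uv′)))

      block! : ∀ {v} → v ∈ P → Unique (v ∷ leaves v)
      block! v∈ = All.tabulate (λ u∈ → λ { refl → proj₂ (leaves-∈ u∈) v∈ })
                  ∷ Uniqueₚ.filter⁺ _ (Uniqueₚ.allFin⁺ order)

      -- A leaf in two blocks would have two neighbours.
      blocks-disjoint : ∀ {v v′} → v ∈ P → v′ ∈ P → v ≢ v′ →
                        ∀ {u} → ¬ (u ∈ v ∷ leaves v × u ∈ v′ ∷ leaves v′)
      blocks-disjoint v∈ v′∈ v≢v′ (here refl , here refl) = v≢v′ refl
      blocks-disjoint v∈ v′∈ v≢v′ (here refl , there u∈′) = proj₂ (leaves-∈ u∈′) v∈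
      blocks-disjoint v∈ v′∈ v≢v′ (there u∈  , here refl) = proj₂ (leaves-∈ u∈) v′∈
      blocks-disjoint v∈ v′∈ v≢v′ (there u∈  , there u∈′) with leaves-∈ u∈ | leaves-∈ u∈′
      ... | vu , u∉ | v′u , _ with leaf _ u∉
      ...   | _ , _ , _ , only = v≢v′ (trans (only (symm vu)) (sym (only (symm v′u))))

      blocks! : ∀ vs → Unique vs → (∀ {v} → v ∈ vs → v ∈ P) →
          Unique (concat (map (λ v → v ∷ leaves v) vs))
      blocks! vs vs! sub =
        Uniqueₚ.concat⁺ (Allₚ.map⁺ (All.tabulate (block! ∘ sub))) (AllPairsₚ.map⁺ (pairs vs vs! sub))
        where
        pairs : ∀ vs → Unique vs → (∀ {v} → v ∈ vs → v ∈ P) →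
                AllPairs (λ v v′ → ∀ {u} → ¬ (u ∈ v ∷ leaves v × u ∈ v′ ∷ leaves v′)) vs
        pairs []       _          _   = []
        pairs (v ∷ vs) (v∉ ∷ vs!) sub =
          All.tabulate (λ v′∈ → blocks-disjoint (sub (here refl)) (sub (there v′∈)) (All.lookup v∉ v′∈))
          ∷ pairs vs vs! (sub ∘ there)

      block-∈ : ∀ vs {v u} → v ∈ vs → u ∈ v ∷ leaves v → u ∈ concat (map (λ v → v ∷ leaves v) vs)
      block-∈ vs v∈ u∈ = ∈-concat⁺′ u∈ (∈-map⁺ (λ v → v ∷ leaves v) v∈)

    layout : ∀ {c vs w} → P ≡ c ∷ vs → spineWord (shape P) ≡ true ∷ w → Layout G w
    layout {c} {vs} refl word≡ = record
      { root     = c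
      ; tokens   = leafTokens c ++ spineTokens vs
      ; word     = proj₂ (∷-injective (trans (spineTokens-word P) word≡))
      ; unique   = subst Unique (sym (spineTokens-names P)) (blocks! P unique id)
      ; complete = λ v → subst (v ∈_) (sym (spineTokens-names P)) (every v)
      ; adj⇒     = edge
      ; ⇒adj     = λ e∈ → Sum.[ proj₁ ∘ leaves-∈ ∘ proj₂ , adjacent ] (spine-edges⇒ c vs e∈)
      }
      where
      every : ∀ v → v ∈ concat (map (λ v → v ∷ leaves v) P)
      every v with v ∈? P
      ... | yes v∈ = block-∈ P v∈ (here refl)
      ... | no  v∉ with leaf v v∉
      ...   | p , p∈ , pv , _ = block-∈ P p∈ (there (∈-leavesAt pv v∉))
      edge : ∀ {u v} → Adj u v → (u , v) ∈ spine-edges c vs ⊎ (v , u) ∈ spine-edges c vs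
      edge {u} {v} uv with u ∈? P | v ∈? P
      ... | yes u∈ | yes v∈ = Sum.map (path-edge c vs) (path-edge c vs) (path u∈ v∈ uv)
      ... | yes u∈ | no  v∉ = inj₁ (leaf-edge c vs u∈ (∈-leavesAt uv v∉))
      ... | no  u∉ | yes v∈ = inj₂ (leaf-edge c vs v∈ (∈-leavesAt (symm uv) u∉))
      ... | no  u∉ | no  v∉ with leaf u u∉
      ...   | p , p∈ , _ , only = contradiction (subst (_∈ P) (sym (only uv)) p∈) v∉

  spine-layout : ∀ {P} → Spine P → ∀ {w} → spineWord (shape P) ≡ true ∷ w → Layout G w
  spine-layout {[]}     S ()
  spine-layout {c ∷ vs} S word≡ = layout S refl word≡

-- From the path of inner edges to a spine

nonempty-length : ∀ {as : List A} {a} → a ∈ as → ∃[ i ] length as ≡ suc i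
nonempty-length {as = _ ∷ as} _ = length as , refl

at-least-two : ∀ (as : List A) {n} → length as ≡ suc (suc n) → ∃[ a ] ∃[ b ] ∃[ bs ] as ≡ a ∷ b ∷ bs
at-least-two (a ∷ b ∷ bs) _ = a , b , bs , refl

length-1-≡ : ∀ {as : List A} {a b} → length as ≡ 1 → a ∈ as → b ∈ as → a ≡ b
length-1-≡ {as = _ ∷ []} _ (here refl) (here refl) = refl

constant-length-1 : ∀ {as : List A} {a} → Unique as → a ∈ as → (∀ {b} → b ∈ as → b ≡ a) → length as ≡ 1
constant-length-1 {as = _ ∷ []}     _               _ _  = refl
constant-length-1 {as = b ∷ c ∷ as} ((b≢c ∷ _) ∷ _) _ eq =
  contradiction (trans (eq (here refl)) (sym (eq (there (here refl))))) b≢c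

module _ {G : Graph} where
  open Graph G

  leaf-neighbour-unique : ∀ {v u y} → Leaf v → Adj v u → Adj v y → u ≡ y
  leaf-neighbour-unique {v} leaf vu vy =
    length-1-≡ leaf (∈-filter⁺ (adj? v) (∈-allFin _) vu) (∈-filter⁺ (adj? v) (∈-allFin _) vy)

  second-neighbour : ∀ {v u} → ¬ Leaf v → Adj v u → ∃[ y ] y ≢ u × Adj v y
  second-neighbour {v} {u} ¬leaf vu with Finₚ.any? (λ y → ¬? (y ≟ᶠ u) ×-dec adj? v y)
  ... | yes found = found
  ... | no  none  = contradiction
    (constant-length-1 (Uniqueₚ.filter⁺ (adj? v) (Uniqueₚ.allFin⁺ order))
      (∈-filter⁺ (adj? v) (∈-allFin u) vu) only) ¬leaf
    where
    only : ∀ {y} → y ∈ filter (adj? v) (allFin order) → y ≡ u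
    only {y} y∈ = decidable-stable (y ≟ᶠ u) λ y≢u →
      none (y , y≢u , proj₂ (∈-filter⁻ (adj? v) {xs = allFin order} y∈))

  module _ (connected : Connected G) {P : List Vertex} {v₀ : Vertex} (v₀∈P : v₀ ∈ P)
    (closed : ∀ {u v} → u ∈ P → Adj u v → v ∈ P ⊎ Leaf v) where

    private
      Near : Vertex → Set
      Near u = u ∈ P ⊎ (Leaf u × ∃[ v ] v ∈ P × Adj v u)

      near-step : ∀ {u v} → Near u → Adj u v → Near v
      near-step {u} (inj₁ u∈) uv with closed u∈ uv
      ... | inj₁ v∈   = inj₁ v∈
      ... | inj₂ leaf = inj₂ (leaf , u , u∈ , uv)
      near-step (inj₂ (leaf , p , p∈ , pu)) uv =
        inj₁ (subst (_∈ P) (leaf-neighbour-unique leaf (symm pu) uv) p∈)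

      near-star : ∀ {u v} → Near u → Star Adj u v → Near v
      near-star near ε        = near
      near-star near (uv ◅ s) = near-star (near-step near uv) s

    -- The vertices of P and the leaves attached to P are closed under adjacency, since the only
    -- neighbour of such a leaf lies in P. By connectedness they are all vertices.
    leaf-outside : ∀ u → u ∉ P → ∃[ v ] v ∈ P × Adj v u × (∀ {y} → Adj u y → y ≡ v)
    leaf-outside u u∉ with near-star (inj₁ v₀∈P) (connected v₀ u)
    ... | inj₁ u∈                    = contradiction u∈ u∉
    ... | inj₂ (leaf , v , v∈ , vu) = v , v∈ , vu , λ uy → leaf-neighbour-unique leaf uy (symm vu)

  InnerPath : List Vertex → Set
  InnerPath p = Unique p × (∀ u v → InnerEdge G u v ⇔ (Consecutive G p u v ⊎ Consecutive G p v u))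

  innerPath-reverse : ∀ {p} → InnerPath p → InnerPath (reverse p)
  innerPath-reverse (p! , inner) = reverse-unique p! , λ u v → mk⇔
    (Sum.map consecutive-reverse consecutive-reverse ∘ Sum.swap ∘ Equivalence.to (inner u v))
    (Equivalence.from (inner u v) ∘ Sum.swap ∘ Sum.map consecutive-reverse⁻ consecutive-reverse⁻)

  module _ {c d : Vertex} {p : List Vertex} (path : InnerPath (c ∷ d ∷ p)) where

    private
      P : List Vertex
      P = c ∷ d ∷ p
      P! : Unique P
      P! = proj₁ path
      inner⇒ : ∀ {u v} → InnerEdge G u v → Consecutive G P u v ⊎ Consecutive G P v u
      inner⇒ = Equivalence.to (proj₂ path _ _)
      ⇒inner : ∀ {u v} → Consecutive G P u v ⊎ Consecutive G P v u → InnerEdge G u v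
      ⇒inner = Equivalence.from (proj₂ path _ _)

    path-inner : ∀ {u} → u ∈ P → ¬ Leaf u
    path-inner u∈ with consecutive-exists p u∈
    ... | v , uv = proj₁ (proj₂ (⇒inner uv))

    path-closed : ∀ {u v} → u ∈ P → Adj u v → v ∈ P ⊎ Leaf v
    path-closed {v = v} u∈ uv with degree v ℕₚ.≟ 1
    ... | yes leaf = inj₂ leaf
    ... | no ¬leaf = inj₁ (Sum.[ proj₂ ∘ consecutive-∈ , proj₁ ∘ consecutive-∈ ]′
                            (inner⇒ (uv , path-inner u∈ , ¬leaf)))

    path-spine : Connected G → Spine G P
    path-spine connected = record
      { unique   = P!
      ; path     = λ u∈ v∈ uv → inner⇒ (uv , path-inner u∈ , path-inner v∈)
      ; adjacent = λ uv → proj₁ (⇒inner (inj₁ uv))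
      ; leaf     = leaf-outside connected (here refl) path-closed
      }

    -- The end c is not a leaf and so has a neighbour y other than d. If y were on the path, the
    -- inner edge from c to y would join consecutive vertices, but c is next to d only.
    head-leaf : ∃[ i ] length (leavesAt G P c) ≡ suc i
    head-leaf with second-neighbour (path-inner (here refl)) (proj₁ (⇒inner (inj₁ (consecutive-here {p = p}))))
    ... | y , y≢d , cy = nonempty-length (∈-leavesAt G cy y∉P)
      where
      c∉ : c ∉ d ∷ p
      c∉ = Uniqueₚ.Unique[x∷xs]⇒x∉xs P!
      y∉P : y ∉ P
      y∉P y∈ with inner⇒ (cy , path-inner (here refl) , path-inner y∈)
      ... | inj₁ cy′ with consecutive-inv cy′
      ...   | inj₁ (_ , y≡d) = y≢d y≡d
      ...   | inj₂ later     = c∉ (proj₁ (consecutive-∈ later))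
      y∉P y∈ | inj₂ yc with consecutive-inv yc
      ...   | inj₁ (_ , c≡d) = c∉ (here c≡d)
      ...   | inj₂ later     = c∉ (proj₂ (consecutive-∈ later))

  path-ends : ∀ {c d p} → InnerPath (c ∷ d ∷ p) → Ends (shape G (c ∷ d ∷ p))
  path-ends {c} {d} {p} path = from-reverse (at-least-two (reverse P) (length-reverse P))
    where
    P : List Vertex
    P = c ∷ d ∷ p
    head-shape : ∀ {c d p} → InnerPath (c ∷ d ∷ p) → ∃[ i ] ∃[ S ] shape G (c ∷ d ∷ p) ≡ suc i ∷ S
    head-shape {c} {d} {p} path =
      proj₁ (head-leaf path) , rest , cong (_∷ rest) (proj₂ (head-leaf path))
      where
      rest : List ℕ
      rest = map (length ∘ leavesAt G (c ∷ d ∷ p)) (d ∷ p)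
    from-reverse : ∃[ c′ ] ∃[ d′ ] ∃[ p′ ] reverse P ≡ c′ ∷ d′ ∷ p′ → Ends (shape G P)
    from-reverse (c′ , d′ , p′ , rev≡) = leafy
      (proj₂ (proj₂ (head-shape path)))
      (trans (sym (shape-reverse G P)) (trans (cong (shape G) rev≡)
        (proj₂ (proj₂ (head-shape (subst InnerPath rev≡ (innerPath-reverse path)))))))

  single-spine : Connected G → ∀ v → (∀ {u} → Adj v u → Leaf u) → Spine G (v ∷ [])
  single-spine connected v leaves = record
    { unique   = [] ∷ []
    ; path     = λ { (here refl) (here refl) vv → contradiction vv (irrefl refl) }
    ; adjacent = λ uv → contradiction uv consecutive-single
    ; leaf     = leaf-outside connected (here refl) λ { (here refl) vu → inj₂ (leaves vu) }
    }

  single-ends : ∀ v → Ends (shape G (v ∷ []))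
  single-ends v = ends (length (leavesAt G (v ∷ []) v))
    where
    ends : ∀ l → Ends (l ∷ [])
    ends zero    = single
    ends (suc i) = leafy refl refl

  -- Any vertex that is not a leaf is the centre of a star; this includes the single vertex of
  -- degree 0. If all vertices are leaves, any of them can serve as the centre.
  no-inner-edges : Tree G → (∀ {u v} → ¬ InnerEdge G u v) → ∃[ P ] Spine G P × Ends (shape G P)
  no-inner-edges tree none with Finₚ.any? (λ v → ¬? (degree v ℕₚ.≟ 1))
  ... | yes (v , ¬leaf) = v ∷ [] , single-spine (Tree.connected tree) v leaves , single-ends v
    where
    leaves : ∀ {u} → Adj v u → Leaf u
    leaves {u} vu = decidable-stable (degree u ℕₚ.≟ 1) λ ¬leaf′ → none (vu , ¬leaf , ¬leaf′)
  ... | no all-leaves = v ∷ [] , single-spine (Tree.connected tree) v (λ {u} _ → leaves u) , single-ends v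
    where
    v : Vertex
    v = Fin.fromℕ< (ℕ.>-nonZero⁻¹ order {{Tree.nonEmpty tree}})
    leaves : ∀ u → Leaf u
    leaves u = decidable-stable (degree u ℕₚ.≟ 1) λ ¬leaf → all-leaves (u , ¬leaf)

  caterpillar-spine : Caterpillar G → ∃[ P ] Spine G P × Ends (shape G P)
  caterpillar-spine (tree , [] , _ , inner) =
    no-inner-edges tree λ uv → case Equivalence.to (inner _ _) uv of λ
      { (inj₁ ([] , _ , ())) ; (inj₁ (_ ∷ _ , _ , ())) ; (inj₂ ([] , _ , ())) ; (inj₂ (_ ∷ _ , _ , ())) }
  -- A path with one vertex has no edges, and its vertex need not be the centre of the star; so the
  -- spine is chosen anew.
  caterpillar-spine (tree , c ∷ [] , _ , inner) =
    no-inner-edges tree λ uv → Sum.[ consecutive-single , consecutive-single ]′ (Equivalence.to (inner _ _) uv)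
  caterpillar-spine (tree , c ∷ d ∷ p , path) =
    c ∷ d ∷ p , path-spine path (Tree.connected tree) , path-ends path

  caterpillar-layouts : Caterpillar G →
    Layout G [] ⊎ Layout G (false ∷ []) ⊎ ∃[ u ] Layout G (wrap u) × Layout G (wrap (reverse u))
  caterpillar-layouts cat with caterpillar-spine cat
  ... | P , S , ends with spineWord-ends ends
  ...   | inj₁ eq                    = inj₁ (spine-layout G S eq)
  ...   | inj₂ (inj₁ eq)             = inj₂ (inj₁ (spine-layout G S eq))
  ...   | inj₂ (inj₂ (u , eq , rev)) = inj₂ (inj₂ (u , spine-layout G S eq ,
            spine-layout G (spine-reverse G S) (trans (cong spineWord (shape-reverse G P)) rev)))

-- Reconstruction

coeff-↭ : ∀ p {l m} → l ↭ m → coeff p l ≡ coeff p m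
coeff-↭ []            ρ = refl
coeff-↭ ((c , k) ∷ p) {l} {m} ρ with k ↭? l | k ↭? m
... | yes _ | yes _ = cong (_+_ c) (coeff-↭ p ρ)
... | yes σ | no ¬σ = contradiction (↭-trans σ ρ) ¬σ
... | no ¬σ | yes σ = contradiction (↭-trans σ (↭-sym ρ)) ¬σ
... | no _  | no _  = coeff-↭ p ρ

coeff-absent : ∀ p {m} → ¬ Any (λ t → proj₂ t ↭ m) p → coeff p m ≡ 0ℤ
coeff-absent []            none = refl
coeff-absent ((c , k) ∷ p) {m} none with k ↭? m
... | yes σ = contradiction (here σ) none
... | no _  = coeff-absent p (none ∘ there)

coeff-present : ∀ p {m} → coeff p m ≢ 0ℤ → Any (λ t → proj₂ t ↭ m) p
coeff-present p {m} ≢0 =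
  decidable-stable (Any.any? (λ t → proj₂ t ↭? m) p) λ none → ≢0 (coeff-absent p none)

-- It suffices to compare the coefficients of the monomials that are present.
_≈ₚ?_ : ∀ p q → Dec (p ≈ₚ q)
p ≈ₚ? q = map′ everywhere (λ eq → All.tabulate λ {t} _ → eq (proj₂ t))
               (All.all? (λ t → coeff p (proj₂ t) ≟ coeff q (proj₂ t)) (p ++ q))
  where
  everywhere : All (λ t → coeff p (proj₂ t) ≡ coeff q (proj₂ t)) (p ++ q) → p ≈ₚ q
  everywhere eqs m = case Any.any? (λ t → proj₂ t ↭? m) (p ++ q) of λ
    { (yes present) → at-term eqs present
    ; (no  absent)  → trans (coeff-absent p (absent ∘ Anyₚ.++⁺ˡ)) (sym (coeff-absent q (absent ∘ Anyₚ.++⁺ʳ p)))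
    }
    where
    at-term : ∀ {ts} → All (λ t → coeff p (proj₂ t) ≡ coeff q (proj₂ t)) ts →
              Any (λ t → proj₂ t ↭ m) ts → coeff p m ≡ coeff q m
    at-term (eq ∷ _)   (here ρ)  = trans (coeff-↭ p (↭-sym ρ)) (trans eq (coeff-↭ q ρ))
    at-term (_  ∷ eqs) (there i) = at-term eqs i

allWords : ℕ → List (List Bool)
allWords zero    = [] ∷ []
allWords (suc n) = map (true ∷_) (allWords n) ++ map (false ∷_) (allWords n)

∈-allWords : ∀ u → u ∈ allWords (length u)
∈-allWords []          = here refl
∈-allWords (true  ∷ u) = ∈-++⁺ˡ (∈-map⁺ (true ∷_) (∈-allWords u))
∈-allWords (false ∷ u) = ∈-++⁺ʳ (map (true ∷_) (allWords (length u))) (∈-map⁺ (false ∷_) (∈-allWords u))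

-- With one or two vertices the word is too short to have distinct first and last letters, as `wrap`
-- requires.
codes : ℕ → List (List Bool)
codes 0                   = []
codes 1                   = [] ∷ []
codes 2                   = (false ∷ []) ∷ []
codes (suc (suc (suc n))) = map wrap (allWords n)

indices : Monomial → List ℕ
indices []        = []
indices (z   ∷ m) = indices m
indices (x n ∷ m) = n ∷ indices m

-- As `p` may contain terms that cancel, every index occurring in it is tried as the number of
-- vertices. The right one occurs because x_n has a nonzero coefficient.
candidates : Poly → List (List Bool)
candidates p = concatMap codes (concatMap (indices ∘ proj₂) p)

matches? : ∀ p w → Dec (p ≈ₚ U (caterpillar w))
matches? p w = p ≈ₚ? U (caterpillar w)

matching : Poly → List (List Bool)
matching p = filter (matches? p) (candidates p)

reconstruct : Poly → Graph
-- The default `[]` answers the polynomials that match no candidate.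
reconstruct p = caterpillar (fromMaybe [] (head (matching p)))

-- Only the choice that cuts nothing contributes to x_n, so this coefficient reveals the number of
-- vertices.
cutSum-order : ∀ n w → cutSum (termCoeff (x n ∷ [])) 1 w ≡ δ n (suc (length w))
cutSum-order n w = begin
  cutSum (termCoeff (x n ∷ [])) 1 w   ≡⟨ cutSum-cong term 1 w ⟨
  cutSum (indicator (n ∷ [])) 1 w     ≡⟨ cutSum-indicator (n ∷ []) 1 w ⟩
  occurrences (n ∷ []) 1 w            ≡⟨ occurrences-[ n ] 1 w ⟩
  δ n (suc (length w))                ∎
  where
  one : indicator (n ∷ []) (n ∷ []) ≡ 1ℤ
  one = trans (*-identityʳ (δ n n)) (δ-refl n)
  term : ∀ s → indicator (n ∷ []) s ≡ termCoeff (x n ∷ []) s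
  term s = trans
    (symmetric-term (n ∷ []) (λ s ρ → cong (indicator (n ∷ [])) (↭-singleton-inv ρ))
      (λ s ¬ρ → indicator-≢ (n ∷ []) s λ { refl → ¬ρ ↭-refl }) s)
    (trans (cong (_* termCoeff (x n ∷ []) s) one) (*-identityˡ (termCoeff (x n ∷ []) s)))

SameCuts : List Bool → List Bool → Set
SameCuts w w′ = ∀ m → cutSum (termCoeff m) 1 w ≡ cutSum (termCoeff m) 1 w′

same-length : ∀ {w w′} → SameCuts w w′ → length w ≡ length w′
same-length {w} {w′} same = decidable-stable (length w ℕₚ.≟ length w′) λ ≢ →
  case (begin
    1ℤ                                            ≡⟨ δ-refl n ⟨
    δ n n                                         ≡⟨ cutSum-order n w ⟨
    cutSum (termCoeff (x n ∷ [])) 1 w             ≡⟨ same (x n ∷ []) ⟩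
    cutSum (termCoeff (x n ∷ [])) 1 w′            ≡⟨ cutSum-order n w′ ⟩
    δ n (suc (length w′))                         ≡⟨ δ-≢ (≢ ∘ ℕₚ.suc-injective) ⟩
    0ℤ                                            ∎) of λ ()
  where n = suc (length w)

codes-form : ∀ n {w} → w ∈ codes n → w ≡ [] ⊎ w ≡ false ∷ [] ⊎ ∃[ u ] w ≡ wrap u
codes-form 1                   (here eq) = inj₁ eq
codes-form 2                   (here eq) = inj₂ (inj₁ eq)
codes-form (suc (suc (suc n))) w∈ with ∈-map⁻ wrap w∈
... | u , _ , eq = inj₂ (inj₂ (u , eq))

wrap-∈-codes : ∀ u → wrap u ∈ codes (suc (length (wrap u)))
wrap-∈-codes u = subst (λ n → wrap u ∈ codes (suc n)) (sym (length-wrap u)) (∈-map⁺ wrap (∈-allWords u))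

∈-indices : ∀ {n m} → m ↭ x n ∷ [] → n ∈ indices m
∈-indices ρ with refl ← ↭-singleton-inv ρ = here refl

CaterpillarWord : List Bool → Set
CaterpillarWord w = w ≡ [] ⊎ w ≡ false ∷ [] ⊎ ∃[ u ] w ≡ wrap u

Matches : Poly → List Bool → Set
Matches p w = p ≈ₚ U (caterpillar w)

module _ {T : Graph} {w : List Bool} (layout : Layout T w) (w∈codes : w ∈ codes (suc (length w)))
         {p : Poly} (p≈ : p ≈ₚ U T) where

  private
    n = suc (length w)

    U≡ : ∀ m → coeff p m ≡ cutSum (termCoeff m) 1 w
    U≡ m = trans (p≈ m) (U-layout T layout m)

    order-present : Any (λ t → proj₂ t ↭ x n ∷ []) p
    order-present = coeff-present p λ ≡0 → case trans (sym (δ-refl n))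
      (trans (sym (cutSum-order n w)) (trans (sym (U≡ (x n ∷ []))) ≡0)) of λ ()

    w∈candidates : w ∈ candidates p
    w∈candidates = ∈-concatMap⁺ codes (Any.map (λ { refl → w∈codes })
      (∈-concatMap⁺ (indices ∘ proj₂) (Any.map ∈-indices order-present)))

    w-matches : Matches p w
    w-matches m = trans (U≡ m) (sym (U-layout (caterpillar w) (caterpillar-layout w) m))

    sameCuts : ∀ {w′} → Matches p w′ → SameCuts w′ w
    sameCuts {w′} p≈′ m =
      trans (sym (U-layout (caterpillar w′) (caterpillar-layout w′) m)) (trans (sym (p≈′ m)) (U≡ m))

    candidate-word : ∀ {w′} → w′ ∈ candidates p → CaterpillarWord w′
    candidate-word w′∈ with Any.satisfied (∈-concatMap⁻ codes {xs = concatMap (indices ∘ proj₂) p} w′∈)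
    ... | k , w′∈codes = codes-form k w′∈codes

  reconstruct-found : ∃[ w′ ] reconstruct p ≡ caterpillar w′ × CaterpillarWord w′ × SameCuts w′ w
  reconstruct-found = go (matching p) refl
    where
    go : ∀ ws → matching p ≡ ws →
         ∃[ w′ ] reconstruct p ≡ caterpillar w′ × CaterpillarWord w′ × SameCuts w′ w
    go []        eq = case subst (w ∈_) eq (∈-filter⁺ (matches? p) w∈candidates w-matches) of λ ()
    go (w′ ∷ ws) eq = w′ , cong (λ ws → caterpillar (fromMaybe [] (head ws))) eq ,
                      candidate-word (proj₁ found) , sameCuts {w′} (proj₂ found)
      where
      found : w′ ∈ candidates p × Matches p w′
      found = ∈-filter⁻ (matches? p) {xs = candidates p} (subst (w′ ∈_) (sym eq) (here refl))

-- Words of the three forms have lengths 0, 1 and at least 2, so by `same-length` the forms agree.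
-- In the third form `word-determined` leaves `w` and its reversal, and `T` has layouts for both.
identify : ∀ {T w w′} → Layout T w → CaterpillarWord w′ → SameCuts w′ w →
           (∀ u → w ≡ wrap u → Layout T (wrap (reverse u))) → CaterpillarWord w → Layout T w′
identify layout (inj₁ refl) same _ (inj₁ refl) = layout
identify layout (inj₂ (inj₁ refl)) same _ (inj₂ (inj₁ refl)) = layout
identify layout (inj₂ (inj₂ (u′ , refl))) same reversed (inj₂ (inj₂ (u , refl))) =
  Sum.[ (λ { refl → layout }) , (λ { refl → reversed u refl }) ]′ (word-determined u′ u lengths same)
  where
  lengths : length u′ ≡ length u
  lengths = ℕₚ.suc-injective (ℕₚ.suc-injective
    (trans (sym (length-wrap u′)) (trans (same-length {wrap u′} {wrap u} same) (length-wrap u))))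
identify layout (inj₁ refl) same _ (inj₂ (inj₁ refl)) with () ← same-length {[]} {false ∷ []} same
identify layout (inj₂ (inj₁ refl)) same _ (inj₁ refl) with () ← same-length {false ∷ []} {[]} same
identify layout (inj₁ refl) same _ (inj₂ (inj₂ (u , refl))) with () ← same-length {[]} {wrap u} same
identify layout (inj₂ (inj₂ (u , refl))) same _ (inj₁ refl) with () ← same-length {wrap u} {[]} same
identify layout (inj₂ (inj₁ refl)) same _ (inj₂ (inj₂ (u , refl)))
  with () ← trans (same-length {false ∷ []} {wrap u} same) (length-wrap u)
identify layout (inj₂ (inj₂ (u , refl))) same _ (inj₂ (inj₁ refl))
  with () ← trans (sym (length-wrap u)) (same-length {wrap u} {false ∷ []} same)

wrap-injective : ∀ {u u′} → wrap u ≡ wrap u′ → u ≡ u′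
wrap-injective {u} {u′} eq = proj₁ (∷ʳ-injective u u′ (proj₂ (∷-injective eq)))

reconstruct-≅ : ∀ {T w} → Layout T w → w ∈ codes (suc (length w)) → CaterpillarWord w →
                (∀ u → w ≡ wrap u → Layout T (wrap (reverse u))) → ∀ p → p ≈ₚ U T → reconstruct p ≅ T
reconstruct-≅ {T} {w} layout w∈ w-word reversed p p≈ = conclude (reconstruct-found layout w∈ {p} p≈)
  where
  conclude : ∃[ w′ ] reconstruct p ≡ caterpillar w′ × CaterpillarWord w′ × SameCuts w′ w →
      reconstruct p ≅ T
  conclude (w′ , eq , w′-word , same) =
    subst (_≅ T) (sym eq) (layout-≅ (identify layout w′-word same reversed w-word))

theorem2 : Σ[ reconstruct ∈ (Poly → Graph) ]
    (∀ (T : Graph) → Caterpillar T → ∀ (p : Poly) → p ≈ₚ U T → reconstruct p ≅ T)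
theorem2 = reconstruct , λ T cat p p≈ → case caterpillar-layouts cat of λ
  { (inj₁ layout)                        →
      reconstruct-≅ layout (here refl) (inj₁ refl) (λ _ ()) p p≈
  ; (inj₂ (inj₁ layout))                 →
      reconstruct-≅ layout (here refl) (inj₂ (inj₁ refl)) (λ { [] () ; (_ ∷ _) () }) p p≈
  ; (inj₂ (inj₂ (u , layout , layoutʳ))) →
      reconstruct-≅ layout (wrap-∈-codes u) (inj₂ (inj₂ (u , refl)))
        (λ u′ eq → subst (λ u → Layout T (wrap (reverse u))) (wrap-injective eq) layoutʳ) p p≈
  }
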